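{- Given a directed acyclic graph $G$ with $n$ vertices and $m$ arcs, and $k$ pairs of vertices $(u_1,v_1),\dots,(u_k,v_k)$ of $G$, all junctions of all the $k$ given pairs can be found in $O(n(m+k))$ time. The space used is $O(m)$ if the junctions are printed out during the execution, and $O(nk+m)$ if all junctions of the $k$ given pairs are stored.
   Context: All paths are directed, and a single vertex counts as a (trivial) directed path. For distinct vertices $u,v$ of a directed acyclic graph $G$, a vertex $s\in G$ is a junction of $u,v$ if there are internally disjoint directed paths $P$ from $s$ to $u$ and $Q$ from $s$ to $v$ in $G$, where internally disjoint means that $s$ is the only vertex common to $P$ and $Q$. In particular, if $u$ is a proper ancestor of $v$, then $u$ is a junction of $u,v$. By convention no vertex is a junction of a pair $u,u$. -}

module Defs where

open import Data.Bool.Base using (if_then_else_)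
open import Data.Fin.Base using (Fin; toℕ)
open import Data.List.Base as List using (List; []; _∷_; _++_)
open import Data.List.Membership.Propositional using (_∈_)
open import Data.List.Relation.Unary.Unique.Propositional using (Unique)
open import Data.Nat.Base using (ℕ; zero; suc; _+_; _*_; _∸_; _^_; _≤_; _<_; _≡ᵇ_)
open import Data.Product.Base using (Σ-syntax; ∃-syntax; _×_; _,_; proj₁; proj₂)
open import Data.Vec.Base as Vec using (Vec)
import Data.Vec.Membership.Propositional as Vec
import Data.Vec.Relation.Unary.Unique.Propositional as Vec
open import Function.Bundles using (_⇔_)
open import Relation.Binary.Construct.Closure.ReflexiveTransitive using (Star; ε; _◅_)
open import Relation.Binary.Construct.Closure.Transitive using (TransClosure)
open import Relation.Binary.PropositionalEquality using (_≡_; _≢_)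
open import Relation.Nullary.Negation using (¬_)

------------------------------------------------------------------------
-- Directed acyclic graphs and junctions

record DAG (n m : ℕ) : Set where
  field
    arcs     : Vec (Fin n × Fin n) m
    distinct : Vec.Unique arcs

  Arc : Fin n → Fin n → Set
  Arc u v = (u , v) Vec.∈ arcs

  field
    acyclic : ∀ {v} → ¬ TransClosure Arc v v

module _ {n m : ℕ} (G : DAG n m) where
  open DAG G using (Arc)

  vertices : ∀ {u v} → Star Arc u v → List (Fin n)
  vertices {u} ε       = u ∷ []
  vertices {u} (_ ◅ w) = u ∷ vertices w

  record Path (u v : Fin n) : Set where
    field
      walk   : Star Arc u v
      simple : Unique (vertices walk)

  infix 4 _on_

  _on_ : ∀ {u v} → Fin n → Path u v → Set
  x on P = x ∈ vertices (Path.walk P)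

  Junction : Fin n → Fin n → Fin n → Set
  Junction u v s =
    u ≢ v ×
    Σ[ P ∈ Path s u ] Σ[ Q ∈ Path s v ] (∀ x → x on P → x on Q → x ≡ s)

------------------------------------------------------------------------
-- A word RAM programmed in a structured language.  It has a read-only
-- random-access input, a working memory and a write-only output.  A program
-- is a fixed finite text, so it mentions only finitely many registers and its
-- expressions have bounded size: charging one time unit per executed command
-- or evaluated condition, and not counting registers as space, only affects
-- constant factors.

data Expr : Set where
  lit           : ℕ → Expr
  reg           : ℕ → Expr
  inp           : Expr → Expr
  mem           : Expr → Expr
  _⊕_ _⊖_ _⊗_ : Expr → Expr → Expr

data Cmd : Set where
  skip       : Cmd
  _≔_        : ℕ → Expr → Cmd
  store      : Expr → Expr → Cmd
  print      : Expr → Expr → Cmd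
  _⨟_        : Cmd → Cmd → Cmd
  ifNonzero  : Expr → Cmd → Cmd → Cmd
  whileNonzero : Expr → Cmd → Cmd

infixl 6 _⊕_ _⊖_
infixl 7 _⊗_
infix  5 _≔_
infixr 4 _⨟_

record State : Set where
  constructor ⟨_,_,_⟩
  field
    registers : ℕ → ℕ
    memory    : ℕ → ℕ
    -- Most recently printed record first.
    output    : List (ℕ × ℕ)

open State public

initial : State
initial = ⟨ (λ _ → 0) , (λ _ → 0) , [] ⟩

infixl 9 _[_↦_]

_[_↦_] : (ℕ → ℕ) → ℕ → ℕ → (ℕ → ℕ)
(f [ x ↦ v ]) y = if y ≡ᵇ x then v else f y

-- Positions past the end read as 0.
nth : List ℕ → ℕ → ℕ
nth []       _       = 0
nth (x ∷ _)  zero    = x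
nth (_ ∷ xs) (suc i) = nth xs i

-- The machine has memory cells 0, …, cells ∸ 1, and every cell and register
-- holds a number below wordBound.  A program that addresses a cell outside
-- this range or computes a larger number gets stuck.
module Machine (input : List ℕ) (cells wordBound : ℕ) where

  eval : Expr → State → ℕ
  eval (lit x)  σ = x
  eval (reg x)  σ = registers σ x
  eval (inp e)  σ = nth input (eval e σ)
  eval (mem e)  σ = memory σ (eval e σ)
  eval (e ⊕ e′) σ = eval e σ + eval e′ σ
  eval (e ⊖ e′) σ = eval e σ ∸ eval e′ σ
  eval (e ⊗ e′) σ = eval e σ * eval e′ σ

  Safe : Expr → State → Set
  Safe (lit x)    σ = x < wordBound
  Safe (reg x)    σ = registers σ x < wordBound
  Safe (inp e)    σ = Safe e σ × nth input (eval e σ) < wordBound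
  Safe (mem e)    σ = Safe e σ × eval e σ < cells × memory σ (eval e σ) < wordBound
  Safe (e ⊕ e′)   σ = Safe e σ × Safe e′ σ × eval e σ + eval e′ σ < wordBound
  Safe (e ⊖ e′)   σ = Safe e σ × Safe e′ σ
  Safe (e ⊗ e′)   σ = Safe e σ × Safe e′ σ × eval e σ * eval e′ σ < wordBound

  infix 3 _,_⇓[_]_

  -- c , σ ⇓[ t ] σ′: started in σ, the command c halts in σ′ after t time units.
  data _,_⇓[_]_ : Cmd → State → ℕ → State → Set where

    skip : ∀ {σ} → skip , σ ⇓[ 1 ] σ

    assign : ∀ {x e σ} → Safe e σ →
      x ≔ e , σ ⇓[ 1 ]
      ⟨ registers σ [ x ↦ eval e σ ] , memory σ , output σ ⟩

    store : ∀ {a e σ} → Safe a σ → eval a σ < cells → Safe e σ →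
      store a e , σ ⇓[ 1 ]
      ⟨ registers σ , memory σ [ eval a σ ↦ eval e σ ] , output σ ⟩

    print : ∀ {e e′ σ} → Safe e σ → Safe e′ σ →
      print e e′ , σ ⇓[ 1 ]
      ⟨ registers σ , memory σ , (eval e σ , eval e′ σ) ∷ output σ ⟩

    seq : ∀ {c c′ σ σ′ σ″ t t′} →
      c , σ ⇓[ t ] σ′ → c′ , σ′ ⇓[ t′ ] σ″ →
      c ⨟ c′ , σ ⇓[ t + t′ ] σ″

    if-nonzero : ∀ {e c c′ σ σ′ t} → Safe e σ → eval e σ ≢ 0 →
      c , σ ⇓[ t ] σ′ →
      ifNonzero e c c′ , σ ⇓[ suc t ] σ′

    if-zero : ∀ {e c c′ σ σ′ t} → Safe e σ → eval e σ ≡ 0 →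
      c′ , σ ⇓[ t ] σ′ →
      ifNonzero e c c′ , σ ⇓[ suc t ] σ′

    while-nonzero : ∀ {e c σ σ′ σ″ t t′} → Safe e σ → eval e σ ≢ 0 →
      c , σ ⇓[ t ] σ′ → whileNonzero e c , σ′ ⇓[ t′ ] σ″ →
      whileNonzero e c , σ ⇓[ suc (t + t′) ] σ″

    while-zero : ∀ {e c σ} → Safe e σ → eval e σ ≡ 0 →
      whileNonzero e c , σ ⇓[ 1 ] σ

------------------------------------------------------------------------
-- The problem of finding all junctions of k given pairs

Pairs : ℕ → ℕ → Set
Pairs n k = Vec (Fin n × Fin n) k

-- n, m, k, then the endpoints of the arcs, then the members of the pairs.
encode : ∀ {n m k} → DAG n m → Pairs n k → List ℕ
encode {n} {m} {k} G ps =
  n ∷ m ∷ k ∷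
  List.concatMap (λ (u , v) → toℕ u ∷ toℕ v ∷ [])
    (Vec.toList (DAG.arcs G) ++ Vec.toList ps)

module _ {n m k : ℕ} (G : DAG n m) (ps : Pairs n k) where

  JunctionOfPair : Fin k → Fin n → Set
  JunctionOfPair i = Junction G (proj₁ (Vec.lookup ps i)) (proj₂ (Vec.lookup ps i))

  -- The records printed are, in some order and each exactly once, the pairs
  -- (i , s) such that s is a junction of the i-th given pair.
  PrintsJunctions : State → Set
  PrintsJunctions σ =
    ∃[ xs ] Unique xs
      × (∀ i s → (i , s) ∈ xs ⇔ JunctionOfPair i s)
      × output σ ≡ List.map (λ (i , s) → toℕ i , toℕ s) xs

  -- Register 0 holds the base address of k consecutive blocks of n + 1 cells.
  -- The i-th block holds the number of junctions of the i-th pair followed by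
  -- these junctions, in some order and each exactly once.
  StoresJunctions : (cells : ℕ) → State → Set
  StoresJunctions cells σ =
    base + k * suc n ≤ cells
      × (∀ i → ∃[ xs ] Unique xs
          × (∀ s → s ∈ xs ⇔ JunctionOfPair i s)
          × memory σ (block i) ≡ List.length xs
          × (∀ j → memory σ (suc (block i) + toℕ j) ≡ toℕ (List.lookup xs j)))
    where
    base : ℕ
    base = registers σ 0

    block : Fin k → ℕ
    block i = base + toℕ i * suc n

-- Words of O(log (n + m + k)) bits.
wordBound : (K n m k : ℕ) → ℕ
wordBound K n m k = (n + m + k + 2) ^ K

-- The summand 1 lets O(f) allow a constant where f vanishes (for instance on
-- the empty graph); wherever f is positive it is absorbed by the constant K.
_·O_ : ℕ → ℕ → ℕ
K ·O f = K * (f + 1)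

infix 6 _·O_

-- Started on the input (G , ps) with the given number of memory cells, the
-- program halts within the given time in a state satisfying Post.
Solves : ∀ {n m k} → Cmd → (K time cells : ℕ) → DAG n m → Pairs n k → (State → Set) → Set
Solves {n} {m} {k} prog K time cells G ps Post =
  ∃[ t ] ∃[ σ ] prog , initial ⇓[ t ] σ × t ≤ time × Post σ
  where open Machine (encode G ps) cells (wordBound K n m k)

{-# OPTIONS --safe #-}
module Submission where

-- For one source s, scan the arcs so that the arcs entering a vertex come
-- before those leaving it, and label the vertices reachable from s: s is its
-- own label; another vertex inherits the label of its reachable predecessors
-- if they all have the same label and s is not among them, and is its own label
-- otherwise.  Then s is a junction of u and v if and only if both are reachable
-- and have different labels.
--
-- Indeed, the label of v lies on all walks from s to v, and only s has the label
-- s; so if distinct vertices u and v have the same label, it is a common vertex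
-- other than s of any two walks to u and v (`separated`).  Conversely, vertices
-- with different labels are reached by walks that meet only in s.  When an arc
-- from a to b is scanned, b is still a sink, hence lies on no walk to another
-- vertex, so appending the arc to a walk to a preserves disjointness.  If b
-- becomes its own label, then a is s, or a and b had different labels, one of
-- which differs from that of any given third vertex (module `Scan`).
-- `junction⇒labels` and `labels⇒junction` transfer this to paths of the graph.
--
-- One labelling costs O(m) steps if the vertices are numbered so that their
-- labels fit into O(m) cells.  Only the ends of arcs get a number, since other
-- vertices neither are junctions nor belong to pairs with junctions.  Numbers are
-- found by sequential search in O(n) steps, which is affordable once for
-- every end of an arc and every member of a pair.  As the numbers of the members
-- of all pairs do not fit into O(m) cells, the pairs are treated in batches of m
-- pairs.  For each batch the labelling is repeated for all of the at most n
-- sources, in O(n m) steps, and there are at most k / m + 1 batches, which gives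
-- O(n (m + k)) in total.  The arcs are sorted in n rounds of O(m) steps: each
-- round releases the arcs whose tails are entered by no unreleased arc, and an
-- arc left after n rounds would end a walk with more than n vertices
-- (`no-long-chain`).  A graph without arcs has no junctions and is treated
-- separately, because there O(n (m + k)) may be less than n.
--
-- The two programs differ only in the command executed for every junction found.
-- They are verified with triples that carry a time bound and speak about an
-- abstract state, in which memory is divided into nine arrays.

open import Defs
open import Data.Bool.Base using (true; false; if_then_else_; T)
open import Data.Empty using (⊥-elim)
open import Data.Fin.Base using (Fin; zero; suc; toℕ; fromℕ<)
open import Data.Fin.Properties using () renaming (_≟_ to _≟ᶠ_)
open import Data.Fin.Properties using (toℕ-injective; toℕ-fromℕ<; toℕ<n; injective⇒≤)
open import Data.List.Base as List using (List; []; _∷_; _++_; length)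
open import Data.List.Membership.Propositional using (_∈_; _∉_)
open import Data.List.Membership.Propositional.Properties using (∈-++⁻; ∈-++⁺ˡ; ∈-++⁺ʳ; ∈-lookup)
open import Data.List.Properties using (++-identityʳ; length-++; length-map; map-++)
open import Data.List.Relation.Unary.All as All using (All; []; _∷_)
open import Data.List.Relation.Unary.All.Properties using (¬Any⇒All¬)
open import Data.List.Relation.Unary.AllPairs using ([]; _∷_)
open import Data.List.Relation.Unary.Any using (here; there)
open import Data.List.Relation.Unary.Unique.Propositional using (Unique)
import Data.List.Relation.Unary.Unique.Propositional.Properties as Unique
open import Data.Nat.Base using (ℕ; zero; suc; _+_; _*_; _∸_; _^_; _≤_; _<_; _⊔_; _≡ᵇ_; _<ᵇ_; z≤n; s≤s; >-nonZero)
open import Data.Nat.Properties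
open import Data.Nat.DivMod using (_/_; _%_; m≡m%n+[m/n]*n; m%n<n; m/n*n≤m)
open import Data.Nat.Tactic.RingSolver using (solve-∀)
open import Data.Product.Base using (Σ-syntax; ∃₂; ∃-syntax; _×_; _,_; proj₁; proj₂; map₂)
open import Data.Sum.Base using (_⊎_; inj₁; inj₂)
open import Data.Unit.Base using (⊤; tt)
open import Data.Vec.Base as Vec using (Vec)
import Data.Vec.Membership.Propositional as Vec
import Data.Vec.Membership.Propositional.Properties as Vec
import Data.Vec.Relation.Unary.Any as VecAny
import Data.Vec.Relation.Unary.Any.Properties as VecAny
open import Function.Base using (_∘_; id; _$_; case_of_)
open import Function.Bundles using (_⇔_; mk⇔; module Equivalence)
open import Relation.Binary.Construct.Closure.ReflexiveTransitive using (Star; ε; _◅_; _◅◅_)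
open import Relation.Binary.Construct.Closure.Transitive using (TransClosure; [_]; _∷_)
open import Relation.Binary.PropositionalEquality using (_≡_; _≢_; refl; sym; trans; cong; cong₂; subst)
open import Relation.Binary.Definitions using (tri<; tri≈; tri>)
open import Relation.Nullary.Decidable.Core using (Dec; yes; no)
open import Relation.Nullary.Negation using (¬_; contradiction)

------------------------------------------------------------------------
-- Functions, lists and arithmetic

module _ (f : ℕ → ℕ) where

  ↦-here : ∀ x v → (f [ x ↦ v ]) x ≡ v
  ↦-here x v with x ≡ᵇ x in eq
  ... | true  = refl
  ... | false = ⊥-elim (subst T eq (≡⇒≡ᵇ x x refl))

  ↦-there : ∀ {x y} v → y ≢ x → (f [ x ↦ v ]) y ≡ f y
  ↦-there {x} {y} v y≢x with y ≡ᵇ x in eq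
  ... | true  = contradiction (≡ᵇ⇒≡ y x (subst T (sym eq) tt)) y≢x
  ... | false = refl

-- A list read as a total function with a default value, and its update.
module _ {A : Set} where

  at : A → List A → ℕ → A
  at d []       _       = d
  at d (x ∷ _)  zero    = x
  at d (_ ∷ xs) (suc i) = at d xs i

  set : A → List A → ℕ → A → List A
  set d []       zero    v = v ∷ []
  set d []       (suc i) v = d ∷ set d [] i v
  set d (_ ∷ xs) zero    v = v ∷ xs
  set d (x ∷ xs) (suc i) v = x ∷ set d xs i v

  at-set : ∀ d xs i v j → at d (set d xs i v) j ≡ (if j ≡ᵇ i then v else at d xs j)
  at-set d []       zero    v zero    = refl
  at-set d []       zero    v (suc j) = refl
  at-set d []       (suc i) v zero    = refl
  at-set d []       (suc i) v (suc j) = at-set d [] i v j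
  at-set d (x ∷ xs) zero    v zero    = refl
  at-set d (x ∷ xs) zero    v (suc j) = refl
  at-set d (x ∷ xs) (suc i) v zero    = refl
  at-set d (x ∷ xs) (suc i) v (suc j) = at-set d xs i v j

lookup-injective : ∀ {A : Set} {xs : List A} → Unique xs →
  ∀ i j → List.lookup xs i ≡ List.lookup xs j → i ≡ j
lookup-injective (_ ∷ _)   zero    zero    _  = refl
lookup-injective {xs = _ ∷ xs} (x∉ ∷ _) zero (suc j) eq =
  contradiction eq (All.lookup x∉ (∈-lookup {xs = xs} j))
lookup-injective {xs = _ ∷ xs} (x∉ ∷ _) (suc i) zero eq =
  contradiction (sym eq) (All.lookup x∉ (∈-lookup {xs = xs} i))
lookup-injective (_ ∷ xs!) (suc i) (suc j) eq = cong suc (lookup-injective xs! i j eq)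

Unique⇒length≤ : ∀ {n} {xs : List (Fin n)} → Unique xs → length xs ≤ n
Unique⇒length≤ {xs = xs} xs! = injective⇒≤ {f = List.lookup xs} (lookup-injective xs! _ _)

bounded-injective⇒≤ : ∀ {a b} (f : ℕ → ℕ) → (∀ {i} → i < a → f i < b) →
  (∀ {i j} → i < a → j < a → f i ≡ f j → i ≡ j) → a ≤ b
bounded-injective⇒≤ f bound inj = injective⇒≤ {f = λ i → fromℕ< (bound (toℕ<n i))} λ {i} {j} eq →
  toℕ-injective (inj (toℕ<n i) (toℕ<n j)
    (trans (sym (toℕ-fromℕ< _)) (trans (cong toℕ eq) (toℕ-fromℕ< _))))

module _ (d : ℕ) where

  *+-monoˡ-< : ∀ {f i j} → f < d → i < j → ∀ g → d * i + f < d * j + g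
  *+-monoˡ-< {f} {i} {j} f<d i<j g = begin-strict
    d * i + f   <⟨ +-monoʳ-< (d * i) f<d ⟩
    d * i + d   ≡⟨ trans (+-comm (d * i) d) (sym (*-suc d i)) ⟩
    d * suc i   ≤⟨ *-monoʳ-≤ d i<j ⟩
    d * j       ≤⟨ m≤m+n (d * j) g ⟩
    d * j + g   ∎
    where open ≤-Reasoning

  *+-injective : ∀ {f g} i j → f < d → g < d → d * i + f ≡ d * j + g → i ≡ j × f ≡ g
  *+-injective {f} {g} i j f<d g<d eq with <-cmp i j
  ... | tri≈ _ refl _ = refl , +-cancelˡ-≡ (d * i) f g eq
  ... | tri< i<j _ _  = contradiction eq (<⇒≢ (*+-monoˡ-< f<d i<j g))
  ... | tri> _ _ j<i  = contradiction (sym eq) (<⇒≢ (*+-monoˡ-< g<d j<i f))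

------------------------------------------------------------------------
-- The program

-- Memory holds the arrays 0, …, 7 interleaved, cell i of array f at address
-- 8 i + f, with indices 0, …, 2 m; the cells from address 8 (2 m + 1) on form
-- array 8, which contains the stored blocks.
--
--   0  name of a slot                    4  latest mark of a slot
--   1  slot of an end of an arc          5  label of a slot
--   2  arc at a position of the order    6  slot of the first member of a pair
--   3  whether an arc has been released  7  slot of the second member of a pair
--
-- The registers are used as follows.
--
--   0  base address of array 8           7  arc or position in the batch
--   1  number of slots                   8  source
--   2  number of ordered arcs            9  slot or position in the order
--   3  end of an arc, round, or number  10  arc being scanned
--      of the first pair of the batch   11  slot of its tail
--   4  vertex searched for              12  slot of its head
--   5  slot found                       13  label of its tail
--   6  number of pairs in the batch

cell : ℕ → Expr → Expr
cell f e = mem (lit 8 ⊗ e ⊕ lit f)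

put : ℕ → Expr → Expr → Cmd
put f e e′ = store (lit 8 ⊗ e ⊕ lit f) e′

-- Nonzero exactly when the values of the two expressions differ.
_≠_ : Expr → Expr → Expr
e ≠ e′ = (e ⊖ e′) ⊕ (e′ ⊖ e)

infix 5 _≠_

-- Execute c for r = 0, …, e ∸ 1.
for : ℕ → Expr → Cmd → Cmd
for r e c = r ≔ lit 0 ⨟ whileNonzero (e ⊖ reg r) (c ⨟ r ≔ reg r ⊕ lit 1)

#vertices #arcs #pairs : Expr
#vertices = inp (lit 0)
#arcs  = inp (lit 1)
#pairs = inp (lit 2)

-- The first slot whose name is in register 4.  The name is written behind the
-- last slot as a sentinel, so an unsuccessful search yields the number of slots.
find : Cmd
find =
  put 0 (reg 1) (reg 4) ⨟
  5 ≔ lit 0 ⨟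
  whileNonzero (cell 0 (reg 5) ≠ reg 4) (5 ≔ reg 5 ⊕ lit 1)

-- Give slots to the ends of the arcs.
number : Cmd
number = for 3 (#arcs ⊕ #arcs) (
  4 ≔ inp (lit 3 ⊕ reg 3) ⨟
  find ⨟
  put 1 (reg 3) (reg 5) ⨟
  -- Keep the sentinel as a new name exactly if the search was unsuccessful.
  1 ≔ reg 1 ⊕ (reg 5 ⊕ lit 1 ⊖ reg 1))

-- The slots of the ends of the arc in register r.
tail head : ℕ → Expr
tail r = cell 1 (reg r ⊕ reg r)
head r = cell 1 (reg r ⊕ reg r ⊕ lit 1)

-- Mark the heads of the unreleased arcs.  In round t the mark is t + 1, so older
-- marks need not be erased.
mark : Cmd
mark = for 7 #arcs (
  ifNonzero (cell 3 (reg 7)) skip (put 4 (head 7) (reg 3 ⊕ lit 1)))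

-- Append the unreleased arcs with unmarked tails to the order.
release : Cmd
release = for 7 #arcs (
  ifNonzero (cell 3 (reg 7)) skip (
  ifNonzero (cell 4 (tail 7) ⊖ reg 3) skip (
  put 3 (reg 7) (lit 1) ⨟
  put 2 (reg 2) (reg 7) ⨟
  2 ≔ reg 2 ⊕ lit 1)))

sort : Cmd
sort = for 3 #vertices (mark ⨟ release)

-- The input position of the current pair of the batch.
pair : Expr
pair = lit 3 ⊕ (#arcs ⊕ #arcs ⊕ (reg 3 ⊕ reg 7 ⊕ (reg 3 ⊕ reg 7)))

-- Find the slots of the members of the pairs of the batch.
load : Cmd
load = for 7 (reg 6) (
  4 ≔ inp pair ⨟ find ⨟ put 6 (reg 7) (reg 5) ⨟
  4 ≔ inp (pair ⊕ lit 1) ⨟ find ⨟ put 7 (reg 7) (reg 5))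

-- Erase all labels, including that of the sentinel.
clear : Cmd
clear = for 9 (reg 1 ⊕ lit 1) (put 5 (reg 9) (lit 0))

-- Label the slots reachable from the source in register 8.  A label is stored as
-- its successor, and 0 stands for no label.
spread : Cmd
spread = for 9 (reg 2) (
  10 ≔ cell 2 (reg 9) ⨟
  11 ≔ tail 10 ⨟
  13 ≔ cell 5 (reg 11) ⨟
  ifNonzero (reg 13) (
    12 ≔ head 10 ⨟
    ifNonzero (reg 11 ≠ reg 8)
      (ifNonzero (cell 5 (reg 12))
        (ifNonzero (cell 5 (reg 12) ≠ reg 13)
          (put 5 (reg 12) (reg 12 ⊕ lit 1))
          skip)
        (put 5 (reg 12) (reg 13)))
      (put 5 (reg 12) (reg 12 ⊕ lit 1)))
    skip)

-- Execute emit for the pairs of the batch that the source is a junction of.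
report : Cmd → Cmd
report emit = for 7 (reg 6) (
  ifNonzero (cell 5 (cell 6 (reg 7)))
    (ifNonzero (cell 5 (cell 7 (reg 7)))
      (ifNonzero (cell 5 (cell 6 (reg 7)) ≠ cell 5 (cell 7 (reg 7))) emit skip)
      skip)
    skip)

sources : Cmd → Cmd
sources emit = for 8 (reg 1) (
  clear ⨟ put 5 (reg 8) (reg 8 ⊕ lit 1) ⨟ spread ⨟ report emit)

batch : Cmd → Cmd
batch emit =
  -- The minimum of m and the number of remaining pairs.
  6 ≔ #arcs ⊖ (#arcs ⊖ (#pairs ⊖ reg 3)) ⨟
  load ⨟
  sources emit ⨟
  3 ≔ reg 3 ⊕ #arcs

batches : Cmd → Cmd
batches emit =
  3 ≔ lit 0 ⨟
  whileNonzero (#pairs ⊖ reg 3) (batch emit)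

program : Cmd → Cmd
program emit =
  0 ≔ lit 8 ⊗ (lit 1 ⊕ (#arcs ⊕ #arcs)) ⨟
  ifNonzero #arcs (number ⨟ sort ⨟ batches emit) skip

-- What is done when the current source is a junction of the current pair.
printing storing : Cmd
printing = print (reg 3 ⊕ reg 7) (cell 0 (reg 8))
storing =
  store block (mem block ⊕ lit 1) ⨟
  store (block ⊕ mem block) (cell 0 (reg 8))
  where
  block : Expr
  block = reg 0 ⊕ (reg 3 ⊕ reg 7) ⊗ (#vertices ⊕ lit 1)

------------------------------------------------------------------------
-- A program logic with time bounds

-- The abstract state.  Registers and arrays are given as lists, so that reading
-- or updating one with a literal number computes; the other arrays are then
-- visibly unaffected.
record AState : Set where
  constructor st
  field
    regs   : List ℕ
    arrays : List (ℕ → ℕ)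
    events : List (ℕ × ℕ)

open AState

none : ℕ → ℕ
none _ = 0

setReg : ℕ → ℕ → AState → AState
setReg r v (st vs As o) = st (set 0 vs r v) As o

setCell : ℕ → ℕ → ℕ → AState → AState
setCell f i v (st vs As o) = st vs (set none As f (at none As f [ i ↦ v ])) o

-- The parameter top bounds all numbers that occur during a computation.
module Logic (m : ℕ) (input : List ℕ) (cells W top : ℕ)
  (room : 8 * suc (m + m) ≤ cells) (base≤top : 8 * suc (m + m) ≤ top) (top<W : top < W) where

  open Machine input cells W

  base : ℕ
  base = 8 * suc (m + m)

  -- The state σ is represented by s.
  record Rel (σ : State) (s : AState) : Set where
    field
      rel-regs   : ∀ r → registers σ r ≡ at 0 (regs s) r
      rel-cells  : ∀ f i → f < 8 → i ≤ m + m → memory σ (8 * i + f) ≡ at none (arrays s) f i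
      rel-blocks : ∀ j → memory σ (base + j) ≡ at none (arrays s) 8 j
      rel-events : output σ ≡ events s

  open Rel

  -- In all states represented by s, the expression e is safe and has value v.
  record Ev (e : Expr) (s : AState) (v : ℕ) : Set where
    field
      safe  : ∀ {σ} → Rel σ s → Safe e σ
      value : ∀ {σ} → Rel σ s → eval e σ ≡ v
      small : v ≤ top

  open Ev

  private variable
    e e′ : Expr
    c c′ : Cmd
    s : AState
    a b v t t₁ t₂ : ℕ

  word : v ≤ top → v < W
  word v≤ = ≤-<-trans v≤ top<W

  8*i+f<base : ∀ {f i} → f < 8 → i ≤ m + m → 8 * i + f < base
  8*i+f<base {f} {i} f<8 i≤ =
    subst (8 * i + f <_) (+-identityʳ base) (*+-monoˡ-< 8 f<8 (s≤s i≤) 0)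

  8≤top : 8 ≤ top
  8≤top = ≤-trans (m≤m*n 8 (suc (m + m))) base≤top

  index≤top : v ≤ m + m → v ≤ top
  index≤top {v} v≤ = ≤-trans (m≤n*m v 8)
    (≤-trans (*-monoʳ-≤ 8 (m≤n⇒m≤1+n v≤)) base≤top)

  ev-lit : ∀ {x} → x ≤ top → Ev (lit x) s x
  ev-lit x≤ = record { safe = λ _ → word x≤ ; value = λ _ → refl ; small = x≤ }

  ev-reg : ∀ {r} → at 0 (regs s) r ≤ top → Ev (reg r) s (at 0 (regs s) r)
  ev-reg {r = r} x≤ = record
    { safe = λ R → subst (_< W) (sym (rel-regs R r)) (word x≤)
    ; value = λ R → rel-regs R r ; small = x≤ }

  ev-inp : Ev e s a → nth input a ≡ v → v ≤ top → Ev (inp e) s v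
  ev-inp E refl v≤ = record
    { safe = λ R → safe E R , subst (λ x → nth input x < W) (sym (value E R)) (word v≤)
    ; value = λ R → cong (nth input) (value E R) ; small = v≤ }

  ev-⊕ : Ev e s a → Ev e′ s b → a + b ≤ top → Ev (e ⊕ e′) s (a + b)
  ev-⊕ E E′ v≤ = record
    { safe = λ R → safe E R , safe E′ R , subst (_< W) (sym (cong₂ _+_ (value E R) (value E′ R))) (word v≤)
    ; value = λ R → cong₂ _+_ (value E R) (value E′ R) ; small = v≤ }

  ev-suc : Ev e s a → suc a ≤ top → Ev (e ⊕ lit 1) s (suc a)
  ev-suc {a = a} E v≤ = subst (Ev _ _) (+-comm a 1)
    (ev-⊕ E (ev-lit (≤-trans (s≤s z≤n) v≤)) (subst (_≤ top) (+-comm 1 a) v≤))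

  ev-⊗ : Ev e s a → Ev e′ s b → a * b ≤ top → Ev (e ⊗ e′) s (a * b)
  ev-⊗ E E′ v≤ = record
    { safe = λ R → safe E R , safe E′ R , subst (_< W) (sym (cong₂ _*_ (value E R) (value E′ R))) (word v≤)
    ; value = λ R → cong₂ _*_ (value E R) (value E′ R) ; small = v≤ }

  ev-⊖ : Ev e s a → Ev e′ s b → Ev (e ⊖ e′) s (a ∸ b)
  ev-⊖ {a = a} {b = b} E E′ = record
    { safe = λ R → safe E R , safe E′ R
    ; value = λ R → cong₂ _∸_ (value E R) (value E′ R)
    ; small = ≤-trans (m∸n≤m a b) (small E) }

  -- The value of an expression with _≠_.
  distance : ℕ → ℕ → ℕ
  distance a b = (a ∸ b) + (b ∸ a)

  distance≤⊔ : ∀ a b → distance a b ≤ a ⊔ b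
  distance≤⊔ zero    zero    = z≤n
  distance≤⊔ zero    (suc b) = ≤-refl
  distance≤⊔ (suc a) zero    = ≤-reflexive (+-identityʳ (suc a))
  distance≤⊔ (suc a) (suc b) = m≤n⇒m≤1+n (distance≤⊔ a b)

  distance≡0⇒≡ : ∀ {a b} → distance a b ≡ 0 → a ≡ b
  distance≡0⇒≡ {a} {b} eq = ≤-antisym (m∸n≡0⇒m≤n (m+n≡0⇒m≡0 (a ∸ b) eq))
                                     (m∸n≡0⇒m≤n (m+n≡0⇒n≡0 (a ∸ b) eq))

  ≡⇒distance≡0 : ∀ {a b} → a ≡ b → distance a b ≡ 0
  ≡⇒distance≡0 {a} refl = cong₂ _+_ (n∸n≡0 a) (n∸n≡0 a)

  ev-≠ : Ev e s a → Ev e′ s b → Ev (e ≠ e′) s (distance a b)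
  ev-≠ {a = a} {b = b} E E′ =
    ev-⊕ (ev-⊖ E E′) (ev-⊖ E′ E) (≤-trans (distance≤⊔ a b) (⊔-lub (small E) (small E′)))

  address : ∀ {f} {f<8 : T (f <ᵇ 8)} → Ev e s a → a ≤ m + m → Ev (lit 8 ⊗ e ⊕ lit f) s (8 * a + f)
  address {f = f} {f<8} E a≤ =
    ev-⊕ (ev-⊗ (ev-lit 8≤top) E (≤-trans (m≤m+n _ f) bound))
      (ev-lit (≤-trans (<⇒≤ (<ᵇ⇒< f 8 f<8)) 8≤top)) bound
    where bound = ≤-trans (<⇒≤ (8*i+f<base (<ᵇ⇒< f 8 f<8) a≤)) base≤top

  ev-cell : ∀ {f} {f<8 : T (f <ᵇ 8)} → Ev e s a → a ≤ m + m →
    at none (arrays s) f a ≡ v → v ≤ top → Ev (cell f e) s v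
  ev-cell {e = e} {a = a} {f = f} {f<8} E a≤ refl v≤ = record
    { safe = λ {σ} R → safe A R , subst (_< cells) (sym (value A R)) (<-≤-trans (8*i+f<base f<8′ a≤) room)
                   , subst (_< W) (sym (val R)) (word v≤)
    ; value = val ; small = v≤ }
    where
    f<8′ = <ᵇ⇒< f 8 f<8
    A = address {f = f} {f<8} E a≤
    val : ∀ {σ} → Rel σ _ → memory σ (eval (lit 8 ⊗ e ⊕ lit f) σ) ≡ _
    val {σ} R = trans (cong (memory σ) (value A R)) (rel-cells R f a f<8′ a≤)

  ev-block : Ev e s (base + a) → base + a < cells → at none (arrays s) 8 a ≡ v → v ≤ top → Ev (mem e) s v
  ev-block {e = e} {a = a} E a< refl v≤ = record
    { safe = λ R → safe E R , subst (_< cells) (sym (value E R)) a< , subst (_< W) (sym (val R)) (word v≤)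
    ; value = val ; small = v≤ }
    where
    val : ∀ {σ} → Rel σ _ → memory σ (eval e σ) ≡ _
    val {σ} R = trans (cong (memory σ) (value E R)) (rel-blocks R a)

  -- Started in any state represented by s, the command c halts within time t
  -- in a state represented by an abstract state satisfying Q.
  record Run (c : Cmd) (s : AState) (t : ℕ) (Q : AState → Set) : Set where
    field
      exec : ∀ {σ} → Rel σ s → ∃[ t′ ] ∃[ σ′ ] ∃[ s′ ] (c , σ ⇓[ t′ ] σ′) × t′ ≤ t × Rel σ′ s′ × Q s′

  open Run

  private variable
    Q Q′ : AState → Set

  run-skip : Q s → Run skip s (suc t) Q
  run-skip q .exec R = _ , _ , _ , skip , s≤s z≤n , R , q

  run-assign : ∀ {r} → Ev e s v → Q (setReg r v s) → Run (r ≔ e) s (suc t) Q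
  run-assign {e = e} {s = s} {v = v} {r = r} E q .exec {σ} R = _ , _ , _ , assign (safe E R) , s≤s z≤n , R′ , q
    where
    R′ : Rel ⟨ registers σ [ r ↦ eval e σ ] , memory σ , output σ ⟩ (setReg r v s)
    R′ .rel-regs r′ rewrite value E R | at-set 0 (regs s) r v r′ with r′ ≡ᵇ r
    ... | true  = refl
    ... | false = rel-regs R r′
    R′ .rel-cells  = rel-cells R
    R′ .rel-blocks = rel-blocks R
    R′ .rel-events = rel-events R

  run-put : ∀ {f} {f<8 : T (f <ᵇ 8)} → Ev e s a → a ≤ m + m → Ev e′ s v →
    Q (setCell f a v s) → Run (put f e e′) s (suc t) Q
  run-put {e = e} {s = s} {a = a} {e′ = e′} {v = v} {f = f} {f<8} E a≤ E′ q .exec {σ} R =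
    _ , _ , _ , store (safe A R) (subst (_< cells) (sym (value A R)) (<-≤-trans (8*i+f<base f<8′ a≤) room)) (safe E′ R)
    , s≤s z≤n , R′ , q
    where
    f<8′ = <ᵇ⇒< f 8 f<8
    A = address {f = f} {f<8} E a≤
    R′ : Rel ⟨ registers σ , memory σ [ eval (lit 8 ⊗ e ⊕ lit f) σ ↦ eval e′ σ ] , output σ ⟩ (setCell f a v s)
    R′ .rel-regs = rel-regs R
    R′ .rel-cells g i g<8 i≤ rewrite value A R | value E′ R
      | at-set none (arrays s) f (at none (arrays s) f [ a ↦ v ]) g with g ≡ᵇ f in eq
    ... | false = trans (↦-there (memory σ) v λ eq′ → subst T eq (≡⇒≡ᵇ g f (proj₂ (*+-injective 8 i a g<8 f<8′ eq′))))
                        (rel-cells R g i g<8 i≤)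
    ... | true with ≡ᵇ⇒≡ g f (subst T (sym eq) tt)
    ...   | refl with i ≟ a
    ...     | yes refl = trans (↦-here (memory σ) (8 * i + g) v) (sym (↦-here (at none (arrays s) g) i v))
    ...     | no i≢a = trans (↦-there (memory σ) v λ eq′ → i≢a (proj₁ (*+-injective 8 i a g<8 f<8′ eq′)))
                         (trans (rel-cells R g i g<8 i≤) (sym (↦-there (at none (arrays s) g) v i≢a)))
    R′ .rel-blocks j rewrite value A R | value E′ R
      | at-set none (arrays s) f (at none (arrays s) f [ a ↦ v ]) 8 with 8 ≡ᵇ f in eq
    ... | true = contradiction (sym (≡ᵇ⇒≡ 8 f (subst T (sym eq) tt))) (<⇒≢ f<8′)
    ... | false = trans (↦-there (memory σ) v λ eq′ → <⇒≢ (<-≤-trans (8*i+f<base f<8′ a≤) (m≤m+n base j)) (sym eq′))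
                        (rel-blocks R j)
    R′ .rel-events = rel-events R

  run-block : Ev e s (base + a) → base + a < cells → Ev e′ s v →
    Q (setCell 8 a v s) → Run (store e e′) s (suc t) Q
  run-block {e = e} {s = s} {a = a} {e′ = e′} {v = v} A a< E′ q .exec {σ} R =
    _ , _ , _ , store (safe A R) (subst (_< cells) (sym (value A R)) a<) (safe E′ R) , s≤s z≤n , R′ , q
    where
    R′ : Rel ⟨ registers σ , memory σ [ eval e σ ↦ eval e′ σ ] , output σ ⟩ (setCell 8 a v s)
    R′ .rel-regs = rel-regs R
    R′ .rel-cells g i g<8 i≤ rewrite value A R | value E′ R
      | at-set none (arrays s) 8 (at none (arrays s) 8 [ a ↦ v ]) g with g ≡ᵇ 8 in eq
    ... | true = contradiction (≡ᵇ⇒≡ g 8 (subst T (sym eq) tt)) (<⇒≢ g<8)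
    ... | false = trans (↦-there (memory σ) v (<⇒≢ (<-≤-trans (8*i+f<base g<8 i≤) (m≤m+n base a))))
                        (rel-cells R g i g<8 i≤)
    R′ .rel-blocks j rewrite value A R | value E′ R
      | at-set none (arrays s) 8 (at none (arrays s) 8 [ a ↦ v ]) 8 with j ≟ a
    ... | yes refl = trans (↦-here (memory σ) (base + j) v) (sym (↦-here (at none (arrays s) 8) j v))
    ... | no j≢a = trans (↦-there (memory σ) v λ eq′ → j≢a (+-cancelˡ-≡ base j a eq′))
                     (trans (rel-blocks R j) (sym (↦-there (at none (arrays s) 8) v j≢a)))
    R′ .rel-events = rel-events R

  run-print : Ev e s a → Ev e′ s b → Q (st (regs s) (arrays s) ((a , b) ∷ events s)) → Run (print e e′) s (suc t) Q
  run-print E E′ q .exec R = _ , _ , _ , print (safe E R) (safe E′ R) , s≤s z≤n , record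
    { rel-regs = rel-regs R ; rel-cells = rel-cells R ; rel-blocks = rel-blocks R
    ; rel-events = cong₂ _∷_ (cong₂ _,_ (value E R) (value E′ R)) (rel-events R) } , q

  run-seq : ∀ t₁ → Run c s t₁ Q′ → (∀ {s′} → Q′ s′ → Run c′ s′ t₂ Q) → Run (c ⨟ c′) s (t₁ + t₂) Q
  run-seq t₁ X Y .exec R with exec X R
  ... | _ , _ , _ , x , x≤ , R′ , q′ with exec (Y q′) R′
  ...   | _ , _ , _ , y , y≤ , R″ , q = _ , _ , _ , seq x y , +-mono-≤ x≤ y≤ , R″ , q

  run-weaken : t₁ ≤ t₂ → Run c s t₁ Q → Run c s t₂ Q
  run-weaken t≤ X .exec R with exec X R
  ... | _ , _ , _ , x , x≤ , q = _ , _ , _ , x , ≤-trans x≤ t≤ , q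

  run-map : (∀ {s′} → Q s′ → Q′ s′) → Run c s t Q → Run c s t Q′
  run-map f X .exec R with exec X R
  ... | _ , _ , _ , x , x≤ , R′ , q = _ , _ , _ , x , x≤ , R′ , f q

  assign-then : ∀ {r} → Ev e s v → Run c (setReg r v s) t Q → Run (r ≔ e ⨟ c) s (suc t) Q
  assign-then {s = s} {v = v} {r = r} E X = run-seq 1 (run-assign {Q = _≡ setReg r v s} E refl) λ { refl → X }

  put-then : ∀ {f} {f<8 : T (f <ᵇ 8)} → Ev e s a → a ≤ m + m → Ev e′ s v →
    Run c (setCell f a v s) t Q → Run (put f e e′ ⨟ c) s (suc t) Q
  put-then {s = s} {a = a} {v = v} {f = f} {f<8 = f<8} E a≤ E′ X =
    run-seq 1 (run-put {Q = _≡ setCell f a v s} {f<8 = f<8} E a≤ E′ refl) λ { refl → X }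

  block-then : Ev e s (base + a) → base + a < cells → Ev e′ s v →
    Run c (setCell 8 a v s) t Q → Run (store e e′ ⨟ c) s (suc t) Q
  block-then {s = s} {a = a} {v = v} E a< E′ X =
    run-seq 1 (run-block {Q = _≡ setCell 8 a v s} E a< E′ refl) λ { refl → X }

  run-if : Ev e s v → (v ≢ 0 → Run c s t Q) → (v ≡ 0 → Run c′ s t Q) → Run (ifNonzero e c c′) s (suc t) Q
  run-if {v = v} E X Y .exec R with v ≟ 0
  ... | yes v≡0 with exec (Y v≡0) R
  ...   | _ , _ , _ , y , y≤ , q = _ , _ , _ , if-zero (safe E R) (trans (value E R) v≡0) y , s≤s y≤ , q
  run-if E X Y .exec R | no v≢0 with exec (X v≢0) R
  ...   | _ , _ , _ , x , x≤ , q =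
    _ , _ , _ , if-nonzero (safe E R) (λ z → v≢0 (trans (sym (value E R)) z)) x , s≤s x≤ , q

  while-done : Ev e s v → v ≡ 0 → Q s → Run (whileNonzero e c) s (suc t) Q
  while-done E v≡0 q .exec R = _ , _ , _ , while-zero (safe E R) (trans (value E R) v≡0) , s≤s z≤n , R , q

  while-step : ∀ t₁ → Ev e s v → v ≢ 0 → Run c s t₁ Q′ → (∀ {s′} → Q′ s′ → Run (whileNonzero e c) s′ t₂ Q) →
    Run (whileNonzero e c) s (suc (t₁ + t₂)) Q
  while-step t₁ E v≢0 X Y .exec R with exec X R
  ... | _ , _ , _ , x , x≤ , R′ , q′ with exec (Y q′) R′
  ...   | _ , _ , _ , y , y≤ , R″ , q =
    _ , _ , _ , while-nonzero (safe E R) (λ z → v≢0 (trans (sym (value E R)) z)) x y , s≤s (+-mono-≤ x≤ y≤) , R″ , q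

  -- Inv (suc j) will hold when the counter r, still j, has been incremented.
  Next : ℕ → (ℕ → AState → Set) → ℕ → AState → Set
  Next r Inv j s = at 0 (regs s) r ≡ j × Inv (suc j) (setReg r (suc j) s)

  -- The invariant Inv j holds whenever the counter has the value j and is tested.
  run-for : ∀ {r} (Inv : ℕ → AState → Set) (N t : ℕ) →
    (∀ {j s′} → Inv j s′ → at 0 (regs s′) r ≡ j × Ev e s′ N) →
    (∀ {j s′} → j < N → Inv j s′ → Run c s′ t (Next r Inv j)) →
    Inv 0 (setReg r 0 s) → Run (for r e c) s (2 + N * (2 + t)) (Inv N)
  run-for {e = e} {c = c} {r = r} Inv N t test body init =
    assign-then (ev-lit z≤n) (loop N 0 (+-identityʳ N) init)
    where
    idx : ∀ {j s′} → j ≤ N → Inv j s′ → Ev (reg r) s′ j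
    idx {s′ = s′} j≤N i with test i
    ... | refl , E = ev-reg (≤-trans j≤N (small E))
    cond : ∀ {j s′} → j ≤ N → Inv j s′ → Ev (e ⊖ reg r) s′ (N ∸ j)
    cond j≤N i = ev-⊖ (proj₂ (test i)) (idx j≤N i)
    loop : ∀ d j {s′} → d + j ≡ N → Inv j s′ →
      Run (whileNonzero (e ⊖ reg r) (c ⨟ r ≔ reg r ⊕ lit 1)) s′ (1 + d * (2 + t)) (Inv N)
    loop zero    j refl i = while-done (cond ≤-refl i) (n∸n≡0 j) i
    loop (suc d) j eq i = run-weaken (≤-reflexive time)
      (while-step (t + 1) (cond (<⇒≤ j<N) i) (m>n⇒m∸n≢0 j<N)
        (run-seq t (body j<N i) λ { {s″} (refl , i′) → run-assign {Q = Inv (suc j)}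
          (ev-⊕ (ev-reg (≤-trans (<⇒≤ j<N) N≤top)) (ev-lit (≤-trans (s≤s z≤n) 8≤top))
                (subst (_≤ top) (+-comm 1 j) (≤-trans j<N N≤top)))
          (subst (λ x → Inv (suc j) (setReg r x s″)) (+-comm 1 j) i′) })
        λ i′ → loop d (suc j) (trans (+-suc d j) eq) i′)
      where
      j<N : j < N
      j<N = subst (j <_) eq (s≤s (m≤n+m j d))
      N≤top = small (proj₂ (test i))
      time : suc (t + 1 + (1 + d * (2 + t))) ≡ 1 + (suc d) * (2 + t)
      time = solve-∀′ t (d * (2 + t))
        where
        solve-∀′ : ∀ t x → suc (t + 1 + (1 + x)) ≡ 1 + (2 + t + x)
        solve-∀′ = solve-∀

------------------------------------------------------------------------
-- Labels of the vertices reachable from a source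

-- The arcs are numbered 0, …, e ∸ 1 in such a way that the arcs entering a
-- vertex precede those leaving it.
module Labels (tl hd : ℕ → ℕ) (e : ℕ)
  (sorted : ∀ {i j} → i < e → j < e → hd j ≡ tl i → j < i) (s c : ℕ) where

  -- Walks from s to x whose arcs have increasing numbers, all less than i.
  data Walk : ℕ → ℕ → Set where
    here : ∀ {i} → Walk i s
    step : ∀ {i j x} → j < i → Walk j (tl j) → hd j ≡ x → Walk i x

  -- The vertex z is on the walk.
  On : ∀ {i x} → ℕ → Walk i x → Set
  On z here                 = z ≡ s
  On z (step {x = x} _ w _) = z ≡ x ⊎ On z w

  Disjoint : ∀ {i j x y} → Walk i x → Walk j y → Set
  Disjoint w w′ = ∀ z → On z w → On z w′ → z ≡ s

  target-on : ∀ {i x} (w : Walk i x) → On x w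
  target-on here         = refl
  target-on (step _ _ _) = inj₁ refl

  source-on : ∀ {i x} (w : Walk i x) → On s w
  source-on here         = refl
  source-on (step _ w _) = inj₂ (source-on w)

  up : ∀ {i j x} → i ≤ j → Walk i x → Walk j x
  up i≤j here           = here
  up i≤j (step k<i w p) = step (<-≤-trans k<i i≤j) w p

  on-up : ∀ {i j x z} (i≤j : i ≤ j) (w : Walk i x) → On z (up i≤j w) → On z w
  on-up _ here         o = o
  on-up _ (step _ _ _) o = o

  -- By the order of the arcs, a walk to the tail of arc j uses earlier arcs.
  below : ∀ {j x} → j < e → (w : Walk e x) → x ≡ tl j →
    Σ[ w′ ∈ Walk j x ] (∀ z → On z w′ → On z w)
  below j<e here              eq = here , λ _ o → o
  below j<e (step k<e w refl) eq = step (sorted j<e k<e eq) w refl , λ _ o → o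

  -- L describes the walks that use arcs below i only: L x is 0 if x is not
  -- reachable; otherwise the predecessor of L x lies on all walks to x, and
  -- vertices with different labels are reached by disjoint walks.
  record Labelled (i : ℕ) (L : ℕ → ℕ) : Set where
    field
      source  : L s ≡ suc s
      other   : ∀ {x} → x ≤ c → L x ≡ suc s → x ≡ s
      live    : ∀ {x} → Walk i x → L x ≢ 0
      reached : ∀ {x} → x ≤ c → L x ≢ 0 → Walk i x
      passes  : ∀ {x d} (w : Walk i x) → L x ≡ suc d → On d w
      apart   : ∀ {x y} → x ≤ c → y ≤ c → L x ≢ 0 → L y ≢ 0 → L x ≢ L y →
                ∃₂ λ (w : Walk i x) (w′ : Walk i y) → Disjoint w w′

  open Labelled

  labelled-cong : ∀ {i L L′} → (∀ x → L′ x ≡ L x) → Labelled i L → Labelled i L′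
  labelled-cong eq λᴸ = record
    { source  = trans (eq s) (source λᴸ)
    ; other   = λ x≤c p → other λᴸ x≤c (trans (sym (eq _)) p)
    ; live    = λ w p → live λᴸ w (trans (sym (eq _)) p)
    ; reached = λ x≤c p → reached λᴸ x≤c λ q → p (trans (eq _) q)
    ; passes  = λ w p → passes λᴸ w (trans (sym (eq _)) p)
    ; apart   = λ x≤c y≤c p q r → apart λᴸ x≤c y≤c (λ z → p (trans (eq _) z)) (λ z → q (trans (eq _) z))
                  λ z → r (trans (eq _) (trans z (sym (eq _))))
    }

  labelled-start : ∀ {L} → s ≤ c → (∀ {x} → x ≤ c → x ≢ s → L x ≡ 0) → L s ≡ suc s → Labelled 0 L
  labelled-start {L} s≤c zeros Ls = record
    { source  = Ls
    ; other   = λ {x} x≤c p → is-s x≤c λ q → 0≢1+n (trans (sym q) p)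
    ; live    = λ { here p → 0≢1+n (trans (sym p) Ls) }
    ; reached = λ x≤c p → subst (Walk 0) (sym (is-s x≤c p)) here
    ; passes  = λ { here p → suc-injective (trans (sym p) Ls) }
    ; apart   = λ x≤c y≤c p q r → contradiction (cong L (trans (is-s x≤c p) (sym (is-s y≤c q)))) r
    }
    where
    is-s : ∀ {x} → x ≤ c → L x ≢ 0 → x ≡ s
    is-s {x} x≤c p with x ≟ s
    ... | yes x≡s = x≡s
    ... | no x≢s = contradiction (zeros x≤c x≢s) p

  -- The effect of scanning arc i, from a to b.
  module Scan {i : ℕ} {L : ℕ → ℕ} (i<e : i < e) (Λ : Labelled i L) (a≤c : tl i ≤ c) (b≤c : hd i ≤ c) where

    private
      a b : ℕ
      a = tl i
      b = hd i

    up₁ : ∀ {x} → Walk i x → Walk (suc i) x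
    up₁ = up (n≤1+n i)

    -- A walk either avoids arc i or ends with it.
    cases : ∀ {x} (w : Walk (suc i) x) →
      (Σ[ w′ ∈ Walk i x ] (∀ z → On z w′ → On z w)) ⊎
      (b ≡ x × Σ[ w′ ∈ Walk i a ] (∀ z → On z w′ → On z w))
    cases here = inj₁ (here , λ _ o → o)
    cases (step {j = j} j<1+i w p) with j ≟ i
    ... | yes refl = inj₂ (p , w , λ _ → inj₂)
    ... | no j≢i   = inj₁ (step (≤∧≢⇒< (≤-pred j<1+i) j≢i) w p , λ _ o → o)

    -- No arc scanned so far leaves the head of arc i.
    sink : ∀ {k y} (w : Walk k y) → k ≤ i → On b w → b ≡ y
    sink here           k≤i o        = o
    sink (step _ _ _)   k≤i (inj₁ o) = o
    sink (step {j = j} j<k w _) k≤i (inj₂ o) =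
      contradiction (<-trans j<i (sorted (<-trans j<i i<e) i<e (sink w (<⇒≤ j<i) o))) (<-irrefl refl)
      where j<i = <-≤-trans j<k k≤i

    b≢a : b ≢ a
    b≢a eq = <-irrefl refl (sorted i<e i<e eq)

    b≢s : Walk i a → b ≢ s
    b≢s w eq = b≢a (sink w ≤-refl (subst (λ z → On z w) (sym eq) (source-on w)))

    extend : Walk i a → Walk (suc i) b
    extend w = step ≤-refl w refl

    extend-disjoint : ∀ {y} (w : Walk i a) (w′ : Walk i y) → y ≢ b → Disjoint w w′ → Disjoint (extend w) (up₁ w′)
    extend-disjoint w w′ y≢b d z (inj₁ refl) o = contradiction (sym (sink w′ ≤-refl (on-up (n≤1+n i) w′ o))) y≢b
    extend-disjoint w w′ y≢b d z (inj₂ o)    o′ = d z o (on-up (n≤1+n i) w′ o′)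

    unreached : L a ≡ 0 → Labelled (suc i) L
    unreached La≡0 = record
      { source  = source Λ
      ; other   = other Λ
      ; live    = λ w → case cases w of λ where
          (inj₁ (w′ , _))     → live Λ w′
          (inj₂ (_ , w′ , _)) → contradiction La≡0 (live Λ w′)
      ; reached = λ x≤c p → up₁ (reached Λ x≤c p)
      ; passes  = λ w p → case cases w of λ where
          (inj₁ (w′ , on))    → on _ (passes Λ w′ p)
          (inj₂ (_ , w′ , _)) → contradiction La≡0 (live Λ w′)
      ; apart   = λ x≤c y≤c p q r → case apart Λ x≤c y≤c p q r of λ where
          (w , w′ , d) → up₁ w , up₁ w′ , λ z o o′ → d z (on-up _ w o) (on-up _ w′ o′)
      }

    -- If b gets the label v, only walks to b have to be considered.
    relabel : ∀ {v} → L a ≢ 0 → v ≢ 0 → v ≢ suc s →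
      (∀ {d} (w : Walk (suc i) b) → v ≡ suc d → On d w) →
      (∀ {y} → y ≤ c → y ≢ b → L y ≢ 0 → L y ≢ v →
        ∃₂ λ (w : Walk (suc i) b) (w′ : Walk (suc i) y) → Disjoint w w′) →
      Labelled (suc i) (L [ b ↦ v ])
    relabel {v} La≢0 v≢0 v≢1+s through split = record
      { source  = trans (rest (b≢s wa ∘ sym)) (source Λ)
      ; other   = other′
      ; live    = live′
      ; reached = reached′
      ; passes  = passes′
      ; apart   = apart′
      }
      where
      wa = reached Λ a≤c La≢0
      L′ = L [ b ↦ v ]
      new : L′ b ≡ v
      new = ↦-here L b v
      rest : ∀ {x} → x ≢ b → L′ x ≡ L x
      rest = ↦-there L v
      other′ : ∀ {x} → x ≤ c → L′ x ≡ suc s → x ≡ s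
      other′ {x} x≤c p with x ≟ b
      ... | yes refl = contradiction (trans (sym new) p) v≢1+s
      ... | no x≢b = other Λ x≤c (trans (sym (rest x≢b)) p)
      live′ : ∀ {x} → Walk (suc i) x → L′ x ≢ 0
      live′ {x} w p with x ≟ b
      ... | yes refl = v≢0 (trans (sym new) p)
      ... | no x≢b with cases w
      ...   | inj₁ (w′ , _) = live Λ w′ (trans (sym (rest x≢b)) p)
      ...   | inj₂ (b≡x , _) = x≢b (sym b≡x)
      reached′ : ∀ {x} → x ≤ c → L′ x ≢ 0 → Walk (suc i) x
      reached′ {x} x≤c p with x ≟ b
      ... | yes refl = extend wa
      ... | no x≢b = up₁ (reached Λ x≤c λ q → p (trans (rest x≢b) q))
      passes′ : ∀ {x d} (w : Walk (suc i) x) → L′ x ≡ suc d → On d w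
      passes′ {x} w p with x ≟ b
      ... | yes refl = through w (trans (sym new) p)
      ... | no x≢b with cases w
      ...   | inj₁ (w′ , on) = on _ (passes Λ w′ (trans (sym (rest x≢b)) p))
      ...   | inj₂ (b≡x , _) = contradiction (sym b≡x) x≢b
      apart′ : ∀ {x y} → x ≤ c → y ≤ c → L′ x ≢ 0 → L′ y ≢ 0 → L′ x ≢ L′ y →
        ∃₂ λ (w : Walk (suc i) x) (w′ : Walk (suc i) y) → Disjoint w w′
      apart′ {x} {y} x≤c y≤c p q r with x ≟ b | y ≟ b
      ... | yes refl | yes refl = contradiction refl r
      ... | yes refl | no y≢b = split y≤c y≢b (λ z → q (trans (rest y≢b) z))
                                  λ z → r (trans new (trans (sym z) (sym (rest y≢b))))
      ... | no x≢b | yes refl with split x≤c x≢b (λ z → p (trans (rest x≢b) z))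
                                  (λ z → r (trans (rest x≢b) (trans z (sym new))))
      ...   | w , w′ , d = w′ , w , λ z o o′ → d z o′ o
      apart′ x≤c y≤c p q r | no x≢b | no y≢b
        with apart Λ x≤c y≤c (λ z → p (trans (rest x≢b) z)) (λ z → q (trans (rest y≢b) z))
               (λ z → r (trans (rest x≢b) (trans z (sym (rest y≢b)))))
      ... | w , w′ , d = up₁ w , up₁ w′ , λ z o o′ → d z (on-up _ w o) (on-up _ w′ o′)

    -- Disjoint walks to b and y, the first along arc i or an old one.
    via-tail : ∀ {y} → y ≤ c → y ≢ b → L a ≢ 0 → L y ≢ 0 → L y ≢ L a →
      ∃₂ λ (w : Walk (suc i) b) (w′ : Walk (suc i) y) → Disjoint w w′
    via-tail y≤c y≢b La≢0 Ly≢0 Ly≢La with apart Λ a≤c y≤c La≢0 Ly≢0 (Ly≢La ∘ sym)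
    ... | w , w′ , d = extend w , up₁ w′ , extend-disjoint w w′ y≢b d

    via-head : ∀ {y} → y ≤ c → L b ≢ 0 → L y ≢ 0 → L y ≢ L b →
      ∃₂ λ (w : Walk (suc i) b) (w′ : Walk (suc i) y) → Disjoint w w′
    via-head y≤c Lb≢0 Ly≢0 Ly≢Lb with apart Λ b≤c y≤c Lb≢0 Ly≢0 (Ly≢Lb ∘ sym)
    ... | w , w′ , d = up₁ w , up₁ w′ , λ z o o′ → d z (on-up _ w o) (on-up _ w′ o′)

    La≢1+s : a ≢ s → L a ≢ suc s
    La≢1+s a≢s p = a≢s (other Λ a≤c p)

    1+b≢1+s : L a ≢ 0 → suc b ≢ suc s
    1+b≢1+s La≢0 = b≢s (reached Λ a≤c La≢0) ∘ suc-injective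

    ends : ∀ {d} (w : Walk (suc i) b) → suc b ≡ suc d → On d w
    ends w refl = target-on w

    -- The cases in which a is reachable.
    direct : L a ≢ 0 → a ≡ s → Labelled (suc i) (L [ b ↦ suc b ])
    direct La≢0 a≡s = relabel La≢0 1+n≢0 (1+b≢1+s La≢0) ends split
      where
      start : ∀ {x} → x ≡ s → Σ[ w ∈ Walk i x ] (∀ z → On z w → z ≡ s)
      start refl = here , λ _ o → o
      split : ∀ {y} → y ≤ c → y ≢ b → L y ≢ 0 → L y ≢ suc b →
        ∃₂ λ (w : Walk (suc i) b) (w′ : Walk (suc i) y) → Disjoint w w′
      split y≤c y≢b Ly≢0 _ = extend w , up₁ w′ , extend-disjoint w w′ y≢b λ z o _ → on z o
        where
        w = proj₁ (start a≡s)
        on = proj₂ (start a≡s)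
        w′ = reached Λ y≤c Ly≢0

    inherit : L a ≢ 0 → a ≢ s → L b ≡ 0 → Labelled (suc i) (L [ b ↦ L a ])
    inherit La≢0 a≢s Lb≡0 = relabel La≢0 La≢0 (La≢1+s a≢s) through
      λ y≤c y≢b → via-tail y≤c y≢b La≢0
      where
      through : ∀ {d} (w : Walk (suc i) b) → L a ≡ suc d → On d w
      through w p with cases w
      ... | inj₁ (w′ , _) = contradiction Lb≡0 (live Λ w′)
      ... | inj₂ (_ , w′ , on) = on _ (passes Λ w′ p)

    agree : L a ≢ 0 → a ≢ s → L b ≡ L a → Labelled (suc i) L
    agree La≢0 a≢s Lb≡La = labelled-cong same (relabel La≢0 La≢0 (La≢1+s a≢s) through
      λ y≤c y≢b → via-tail y≤c y≢b La≢0)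
      where
      same : ∀ x → L x ≡ (L [ b ↦ L a ]) x
      same x with x ≟ b
      ... | yes refl = trans Lb≡La (sym (↦-here L b (L a)))
      ... | no x≢b = sym (↦-there L (L a) x≢b)
      through : ∀ {d} (w : Walk (suc i) b) → L a ≡ suc d → On d w
      through w p with cases w
      ... | inj₁ (w′ , on) = on _ (passes Λ w′ (trans Lb≡La p))
      ... | inj₂ (_ , w′ , on) = on _ (passes Λ w′ p)

    fork : L a ≢ 0 → L b ≢ 0 → L b ≢ L a → Labelled (suc i) (L [ b ↦ suc b ])
    fork La≢0 Lb≢0 Lb≢La = relabel La≢0 1+n≢0 (1+b≢1+s La≢0) ends split
      where
      -- The label of y differs from one of the labels of the ends of arc i.
      split : ∀ {y} → y ≤ c → y ≢ b → L y ≢ 0 → L y ≢ suc b →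
        ∃₂ λ (w : Walk (suc i) b) (w′ : Walk (suc i) y) → Disjoint w w′
      split {y} y≤c y≢b Ly≢0 _ with L y ≟ L a
      ... | no Ly≢La  = via-tail y≤c y≢b La≢0 Ly≢0 Ly≢La
      ... | yes Ly≡La = via-head y≤c Lb≢0 Ly≢0 λ p → Lb≢La (trans (sym p) Ly≡La)

  -- Distinct vertices reached by disjoint walks cannot share a label: it would have
  -- to be s, which is the label of s only.
  separated : ∀ {L x y} → Labelled e L → (w : Walk e x) (w′ : Walk e y) → x ≤ c → y ≤ c →
    x ≢ y → Disjoint w w′ → L x ≢ L y
  separated {L} {x} {y} Λ w w′ x≤c y≤c x≢y d Lx≡Ly with L x in eq
  ... | zero = live Λ w eq
  ... | suc z = x≢y (trans (other Λ x≤c (trans eq z≡s)) (sym (other Λ y≤c (trans (sym Lx≡Ly) z≡s))))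
    where
    z≡s : suc z ≡ suc s
    z≡s = cong suc (d z (passes Λ w eq) (passes Λ w′ (sym Lx≡Ly)))

------------------------------------------------------------------------
-- Orders in which arcs entering a vertex precede those leaving it

module Sorting (tl hd : ℕ → ℕ) (m : ℕ) where

  -- The arcs ord 0, …, ord (e ∸ 1) are those with a nonzero flag, and each
  -- comes after all arcs that enter its tail.
  record Prefix (e : ℕ) (ord flag : ℕ → ℕ) : Set where
    field
      valid   : ∀ {i} → i < e → ord i < m
      flagged : ∀ {i} → i < e → flag (ord i) ≢ 0
      placed  : ∀ {a} → a < m → flag a ≢ 0 → ∃[ i ] i < e × ord i ≡ a
      inj     : ∀ {i j} → i < e → j < e → ord i ≡ ord j → i ≡ j
      before  : ∀ {i a} → i < e → a < m → hd a ≡ tl (ord i) → ∃[ j ] j < i × ord j ≡ a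

  open Prefix

  prefix-size : ∀ {e ord flag} → Prefix e ord flag → e ≤ m
  prefix-size {ord = ord} P = bounded-injective⇒≤ ord (valid P) (inj P)

  prefix-empty : ∀ {ord flag} → (∀ a → flag a ≡ 0) → Prefix 0 ord flag
  prefix-empty zeros = record
    { valid = λ () ; flagged = λ () ; placed = λ {a} _ p → contradiction (zeros a) p
    ; inj = λ () ; before = λ () }

  prefix-sorted : ∀ {e ord flag} → Prefix e ord flag →
    ∀ {i j} → i < e → j < e → hd (ord j) ≡ tl (ord i) → j < i
  prefix-sorted P i<e j<e eq with before P i<e (valid P j<e) eq
  ... | j′ , j′<i , eq′ = subst (_< _) (inj P (<-trans j′<i i<e) j<e eq′) j′<i

  -- An arc may be appended once all arcs entering its tail have been placed.
  prefix-snoc : ∀ {e ord flag a} → Prefix e ord flag → a < m → flag a ≡ 0 →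
    (∀ {b} → b < m → hd b ≡ tl a → flag b ≢ 0) → Prefix (suc e) (ord [ e ↦ a ]) (flag [ a ↦ 1 ])
  prefix-snoc {e} {ord} {flag} {a} P a<m flag≡0 entering = record
    { valid = valid′ ; flagged = flagged′ ; placed = placed′ ; inj = inj′ ; before = before′ }
    where
    ord′ = ord [ e ↦ a ]
    flag′ = flag [ a ↦ 1 ]
    last : ord′ e ≡ a
    last = ↦-here ord e a
    old : ∀ {i} → i < e → ord′ i ≡ ord i
    old i<e = ↦-there ord a (<⇒≢ i<e)
    split : ∀ {i} → i < suc e → i ≡ e ⊎ i < e
    split {i} i<1+e with i ≟ e
    ... | yes i≡e = inj₁ i≡e
    ... | no i≢e  = inj₂ (≤∧≢⇒< (≤-pred i<1+e) i≢e)
    old≢a : ∀ {i} → i < e → ord i ≢ a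
    old≢a i<e refl = flagged P i<e flag≡0
    keep : ∀ {b} → flag b ≢ 0 → flag′ b ≢ 0
    keep {b} p with b ≟ a
    ... | yes refl = contradiction flag≡0 p
    ... | no b≢a = subst (_≢ 0) (sym (↦-there flag 1 b≢a)) p
    valid′ : ∀ {i} → i < suc e → ord′ i < m
    valid′ i< with split i<
    ... | inj₁ refl = subst (_< m) (sym last) a<m
    ... | inj₂ i<e = subst (_< m) (sym (old i<e)) (valid P i<e)
    flagged′ : ∀ {i} → i < suc e → flag′ (ord′ i) ≢ 0
    flagged′ i< with split i<
    ... | inj₁ refl = subst (λ b → flag′ b ≢ 0) (sym last) (subst (_≢ 0) (sym (↦-here flag a 1)) 1+n≢0)
    ... | inj₂ i<e = subst (λ b → flag′ b ≢ 0) (sym (old i<e)) (keep (flagged P i<e))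
    placed′ : ∀ {b} → b < m → flag′ b ≢ 0 → ∃[ i ] i < suc e × ord′ i ≡ b
    placed′ {b} b<m p with b ≟ a
    ... | yes refl = e , ≤-refl , last
    ... | no b≢a with placed P b<m (subst (_≢ 0) (↦-there flag 1 b≢a) p)
    ...   | i , i<e , eq = i , m≤n⇒m≤1+n i<e , trans (old i<e) eq
    inj′ : ∀ {i j} → i < suc e → j < suc e → ord′ i ≡ ord′ j → i ≡ j
    inj′ i< j< eq with split i< | split j<
    ... | inj₁ refl | inj₁ refl = refl
    ... | inj₁ refl | inj₂ j<e = contradiction (trans (sym (old j<e)) (trans (sym eq) last)) (old≢a j<e)
    ... | inj₂ i<e | inj₁ refl = contradiction (trans (sym (old i<e)) (trans eq last)) (old≢a i<e)
    ... | inj₂ i<e | inj₂ j<e = inj P i<e j<e (trans (sym (old i<e)) (trans eq (old j<e)))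
    before′ : ∀ {i b} → i < suc e → b < m → hd b ≡ tl (ord′ i) → ∃[ j ] j < i × ord′ j ≡ b
    before′ i< b<m eq with split i<
    ... | inj₂ i<e with before P i<e b<m (trans eq (cong tl (old i<e)))
    ...   | j , j<i , eq′ = j , j<i , trans (old (<-trans j<i i<e)) eq′
    before′ i< b<m eq | inj₁ refl with placed P b<m (entering b<m (trans eq (cong tl last)))
    ...   | j , j<e , eq′ = j , j<e , trans (old j<e) eq′

  -- A walk that ends with the arc a and has t more arcs.
  Chain : ℕ → ℕ → Set
  Chain zero    a = ⊤
  Chain (suc t) a = ∃[ b ] b < m × hd b ≡ tl a × Chain t b

------------------------------------------------------------------------
-- Walks in a directed acyclic graph

module _ {n m : ℕ} (G : DAG n m) where
  open DAG G

  walk⇒closure : ∀ {u v w} → Arc u v → Star Arc v w → TransClosure Arc u w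
  walk⇒closure uv ε        = [ uv ]
  walk⇒closure uv (vx ◅ p) = uv ∷ walk⇒closure vx p

  initial-part : ∀ {u v x} (p : Star Arc u v) → x ∈ vertices G p → Star Arc u x
  initial-part ε       (here refl) = ε
  initial-part (_ ◅ _) (here refl) = ε
  initial-part (a ◅ p) (there x∈)  = a ◅ initial-part p x∈

  walk-simple : ∀ {u v} (p : Star Arc u v) → Unique (vertices G p)
  walk-simple ε       = [] ∷ []
  walk-simple (a ◅ p) = ¬Any⇒All¬ _ (λ u∈ → acyclic (walk⇒closure a (initial-part p u∈))) ∷ walk-simple p

  ∈-vertices-◅◅⁻ : ∀ {u v w x} (p : Star Arc u v) (q : Star Arc v w) →
    x ∈ vertices G (p ◅◅ q) → x ∈ vertices G p ⊎ x ∈ vertices G q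
  ∈-vertices-◅◅⁻ ε       q x∈         = inj₂ x∈
  ∈-vertices-◅◅⁻ (a ◅ p) q (here eq)  = inj₁ (here eq)
  ∈-vertices-◅◅⁻ (a ◅ p) q (there x∈) with ∈-vertices-◅◅⁻ p q x∈
  ... | inj₁ x∈p = inj₁ (there x∈p)
  ... | inj₂ x∈q = inj₂ x∈q

  length-vertices-∷ʳ : ∀ {u v w} (p : Star Arc u v) (a : Arc v w) →
    length (vertices G (p ◅◅ a ◅ ε)) ≡ suc (length (vertices G p))
  length-vertices-∷ʳ ε       a = refl
  length-vertices-∷ʳ (b ◅ p) a = cong suc (length-vertices-∷ʳ p a)

  source∈vertices : ∀ {u v} (p : Star Arc u v) → u ∈ vertices G p
  source∈vertices ε       = here refl
  source∈vertices (_ ◅ _) = here refl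

  tailOf headOf : Fin m → Fin n
  tailOf a = proj₁ (Vec.lookup arcs a)
  headOf a = proj₂ (Vec.lookup arcs a)

  arc : ∀ a → Arc (tailOf a) (headOf a)
  arc a = Vec.∈-lookup a arcs

  number-of : ∀ {u v} → Arc u v → ∃[ a ] tailOf a ≡ u × headOf a ≡ v
  number-of uv = VecAny.index uv , cong proj₁ eq , cong proj₂ eq
    where eq = sym (VecAny.lookup-index uv)

  -- Slots 0, …, cnt ∸ 1 for distinct vertices, among them the ends of all
  -- arcs: nm gives the vertex of a slot, and sl the slots of the tail and the
  -- head of arc a at positions 2 a and 2 a + 1.
  record Numbering (cnt : ℕ) (nm sl : ℕ → ℕ) : Set where
    field
      distinct-names : ∀ {i j} → i < cnt → j < cnt → nm i ≡ nm j → i ≡ j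
      names<   : ∀ {i} → i < cnt → nm i < n
      slot<    : ∀ {p} → p < m + m → sl p < cnt
      tailName : ∀ a → nm (sl (toℕ a + toℕ a)) ≡ toℕ (tailOf a)
      headName : ∀ a → nm (sl (toℕ a + toℕ a + 1)) ≡ toℕ (headOf a)

  a+a+1<m+m : ∀ {a} → a < m → a + a + 1 < m + m
  a+a+1<m+m {a} a<m = begin-strict
    a + a + 1      <⟨ ≤-refl ⟩
    suc (a + a + 1) ≡⟨ cong suc (trans (+-comm (a + a) 1) (sym (+-suc a a))) ⟩
    suc a + suc a  ≤⟨ +-mono-≤ a<m a<m ⟩
    m + m          ∎
    where open ≤-Reasoning

  a+a<m+m : ∀ {a} → a < m → a + a < m + m
  a+a<m+m {a} a<m = <-trans (≤-reflexive (+-comm 1 (a + a))) (a+a+1<m+m a<m)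

  module Slots {cnt nm sl} (ν : Numbering cnt nm sl) where
    open Numbering ν

    tl hd : ℕ → ℕ
    tl a = sl (a + a)
    hd a = sl (a + a + 1)

    cnt≤n : cnt ≤ n
    cnt≤n = bounded-injective⇒≤ nm names< distinct-names

    tl< : ∀ {a} → a < m → tl a < cnt
    tl< a<m = slot< (a+a<m+m a<m)

    hd< : ∀ {a} → a < m → hd a < cnt
    hd< a<m = slot< (a+a+1<m+m a<m)

    open Sorting tl hd m

    chain⇒walk : ∀ t (a : Fin m) → Chain t (toℕ a) →
      ∃[ u ] Σ[ p ∈ Star Arc u (tailOf a) ] length (vertices G p) ≡ suc t
    chain⇒walk zero    a _ = tailOf a , ε , refl
    chain⇒walk (suc t) a (b′ , b<m , hb≡ta , chain)
      with fromℕ< b<m in eq | toℕ-fromℕ< b<m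
    ... | b | refl with chain⇒walk t b chain
    ...   | u , p , len = u , subst (λ v → Σ[ p ∈ Star Arc u v ] length (vertices G p) ≡ suc (suc t)) meet
                                    (p ◅◅ arc b ◅ ε , trans (length-vertices-∷ʳ p (arc b)) (cong suc len))
      where
      meet : headOf b ≡ tailOf a
      meet = toℕ-injective (trans (sym (headName b)) (trans (cong nm hb≡ta) (tailName a)))

    -- The vertices of a walk are distinct, so there are at most n of them.
    no-long-chain : ∀ {a} → a < m → ¬ Chain n a
    no-long-chain {a} a<m chain with chain⇒walk n (fromℕ< a<m) (subst (Chain n) (sym (toℕ-fromℕ< a<m)) chain)
    ... | u , p , len = <-irrefl refl (subst (_≤ n) len (Unique⇒length≤ (walk-simple p)))

    -- z is the slot of the vertex u, or cnt if u has none.  In the latter case the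
    -- last component says that no slot has the name u.
    Slot : ℕ → ℕ → Set
    Slot u z = z ≤ cnt × (z < cnt → nm z ≡ u) × (∀ {i} → i < cnt → nm i ≡ u → i ≡ z)

    -- A junction is the tail of an arc, so it has a slot.
    junction-named : ∀ {u v s} → Junction G u v s → ∃[ x ] x < cnt × nm x ≡ toℕ s
    junction-named {u} {v} {s} (u≢v , P , Q , _) = go (Path.walk P) (Path.walk Q)
      where
      tail-named : ∀ {w} → Arc s w → ∃[ x ] x < cnt × nm x ≡ toℕ s
      tail-named uv with number-of uv
      ... | a , refl , _ = tl (toℕ a) , tl< (toℕ<n a) , tailName a
      go : Star Arc s u → Star Arc s v → ∃[ x ] x < cnt × nm x ≡ toℕ s
      go (a ◅ _) _       = tail-named a
      go ε       (a ◅ _) = tail-named a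
      go ε       ε       = contradiction refl u≢v

    -- All arcs have been put in order, and x is the slot of the source s.
    module Ordered {e ord flag} (P : Prefix e ord flag) (all : ∀ {a} → a < m → flag a ≢ 0)
      {x : ℕ} (x<cnt : x < cnt) (s : Fin n) (x-is-s : nm x ≡ toℕ s) where
      open Prefix P

      open Labels (tl ∘ ord) (hd ∘ ord) e (prefix-sorted P) x cnt public

      walk-target< : ∀ {i z} → i ≤ e → Walk i z → z < cnt
      walk-target< i≤e here              = x<cnt
      walk-target< i≤e (step j<i _ refl) = hd< (valid (<-≤-trans j<i i≤e))

      on⇒< : ∀ {i z y} → i ≤ e → (w : Walk i z) → On y w → y < cnt
      on⇒< i≤e here refl = x<cnt
      on⇒< i≤e w@(step _ _ _) (inj₁ refl) = walk-target< i≤e w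
      on⇒< i≤e (step j<i w _) (inj₂ o) = on⇒< (≤-trans (<⇒≤ j<i) i≤e) w o

      -- Translate a path in the graph to a walk between slots, prolonging a given
      -- walk w; N holds for the vertices of both.
      from-path : (N : ℕ → Set) → ∀ {u v} (p : Star Arc u v) → (∀ {y} → y ∈ vertices G p → N (toℕ y)) →
        ∀ {z} → z < cnt → nm z ≡ toℕ u → (w : Walk e z) → (∀ y → On y w → N (nm y)) →
        ∃[ z′ ] z′ < cnt × nm z′ ≡ toℕ v × Σ[ w′ ∈ Walk e z′ ] (∀ y → On y w′ → N (nm y))
      from-path N ε       _  z< z-is-u w on = _ , z< , z-is-u , w , on
      from-path N {u} (uv ◅ p) N-p {z} z< z-is-u w on with number-of uv
      ... | a , refl , refl with placed (toℕ<n a) (all (toℕ<n a))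
      ...   | j , j<e , ord≡a = from-path N p (N-p ∘ there) (hd< (toℕ<n a)) (headName a)
                (step j<e (proj₁ before-j) (cong hd ord≡a)) on′
        where
        z≡tl : z ≡ tl (ord j)
        z≡tl = distinct-names z< (tl< (valid j<e))
          (trans z-is-u (trans (sym (tailName a)) (cong (nm ∘ tl) (sym ord≡a))))
        at-j : Σ[ w′ ∈ Walk e (tl (ord j)) ] (∀ y → On y w′ → N (nm y))
        at-j = subst (λ z → Σ[ w′ ∈ Walk e z ] (∀ y → On y w′ → N (nm y))) z≡tl (w , on)
        before-j : Σ[ w′ ∈ Walk j (tl (ord j)) ] (∀ y → On y w′ → On y (proj₁ at-j))
        before-j = below j<e (proj₁ at-j) refl
        on′ : ∀ y → y ≡ hd (toℕ a) ⊎ On y (proj₁ before-j) → N (nm y)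
        on′ y (inj₁ refl) = subst N (sym (headName a)) (N-p (there (source∈vertices p)))
        on′ y (inj₂ o)    = proj₂ at-j y (proj₂ before-j y o)

      -- Translate a walk between slots to a path in the graph.
      to-path : ∀ {i z} → i ≤ e → (w : Walk i z) → ∀ v → nm z ≡ toℕ v →
        Σ[ p ∈ Star Arc s v ] (∀ {y} → y ∈ vertices G p → ∃[ y′ ] On y′ w × nm y′ ≡ toℕ y)
      to-path i≤e here v z-is-v with toℕ-injective (trans (sym x-is-s) z-is-v)
      ... | refl = ε , λ { (here refl) → _ , refl , x-is-s }
      to-path i≤e (step {j = j} j<i w refl) v z-is-v = extended (fromℕ< ord<m) (toℕ-fromℕ< ord<m)
        where
        ord<m = valid (<-≤-trans j<i i≤e)
        extended : ∀ a → toℕ a ≡ ord j → Σ[ p ∈ Star Arc s v ]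
          (∀ {y} → y ∈ vertices G p → ∃[ y′ ] On y′ (step {x = hd (ord j)} j<i w refl) × nm y′ ≡ toℕ y)
        extended a a≡ord with toℕ-injective (trans (sym z-is-v) (trans (cong (nm ∘ hd) (sym a≡ord)) (headName a)))
        ... | refl with to-path (≤-trans (<⇒≤ j<i) i≤e) w (tailOf a) (trans (cong (nm ∘ tl) (sym a≡ord)) (tailName a))
        ...   | p , on = p ◅◅ arc a ◅ ε , λ y∈ → case ∈-vertices-◅◅⁻ p (arc a ◅ ε) y∈ of λ where
                  (inj₁ y∈p) → map₂ (λ (o , q) → inj₂ o , q) (on y∈p)
                  (inj₂ (here refl)) → _ , inj₂ (target-on w) , trans (cong (nm ∘ tl) (sym a≡ord)) (tailName a)
                  (inj₂ (there (here refl))) → _ , inj₁ refl , z-is-v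

      module _ {L} (Λ : Labelled e L) {u v : Fin n} {zu zv : ℕ} (Zu : Slot (toℕ u) zu) (Zv : Slot (toℕ v) zv) where

        junction⇒labels : Junction G u v s → L zu ≢ 0 × L zv ≢ 0 × L zu ≢ L zv
        junction⇒labels (u≢v , P , Q , d) = labels (walk-to P Zu) (walk-to Q Zv)
          where
          walk-to : ∀ {u zu} (P : Path G s u) → Slot (toℕ u) zu →
            zu < cnt × nm zu ≡ toℕ u ×
            Σ[ w ∈ Walk e zu ] (∀ y → On y w → ∃[ y′ ] y′ ∈ vertices G (Path.walk P) × toℕ y′ ≡ nm y)
          walk-to P (_ , _ , only) with from-path (λ k → ∃[ y′ ] y′ ∈ vertices G (Path.walk P) × toℕ y′ ≡ k)
            (Path.walk P) (λ y∈ → _ , y∈ , refl) x<cnt x-is-s here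
            (λ { _ refl → s , source∈vertices (Path.walk P) , sym x-is-s })
          ... | z , z< , z-is-u , w , on with only z< z-is-u
          ...   | refl = z< , z-is-u , w , on
          labels : (zu < cnt × nm zu ≡ toℕ u ×
            Σ[ w ∈ Walk e zu ] (∀ y → On y w → ∃[ y′ ] y′ ∈ vertices G (Path.walk P) × toℕ y′ ≡ nm y)) →
            (zv < cnt × nm zv ≡ toℕ v ×
            Σ[ w ∈ Walk e zv ] (∀ y → On y w → ∃[ y′ ] y′ ∈ vertices G (Path.walk Q) × toℕ y′ ≡ nm y)) →
            L zu ≢ 0 × L zv ≢ 0 × L zu ≢ L zv
          labels (zu< , zu-is-u , w , on) (zv< , zv-is-v , w′ , on′) =
            Labelled.live Λ w , Labelled.live Λ w′ ,
            separated Λ w w′ (<⇒≤ zu<) (<⇒≤ zv<)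
              (λ { refl → u≢v (toℕ-injective (trans (sym zu-is-u) zv-is-v)) })
              disjoint
            where
            disjoint : Disjoint w w′
            disjoint z o o′ with on z o | on′ z o′
            ... | y , y∈P , eq | y′ , y′∈Q , eq′ with toℕ-injective (trans eq (sym eq′))
            ...   | refl with d y y∈P y′∈Q
            ...     | refl = distinct-names (on⇒< ≤-refl w o) x<cnt (trans (sym eq) (sym x-is-s))

        labels⇒junction : L zu ≢ 0 → L zv ≢ 0 → L zu ≢ L zv → Junction G u v s
        labels⇒junction Lu≢0 Lv≢0 Lu≢Lv with Labelled.apart Λ (proj₁ Zu) (proj₁ Zv) Lu≢0 Lv≢0 Lu≢Lv
        ... | w , w′ , d = joined (to-path ≤-refl w u (proj₁ (proj₂ Zu) (walk-target< ≤-refl w)))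
                                  (to-path ≤-refl w′ v (proj₁ (proj₂ Zv) (walk-target< ≤-refl w′)))
          where
          joined : Σ[ p ∈ Star Arc s u ] (∀ {y} → y ∈ vertices G p → ∃[ y′ ] On y′ w × nm y′ ≡ toℕ y) →
                   Σ[ p ∈ Star Arc s v ] (∀ {y} → y ∈ vertices G p → ∃[ y′ ] On y′ w′ × nm y′ ≡ toℕ y) →
                   Junction G u v s
          joined (p , on) (q , on′) =
            (λ { refl → Lu≢Lv (cong L (proj₂ (proj₂ Zv) (walk-target< ≤-refl w)
                   (proj₁ (proj₂ Zu) (walk-target< ≤-refl w)))) }) ,
            record { walk = p ; simple = walk-simple p } , record { walk = q ; simple = walk-simple q } , disjoint
            where
            disjoint : ∀ y → y ∈ vertices G p → y ∈ vertices G q → y ≡ s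
            disjoint y y∈p y∈q with on y∈p | on′ y∈q
            ... | y₁ , o₁ , eq₁ | y₂ , o₂ , eq₂
              with distinct-names (on⇒< ≤-refl w o₁) (on⇒< ≤-refl w′ o₂) (trans eq₁ (sym eq₂))
            ...   | refl = toℕ-injective (trans (sym eq₁) (trans (cong nm (d y₁ o₁ o₂)) x-is-s))

------------------------------------------------------------------------
-- Numbering the ends of the arcs

-- The part of the input that lists arcs or pairs.
flatten : ∀ {n} → List (Fin n × Fin n) → List ℕ
flatten = List.concatMap (λ (u , v) → toℕ u ∷ toℕ v ∷ [])

module _ {n : ℕ} where

  nth-flatten-fst : ∀ {l} (xs : Vec (Fin n × Fin n) l) ys i →
    nth (flatten (Vec.toList xs ++ ys)) (toℕ i + toℕ i) ≡ toℕ (proj₁ (Vec.lookup xs i))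
  nth-flatten-fst (x Vec.∷ xs) ys zero    = refl
  nth-flatten-fst (x Vec.∷ xs) ys (suc i) rewrite +-suc (toℕ i) (toℕ i) = nth-flatten-fst xs ys i

  nth-flatten-snd : ∀ {l} (xs : Vec (Fin n × Fin n) l) ys i →
    nth (flatten (Vec.toList xs ++ ys)) (suc (toℕ i + toℕ i)) ≡ toℕ (proj₂ (Vec.lookup xs i))
  nth-flatten-snd (x Vec.∷ xs) ys zero    = refl
  nth-flatten-snd (x Vec.∷ xs) ys (suc i) rewrite +-suc (toℕ i) (toℕ i) = nth-flatten-snd xs ys i

  nth-flatten-skip : ∀ {l} (xs : Vec (Fin n × Fin n) l) ys q →
    nth (flatten (Vec.toList xs ++ ys)) (l + l + q) ≡ nth (flatten ys) q
  nth-flatten-skip Vec.[]                 ys q = refl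
  nth-flatten-skip {suc l} (x Vec.∷ xs) ys q rewrite +-suc l l = nth-flatten-skip xs ys q

  nth-flatten-< : ∀ {l} (xs : Vec (Fin n × Fin n) l) ys {p} → p < l + l →
    nth (flatten (Vec.toList xs ++ ys)) p < n
  nth-flatten-< {suc l} (x Vec.∷ xs) ys {zero}        p< = toℕ<n (proj₁ x)
  nth-flatten-< {suc l} (x Vec.∷ xs) ys {suc zero}    p< = toℕ<n (proj₂ x)
  nth-flatten-< {suc l} (x Vec.∷ xs) ys {suc (suc p)} p< =
    nth-flatten-< xs ys (≤-pred (≤-pred (subst (suc (suc p) <_) (cong suc (+-suc l l)) p<)))

-- The sizes of the memory and of the words suffice; top bounds all numbers
-- that occur.
record Fits (n m k cells W top : ℕ) : Set where
  field
    room       : 8 * suc (m + m) ≤ cells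
    base≤top   : 8 * suc (m + m) ≤ top
    top<W      : top < W
    n≤top      : n ≤ top
    k+m≤top    : k + m ≤ top
    input-fits : 3 + (m + m + (k + k)) ≤ top

module Execution {n m k : ℕ} (G : DAG n m) (ps : Pairs n k) {cells W top : ℕ}
  (sizes : Fits n m k cells W top) where

  open Fits sizes public
  open Logic m (encode G ps) cells W top room base≤top top<W public

  -- End p of the arcs: the tail of arc a for p = 2 a, its head for p = 2 a + 1.
  endpoint : ℕ → ℕ
  endpoint p = nth (encode G ps) (3 + p)

  endpoint< : ∀ {p} → p < m + m → endpoint p < n
  endpoint< = nth-flatten-< (DAG.arcs G) (Vec.toList ps)

  ev-#vertices : ∀ {s} → Ev #vertices s n
  ev-#vertices = ev-inp (ev-lit z≤n) refl n≤top

  ev-#arcs : ∀ {s} → Ev #arcs s m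
  ev-#arcs = ev-inp (ev-lit (≤-trans (s≤s z≤n) 8≤top)) refl (≤-trans (m≤n+m m k) k+m≤top)

  ev-#pairs : ∀ {s} → Ev #pairs s k
  ev-#pairs = ev-inp (ev-lit (≤-trans (s≤s (s≤s z≤n)) 8≤top)) refl (≤-trans (m≤m+n k m) k+m≤top)

  ev-2#arcs : ∀ {s} → Ev (#arcs ⊕ #arcs) s (m + m)
  ev-2#arcs = ev-⊕ ev-#arcs ev-#arcs (index≤top ≤-refl)

  -- The first of the slots 0, …, cnt with name u.
  record Found (cnt : ℕ) (nm : ℕ → ℕ) (u j : ℕ) : Set where
    field
      j≤cnt  : j ≤ cnt
      match  : nm j ≡ u
      first  : ∀ {i} → i < j → nm i ≢ u

  find-run : ∀ {r0 cnt r2 r3 u r5 rs nm As o} → cnt ≤ m + m → cnt ≤ n → u ≤ top → (∀ {i} → i < cnt → nm i < n) →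
    Run find (st (r0 ∷ cnt ∷ r2 ∷ r3 ∷ u ∷ r5 ∷ rs) (nm ∷ As) o) (3 + 2 * n) λ s →
      ∃[ j ] s ≡ st (r0 ∷ cnt ∷ r2 ∷ r3 ∷ u ∷ j ∷ rs) (nm [ cnt ↦ u ] ∷ As) o × Found cnt (nm [ cnt ↦ u ]) u j
  find-run {r0} {cnt} {r2} {r3} {u} {r5} {rs} {nm} {As} {o} cnt≤ cnt≤n u≤top names =
    put-then (ev-reg (index≤top cnt≤)) cnt≤ (ev-reg u≤top)
    (assign-then (ev-lit z≤n)
    (run-weaken (s≤s (*-monoʳ-≤ 2 cnt≤n)) (search cnt 0 (+-identityʳ cnt) λ ())))
    where
    nm′ = nm [ cnt ↦ u ]
    Post : AState → Set
    Post s = ∃[ j ] s ≡ st (r0 ∷ cnt ∷ r2 ∷ r3 ∷ u ∷ j ∷ rs) (nm′ ∷ As) o × Found cnt nm′ u j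
    name≤top : ∀ {j} → j ≤ cnt → nm′ j ≤ top
    name≤top {j} j≤cnt with j ≟ cnt
    ... | yes refl = subst (_≤ top) (sym (↦-here nm j u)) u≤top
    ... | no j≢cnt = subst (_≤ top) (sym (↦-there nm u j≢cnt))
                       (≤-trans (<⇒≤ (names (≤∧≢⇒< j≤cnt j≢cnt))) n≤top)
    differ-ev : ∀ {j} → j ≤ cnt →
      Ev (cell 0 (reg 5) ≠ reg 4) (st (r0 ∷ cnt ∷ r2 ∷ r3 ∷ u ∷ j ∷ rs) (nm′ ∷ As) o) (distance (nm′ j) u)
    differ-ev j≤cnt = ev-≠
      (ev-cell (ev-reg (index≤top (≤-trans j≤cnt cnt≤))) (≤-trans j≤cnt cnt≤) refl (name≤top j≤cnt))
      (ev-reg u≤top)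
    -- d is the distance to the sentinel, which bounds the remaining steps.
    search : ∀ d j → d + j ≡ cnt → (∀ {i} → i < j → nm′ i ≢ u) →
      Run (whileNonzero (cell 0 (reg 5) ≠ reg 4) (5 ≔ reg 5 ⊕ lit 1))
        (st (r0 ∷ cnt ∷ r2 ∷ r3 ∷ u ∷ j ∷ rs) (nm′ ∷ As) o) (1 + 2 * d) Post
    search d j eq first with nm′ j ≟ u
    ... | yes found = while-done cond (≡⇒distance≡0 found)
                        (j , refl , record { j≤cnt = j≤cnt ; match = found ; first = first })
      where
      j≤cnt = subst (j ≤_) eq (m≤n+m j d)
      cond = differ-ev j≤cnt
    search zero j refl first | no differ = contradiction (↦-here nm j u) differ
    search (suc d) j eq first | no differ =
      run-weaken (≤-reflexive (time d)) (while-step 1 cond (λ p → differ (distance≡0⇒≡ p))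
        (run-assign {Q = _≡ st (r0 ∷ cnt ∷ r2 ∷ r3 ∷ u ∷ suc j ∷ rs) (nm′ ∷ As) o}
          (ev-suc (ev-reg (index≤top (≤-trans j≤cnt cnt≤))) (index≤top (≤-trans j<cnt cnt≤))) refl)
        λ { refl → search d (suc j) (trans (+-suc d j) eq) first′ })
      where
      time : ∀ d → suc (1 + (1 + 2 * d)) ≡ 1 + 2 * suc d
      time = solve-∀
      j<cnt = subst (j <_) eq (s≤s (m≤n+m j d))
      j≤cnt = <⇒≤ j<cnt
      cond = differ-ev j≤cnt
      first′ : ∀ {i} → i < suc j → nm′ i ≢ u
      first′ {i} i< with i ≟ j
      ... | yes refl = differ
      ... | no i≢j = first (≤∧≢⇒< (≤-pred i<) i≢j)

  -- The numbering of the first p ends of arcs.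
  record Partial (p cnt : ℕ) (nm sl : ℕ → ℕ) : Set where
    field
      size     : cnt ≤ p
      distinct : ∀ {i j} → i < cnt → j < cnt → nm i ≡ nm j → i ≡ j
      names<   : ∀ {i} → i < cnt → nm i < n
      slots    : ∀ {q} → q < p → sl q < cnt × nm (sl q) ≡ endpoint q

  -- The new number of slots is written as the program computes it: it exceeds cnt
  -- exactly if the sentinel was found.
  partial-snoc : ∀ {p cnt nm sl j} → p < m + m → Partial p cnt nm sl →
    Found cnt (nm [ cnt ↦ endpoint p ]) (endpoint p) j →
    Partial (suc p) (cnt + (suc j ∸ cnt)) (nm [ cnt ↦ endpoint p ]) (sl [ p ↦ j ])
  partial-snoc {p} {cnt} {nm} {sl} {j} p< Π F = by-cases (j ≟ cnt)
    where
    open Partial Π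
    open Found F
    nm′ = nm [ cnt ↦ endpoint p ]
    old : ∀ {i} → i < cnt → nm′ i ≡ nm i
    old i< = ↦-there nm (endpoint p) (<⇒≢ i<)
    slots′ : ∀ {c} → cnt ≤ c → j < c → ∀ {q} → q < suc p → (sl [ p ↦ j ]) q < c × nm′ ((sl [ p ↦ j ]) q) ≡ endpoint q
    slots′ cnt≤c j<c {q} q< with q ≟ p
    ... | yes refl rewrite ↦-here sl q j = j<c , match
    ... | no q≢p rewrite ↦-there sl j q≢p =
      <-≤-trans (proj₁ sq) cnt≤c , trans (old (proj₁ sq)) (proj₂ sq)
      where sq = slots (≤∧≢⇒< (≤-pred q<) q≢p)
    by-cases : Dec (j ≡ cnt) → Partial (suc p) (cnt + (suc j ∸ cnt)) nm′ (sl [ p ↦ j ])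
    by-cases (no j≢cnt) rewrite m≤n⇒m∸n≡0 (≤∧≢⇒< j≤cnt j≢cnt) | +-identityʳ cnt = record
      { size     = m≤n⇒m≤1+n size
      ; distinct = λ i< j< eq → distinct i< j< (trans (sym (old i<)) (trans eq (old j<)))
      ; names<   = λ i< → subst (_< n) (sym (old i<)) (names< i<)
      ; slots    = slots′ ≤-refl (≤∧≢⇒< j≤cnt j≢cnt)
      }
    by-cases (yes refl) rewrite m+n∸n≡m 1 j | +-comm j 1 = record
      { size     = s≤s size
      ; distinct = distinct′
      ; names<   = names<′
      ; slots    = slots′ (n≤1+n j) ≤-refl
      }
      where
      names<′ : ∀ {i} → i < suc j → nm′ i < n
      names<′ {i} i< with i ≟ j
      ... | yes refl = subst (_< n) (sym match) (endpoint< p<)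
      ... | no i≢j = subst (_< n) (sym (↦-there nm _ i≢j)) (names< (≤∧≢⇒< (≤-pred i<) i≢j))
      distinct′ : ∀ {a b} → a < suc j → b < suc j → nm′ a ≡ nm′ b → a ≡ b
      distinct′ {a} {b} a< b< eq with a ≟ j | b ≟ j
      ... | yes refl | yes refl = refl
      ... | yes refl | no b≢j = contradiction (trans (sym eq) match) (first (≤∧≢⇒< (≤-pred b<) b≢j))
      ... | no a≢j | yes refl = contradiction (trans eq match) (first (≤∧≢⇒< (≤-pred a<) a≢j))
      ... | no a≢j | no b≢j = distinct (≤∧≢⇒< (≤-pred a<) a≢j) (≤∧≢⇒< (≤-pred b<) b≢j)
            (trans (sym (↦-there nm _ a≢j)) (trans eq (↦-there nm _ b≢j)))

  number-run : ∀ {r0 r2 r3 u r5 rs nm sl As o} →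
    Run number (st (r0 ∷ 0 ∷ r2 ∷ r3 ∷ u ∷ r5 ∷ rs) (nm ∷ sl ∷ As) o) (2 + (m + m) * (8 + 2 * n)) λ s →
      ∃[ cnt ] ∃[ nm ] ∃[ sl ] cnt ≤ m + m × Numbering G cnt nm sl ×
        ∃[ r3 ] ∃[ u ] ∃[ r5 ] s ≡ st (r0 ∷ cnt ∷ r2 ∷ r3 ∷ u ∷ r5 ∷ rs) (nm ∷ sl ∷ As) o
  number-run {r0} {r2} {r3} {u} {r5} {rs} {nm} {sl} {As} {o} =
    run-map (λ (cnt , nm , sl , u , j , eq , Π) → cnt , nm , sl , Partial.size Π , numbering Π , m + m , u , j , eq)
      (run-for Inv (m + m) (6 + 2 * n) test body
        (0 , nm , sl , u , r5 , refl , record { size = z≤n ; distinct = λ () ; names< = λ () ; slots = λ () }))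
    where
    Inv : ℕ → AState → Set
    Inv p s = ∃[ cnt ] ∃[ nm ] ∃[ sl ] ∃[ u ] ∃[ j ]
      s ≡ st (r0 ∷ cnt ∷ r2 ∷ p ∷ u ∷ j ∷ rs) (nm ∷ sl ∷ As) o × Partial p cnt nm sl
    test : ∀ {p s} → Inv p s → at 0 (regs s) 3 ≡ p × Ev (#arcs ⊕ #arcs) s (m + m)
    test (_ , _ , _ , _ , _ , refl , _) = refl , ev-2#arcs
    body : ∀ {p s} → p < m + m → Inv p s → Run _ s (6 + 2 * n) (Next 3 Inv p)
    body {p} p< (cnt , nm , sl , _ , _ , refl , Π) =
      assign-then (ev-inp (ev-⊕ (ev-lit (≤-trans (m≤m+n 3 5) 8≤top)) (ev-reg (index≤top (<⇒≤ p<))) fits) refl E≤top)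
      (run-weaken (≤-reflexive (time n)) (run-seq (3 + 2 * n)
        (find-run cnt≤ (bounded-injective⇒≤ nm names< distinct) E≤top names<) λ where
        (j , refl , F) →
          put-then (ev-reg (index≤top (<⇒≤ p<))) (<⇒≤ p<) (ev-reg (index≤top (≤-trans (Found.j≤cnt F) cnt≤)))
          (run-assign
            (ev-⊕ (ev-reg (index≤top cnt≤))
              (ev-⊖ (ev-suc (ev-reg (index≤top (≤-trans (Found.j≤cnt F) cnt≤)))
                      (index≤top (≤-trans (s≤s (≤-trans (Found.j≤cnt F) size)) p<)))
                    (ev-reg (index≤top cnt≤)))
              (index≤top (≤-trans (Partial.size (partial-snoc {sl = sl} p< Π F)) p<)))
            (refl , _ , _ , _ , _ , _ , refl , partial-snoc p< Π F))))
      where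
      open Partial Π
      time : ∀ n → 3 + 2 * n + 2 ≡ 5 + 2 * n
      time = solve-∀
      cnt≤ = ≤-trans size (<⇒≤ p<)
      E≤top = ≤-trans (<⇒≤ (endpoint< p<)) n≤top
      fits : 3 + p ≤ top
      fits = ≤-trans (+-monoʳ-≤ 3 (≤-trans (<⇒≤ p<) (m≤m+n _ _))) input-fits
    numbering : ∀ {cnt nm sl} → Partial (m + m) cnt nm sl → Numbering G cnt nm sl
    numbering {cnt} {nm} {sl} Π = record
      { distinct-names = distinct
      ; names<   = names<
      ; slot<    = λ p< → proj₁ (slots p<)
      ; tailName = λ a → trans (proj₂ (slots (a+a<m+m G (toℕ<n a)))) (nth-flatten-fst (DAG.arcs G) _ a)
      ; headName = λ a → trans (proj₂ (slots (a+a+1<m+m G (toℕ<n a))))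
          (trans (cong endpoint (+-comm (toℕ a + toℕ a) 1)) (nth-flatten-snd (DAG.arcs G) _ a))
      }
      where open Partial Π

------------------------------------------------------------------------
-- Sorting the arcs by rounds

module SortRun {n m k : ℕ} (G : DAG n m) (ps : Pairs n k) {cells W top : ℕ}
  (sizes : Fits n m k cells W top)
  {cnt : ℕ} {nm sl : ℕ → ℕ} (cnt≤ : cnt ≤ m + m) (ν : Numbering G cnt nm sl) where

  open Execution G ps sizes public
  open Slots G ν public
  open Sorting tl hd m public

  m≤top : m ≤ top
  m≤top = ≤-trans (m≤n+m m k) k+m≤top

  ev-tail : ∀ {s r} → at none (arrays s) 1 ≡ sl → at 0 (regs s) r < m → Ev (tail r) s (tl (at 0 (regs s) r))
  ev-tail {s} {r} refl a<m = ev-cell (ev-⊕ ev-a ev-a (index≤top 2a≤)) 2a≤ refl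
    (index≤top (≤-trans (<⇒≤ (tl< a<m)) cnt≤))
    where
    ev-a = ev-reg {r = r} (≤-trans (<⇒≤ a<m) m≤top)
    2a≤ = <⇒≤ (a+a<m+m G a<m)

  ev-head : ∀ {s r} → at none (arrays s) 1 ≡ sl → at 0 (regs s) r < m → Ev (head r) s (hd (at 0 (regs s) r))
  ev-head {s} {r} refl a<m = ev-cell
    (ev-⊕ (ev-⊕ ev-a ev-a (index≤top (<⇒≤ (a+a<m+m G a<m)))) (ev-lit (≤-trans (s≤s z≤n) 8≤top)) (index≤top 2a+1≤))
    2a+1≤ refl (index≤top (≤-trans (<⇒≤ (hd< a<m)) cnt≤))
    where
    ev-a = ev-reg {r = r} (≤-trans (<⇒≤ a<m) m≤top)
    2a+1≤ = <⇒≤ (a+a+1<m+m G a<m)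

  2m≤ : ∀ {a} → a < m → a ≤ m + m
  2m≤ a<m = ≤-trans (<⇒≤ a<m) (m≤m+n m m)

  -- In round t, the slots entered by arcs without a flag are marked t + 1.
  mark-run : ∀ {r0 e t u j r6 r7 rs nm₀ ord flag mk As o} → t < n → (∀ a → flag a ≤ 1) → (∀ x → mk x ≤ t) →
    Run mark (st (r0 ∷ cnt ∷ e ∷ t ∷ u ∷ j ∷ r6 ∷ r7 ∷ rs) (nm₀ ∷ sl ∷ ord ∷ flag ∷ mk ∷ As) o) (2 + m * 4) λ s →
      ∃[ mk ] s ≡ st (r0 ∷ cnt ∷ e ∷ t ∷ u ∷ j ∷ r6 ∷ m ∷ rs) (nm₀ ∷ sl ∷ ord ∷ flag ∷ mk ∷ As) o
        × (∀ x → mk x ≤ suc t)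
        × (∀ x → mk x ≡ suc t → ∃[ b ] b < m × flag b ≡ 0 × hd b ≡ x)
        × (∀ {b} → b < m → flag b ≡ 0 → mk (hd b) ≡ suc t)
  mark-run {r0} {e} {t} {u} {j} {r6} {r7} {rs} {nm₀} {ord} {flag} {mk} {As} {o} t<n flag≤1 mk≤t =
    run-for Inv m 2 (λ { (_ , refl , _) → refl , ev-#arcs }) body
      (mk , refl , (λ x → m≤n⇒m≤1+n (mk≤t x)) , (λ x p → contradiction (mk≤t x) (<⇒≱ (≤-reflexive (sym p)))) , λ ())
    where
    Inv : ℕ → AState → Set
    Inv a s = ∃[ mk ] s ≡ st (r0 ∷ cnt ∷ e ∷ t ∷ u ∷ j ∷ r6 ∷ a ∷ rs) (nm₀ ∷ sl ∷ ord ∷ flag ∷ mk ∷ As) o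
        × (∀ x → mk x ≤ suc t)
        × (∀ x → mk x ≡ suc t → ∃[ b ] b < m × flag b ≡ 0 × hd b ≡ x)
        × (∀ {b} → b < a → flag b ≡ 0 → mk (hd b) ≡ suc t)
    body : ∀ {a s} → a < m → Inv a s → Run _ s 2 (Next 7 Inv a)
    body {a} a<m (mk , refl , mk≤ , sound , complete) =
      run-if (ev-cell (ev-reg (≤-trans (<⇒≤ a<m) m≤top)) (2m≤ a<m) refl (≤-trans (flag≤1 a) (≤-trans (s≤s z≤n) 8≤top)))
        (λ flag≢0 → run-skip (refl , mk , refl , mk≤ , sound , λ {b} b< p → case b ≟ a of λ where
          (yes refl) → contradiction p flag≢0
          (no b≢a) → complete (≤∧≢⇒< (≤-pred b<) b≢a) p))
        (λ flag≡0 → run-put (ev-head refl a<m) (≤-trans (<⇒≤ (hd< a<m)) cnt≤)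
          (ev-suc (ev-reg (≤-trans (<⇒≤ t<n) n≤top)) (≤-trans t<n n≤top))
          (refl , mk [ hd a ↦ suc t ] , refl ,
            (λ x → case x ≟ hd a of λ where
              (yes refl) → ≤-reflexive (↦-here mk x (suc t))
              (no x≢) → subst (_≤ suc t) (sym (↦-there mk (suc t) x≢)) (mk≤ x)) ,
            (λ x p → case x ≟ hd a of λ where
              (yes refl) → a , a<m , flag≡0 , refl
              (no x≢) → sound x (trans (sym (↦-there mk (suc t) x≢)) p)) ,
            λ {b} b< p → case hd b ≟ hd a of λ where
              (yes eq) → trans (cong (mk [ hd a ↦ suc t ]) eq) (↦-here mk (hd a) (suc t))
              (no ne) → trans (↦-there mk (suc t) ne) (complete (≤∧≢⇒< (≤-pred b<) λ { refl → ne refl }) p)))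

  -- The arcs without a flag whose tails are not marked come next in the order.
  release-run : ∀ {r0 e t u j r6 r7 rs nm₀ ord flag mk As o} → t < n → (∀ a → flag a ≤ 1) → Prefix e ord flag →
    (∀ {a} → a < m → flag a ≡ 0 → Chain t a) →
    (∀ x → mk x ≤ suc t) →
    (∀ x → mk x ≡ suc t → ∃[ b ] b < m × flag b ≡ 0 × hd b ≡ x) →
    (∀ {b} → b < m → flag b ≡ 0 → mk (hd b) ≡ suc t) →
    Run release (st (r0 ∷ cnt ∷ e ∷ t ∷ u ∷ j ∷ r6 ∷ r7 ∷ rs) (nm₀ ∷ sl ∷ ord ∷ flag ∷ mk ∷ As) o) (2 + m * 7) λ s →
      ∃[ e ] ∃[ ord ] ∃[ flag ]
        s ≡ st (r0 ∷ cnt ∷ e ∷ t ∷ u ∷ j ∷ r6 ∷ m ∷ rs) (nm₀ ∷ sl ∷ ord ∷ flag ∷ mk ∷ As) o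
        × (∀ a → flag a ≤ 1) × Prefix e ord flag × (∀ {a} → a < m → flag a ≡ 0 → Chain (suc t) a)
  release-run {r0} {e} {t} {u} {j} {r6} {r7} {rs} {nm₀} {ord} {flag} {mk} {As} {o}
    t<n flag≤1 P chains mk≤ sound complete =
    run-map (λ (e , ord , flag , eq , f≤1 , P , _ , _ , chains′) →
        e , ord , flag , eq , f≤1 , P , λ {a} a<m → chains′ a<m a<m)
      (run-for Inv m 5 (λ { (_ , _ , _ , refl , _) → refl , ev-#arcs }) body
        (e , ord , flag , refl , flag≤1 , P , (λ _ → refl) , id , λ ()))
    where
    flag₀ = flag
    Inv : ℕ → AState → Set
    Inv a s = ∃[ e ] ∃[ ord ] ∃[ flag ]
        s ≡ st (r0 ∷ cnt ∷ e ∷ t ∷ u ∷ j ∷ r6 ∷ a ∷ rs) (nm₀ ∷ sl ∷ ord ∷ flag ∷ mk ∷ As) o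
        × (∀ b → flag b ≤ 1) × Prefix e ord flag
        × (∀ {b} → a ≤ b → flag b ≡ flag₀ b)
        × (∀ {b} → flag₀ b ≢ 0 → flag b ≢ 0)
        × (∀ {b} → b < a → b < m → flag b ≡ 0 → Chain (suc t) b)
    body : ∀ {a s} → a < m → Inv a s → Run _ s 5 (Next 7 Inv a)
    body {a} a<m (e , ord , flag , refl , f≤1 , P , same , keep , chains′) =
      run-if (ev-cell ev-a (2m≤ a<m) refl (≤-trans (f≤1 a) (≤-trans (s≤s z≤n) 8≤top)))
        (λ flag≢0 → run-skip (refl , e , ord , flag , refl , f≤1 , P , same ∘ <⇒≤ , keep ,
          λ b< b<m p → case m<1+n⇒m<n∨m≡n b< of λ where
            (inj₁ b<a) → chains′ b<a b<m p
            (inj₂ refl) → contradiction p flag≢0))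
        λ flag≡0 → run-if (ev-⊖ (ev-cell (ev-tail refl a<m) (≤-trans (<⇒≤ (tl< a<m)) cnt≤) refl
                                  (≤-trans (mk≤ _) (≤-trans t<n n≤top)))
                                (ev-reg (≤-trans (<⇒≤ t<n) n≤top)))
          (λ marked → run-skip (refl , e , ord , flag , refl , f≤1 , P , same ∘ <⇒≤ , keep ,
            λ b< b<m p → case m<1+n⇒m<n∨m≡n b< of λ where
              (inj₁ b<a) → chains′ b<a b<m p
              (inj₂ refl) → case sound (tl a) (≤-antisym (mk≤ _) (m∸n≢0⇒n<m marked)) of λ where
                (b′ , b′<m , unflagged , eq) → b′ , b′<m , eq , chains b′<m unflagged))
          λ unmarked →
            put-then ev-a (2m≤ a<m) (ev-lit (≤-trans (s≤s z≤n) 8≤top))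
            (put-then (ev-reg (≤-trans e≤m m≤top)) (≤-trans e≤m (m≤m+n m m)) ev-a
            (run-assign (ev-suc (ev-reg (≤-trans e≤m m≤top)) (≤-trans (prefix-size (P′ flag≡0 unmarked)) m≤top))
              (refl , suc e , _ , _ , refl , f≤1′ , P′ flag≡0 unmarked ,
                (λ a<b → trans (↦-there flag 1 (<⇒≢ a<b ∘ sym)) (same (<⇒≤ a<b))) ,
                (λ p → raise (keep p)) ,
                λ {b} b< b<m p → case b ≟ a of λ where
                  (yes refl) → contradiction (trans (sym p) (↦-here flag a 1)) λ ()
                  (no b≢a) → chains′ (≤∧≢⇒< (≤-pred b<) b≢a) b<m (trans (sym (↦-there flag 1 b≢a)) p))))
      where
      ev-a : ∀ {rs′ As′ o′ r6 j u t e cnt r0} → Ev (reg 7) (st (r0 ∷ cnt ∷ e ∷ t ∷ u ∷ j ∷ r6 ∷ a ∷ rs′) As′ o′) a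
      ev-a = ev-reg (≤-trans (<⇒≤ a<m) m≤top)
      e≤m = prefix-size P
      P′ : flag a ≡ 0 → mk (tl a) ∸ t ≡ 0 → Prefix (suc e) (ord [ e ↦ a ]) (flag [ a ↦ 1 ])
      P′ flag≡0 unmarked = prefix-snoc P a<m flag≡0 λ {b} b<m eq flag≡0′ → case flag₀ b ≟ 0 of λ where
        (yes p) → 1+n≰n (≤-trans (≤-reflexive (sym (trans (cong mk (sym eq)) (complete b<m p))))
                                 (m∸n≡0⇒m≤n unmarked))
        (no p) → keep p flag≡0′
      raise : ∀ {b} → flag b ≢ 0 → (flag [ a ↦ 1 ]) b ≢ 0
      raise {b} p q with b ≟ a
      ... | yes refl = contradiction (trans (sym q) (↦-here flag a 1)) λ ()
      ... | no b≢a = p (trans (sym (↦-there flag 1 b≢a)) q)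
      f≤1′ : ∀ b → (flag [ a ↦ 1 ]) b ≤ 1
      f≤1′ b with b ≟ a
      ... | yes refl = ≤-reflexive (↦-here flag a 1)
      ... | no b≢a = subst (_≤ 1) (sym (↦-there flag 1 b≢a)) (f≤1 b)

  -- After t rounds, an unreleased arc ends a walk with t more arcs; none is left
  -- after n rounds.
  sort-run : ∀ {r0 r3 u j r6 r7 rs nm₀ ord As o} →
    Run sort (st (r0 ∷ cnt ∷ 0 ∷ r3 ∷ u ∷ j ∷ r6 ∷ r7 ∷ rs) (nm₀ ∷ sl ∷ ord ∷ none ∷ none ∷ As) o)
        (2 + n * (6 + m * 11)) λ s →
      ∃[ e ] ∃[ ord ] ∃[ flag ] ∃[ mk ] ∃[ r3 ] ∃[ r7 ]
        s ≡ st (r0 ∷ cnt ∷ e ∷ r3 ∷ u ∷ j ∷ r6 ∷ r7 ∷ rs) (nm₀ ∷ sl ∷ ord ∷ flag ∷ mk ∷ As) o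
        × Prefix e ord flag × (∀ {a} → a < m → flag a ≢ 0)
  sort-run {r0} {r3} {u} {j} {r6} {r7} {rs} {nm₀} {ord} {As} {o} =
    run-map (λ (e , ord , flag , mk , r7 , eq , _ , P , _ , chains) → e , ord , flag , mk , _ , r7 , eq , P ,
        λ a<m p → no-long-chain a<m (chains a<m p))
      (run-for Inv n (4 + m * 11) (λ { (_ , _ , _ , _ , _ , refl , _) → refl , ev-#vertices }) body
        (0 , ord , none , none , r7 , refl , (λ _ → z≤n) , prefix-empty (λ _ → refl) , (λ _ → z≤n) , λ _ _ → tt))
    where
    Inv : ℕ → AState → Set
    Inv t s = ∃[ e ] ∃[ ord ] ∃[ flag ] ∃[ mk ] ∃[ r7 ]
        s ≡ st (r0 ∷ cnt ∷ e ∷ t ∷ u ∷ j ∷ r6 ∷ r7 ∷ rs) (nm₀ ∷ sl ∷ ord ∷ flag ∷ mk ∷ As) o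
        × (∀ a → flag a ≤ 1) × Prefix e ord flag × (∀ x → mk x ≤ t)
        × (∀ {a} → a < m → flag a ≡ 0 → Chain t a)
    time : ∀ m → 2 + m * 4 + (2 + m * 7) ≡ 4 + m * 11
    time = solve-∀
    body : ∀ {t s} → t < n → Inv t s → Run _ s (4 + m * 11) (Next 3 Inv t)
    body {t} t<n (e , ord , flag , mk , r7 , refl , f≤1 , P , mk≤ , chains) =
      run-weaken (≤-reflexive (time m))
      (run-seq (2 + m * 4) (mark-run t<n f≤1 mk≤) λ { (mk′ , refl , mk′≤ , sound , complete) →
        run-map (λ { (e , ord , flag , refl , f≤1 , P , chains) →
            refl , e , ord , flag , mk′ , m , refl , f≤1 , P , mk′≤ , chains })
          (release-run t<n f≤1 P chains mk′≤ sound complete) })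

------------------------------------------------------------------------
-- Processing the pairs in batches

module BatchRun {n m k : ℕ} (G : DAG n m) (ps : Pairs n k) {cells W top : ℕ}
  (sizes : Fits n m k cells W top)
  {cnt : ℕ} {nm sl : ℕ → ℕ} (cnt≤ : cnt ≤ m + m) (ν : Numbering G cnt nm sl)
  {e : ℕ} {ord flag : ℕ → ℕ} (P : Sorting.Prefix (Slots.tl G ν) (Slots.hd G ν) m e ord flag)
  (all : ∀ {a} → a < m → flag a ≢ 0) where

  open SortRun G ps sizes cnt≤ ν public
  open Numbering ν
  open Prefix P

  e≤m : e ≤ m
  e≤m = prefix-size P

  cnt≤top : cnt ≤ top
  cnt≤top = index≤top cnt≤

  cnt<top : cnt < top
  cnt<top = begin-strict
    cnt              <⟨ s≤s cnt≤ ⟩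
    suc (m + m)      ≤⟨ m≤n*m (suc (m + m)) 8 ⟩
    8 * suc (m + m)  ≤⟨ base≤top ⟩
    top              ∎
    where open ≤-Reasoning

  first second : Fin k → Fin n
  first  i = proj₁ (Vec.lookup ps i)
  second i = proj₂ (Vec.lookup ps i)

  -- What emit has to achieve.  Emits c holds when, for all i, the sources in
  -- the slots 0, …, c i ∸ 1 have been tried for pair i; Goal is to hold when all
  -- have been tried.
  record Emitter (emit : Cmd) (Goal : (ℕ → ℕ) → List (ℕ × ℕ) → Set) : Set₁ where
    field
      Emits : (c out : ℕ → ℕ) → List (ℕ × ℕ) → Set
      emit-run : ∀ {c out o r4 r5 r6 i₀ b x rs nm₀ a1 a2 a3 a4 a5 a6 a7} →
        ∀ i s → toℕ i ≡ i₀ + b → c (toℕ i) ≡ x → x < cnt → nm x ≡ toℕ s → nm₀ x ≡ nm x →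
        JunctionOfPair G ps i s → Emits c out o →
        Run emit (st (base ∷ cnt ∷ e ∷ i₀ ∷ r4 ∷ r5 ∷ r6 ∷ b ∷ x ∷ rs)
                     (nm₀ ∷ a1 ∷ a2 ∷ a3 ∷ a4 ∷ a5 ∷ a6 ∷ a7 ∷ out ∷ []) o) 2 λ s →
          ∃[ out ] ∃[ o ] s ≡ st (base ∷ cnt ∷ e ∷ i₀ ∷ r4 ∷ r5 ∷ r6 ∷ b ∷ x ∷ rs)
                     (nm₀ ∷ a1 ∷ a2 ∷ a3 ∷ a4 ∷ a5 ∷ a6 ∷ a7 ∷ out ∷ []) o
            × Emits (c [ toℕ i ↦ suc x ]) out o
      emit-skip : ∀ {c out o x} → ∀ i s → c (toℕ i) ≡ x → x < cnt → nm x ≡ toℕ s →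
        ¬ JunctionOfPair G ps i s → Emits c out o → Emits (c [ toℕ i ↦ suc x ]) out o
      emit-start : Emits none none []
      emit-end : ∀ {c out o} → (∀ {i} → i < k → c i ≡ cnt) → Emits c out o → Goal out o

  i+i≤k+k : ∀ (i : Fin k) → suc (toℕ i + toℕ i) ≤ k + k
  i+i≤k+k i = +-mono-≤ (toℕ<n i) (<⇒≤ (toℕ<n i))

  pair-index : ∀ {r0 r1 r2 i₀ r4 r5 r6 b rs As o} (i : Fin k) → toℕ i ≡ i₀ + b →
    Ev pair (st (r0 ∷ r1 ∷ r2 ∷ i₀ ∷ r4 ∷ r5 ∷ r6 ∷ b ∷ rs) As o) (3 + (m + m + (toℕ i + toℕ i)))
  pair-index {i₀ = i₀} {b = b} i eq rewrite eq =
    ev-⊕ (ev-lit (≤-trans (m≤m+n 3 _) bound))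
      (ev-⊕ ev-2#arcs
        (ev-⊕ ev-ib ev-ib (≤-trans (≤-trans (m≤n+m _ (m + m)) (m≤n+m _ 3)) bound))
        (≤-trans (m≤n+m _ 3) bound))
      bound
    where
    bound : 3 + (m + m + (i₀ + b + (i₀ + b))) ≤ top
    bound = ≤-trans (+-monoʳ-≤ 3 (+-monoʳ-≤ (m + m) (subst (λ x → x + x ≤ k + k) eq (<⇒≤ (i+i≤k+k i))))) input-fits
    ib≤top : i₀ + b ≤ top
    ib≤top = ≤-trans (m≤m+n (i₀ + b) (i₀ + b)) (≤-trans (≤-trans (m≤n+m _ (m + m)) (m≤n+m _ 3)) bound)
    ev-ib = ev-⊕ (ev-reg {r = 3} (≤-trans (m≤m+n i₀ b) ib≤top)) (ev-reg {r = 7} (≤-trans (m≤n+m b i₀) ib≤top)) ib≤top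

  nth-first : ∀ i → nth (encode G ps) (3 + (m + m + (toℕ i + toℕ i))) ≡ toℕ (first i)
  nth-first i = trans (nth-flatten-skip (DAG.arcs G) (Vec.toList ps) _)
    (subst (λ l → nth (flatten l) (toℕ i + toℕ i) ≡ toℕ (first i)) (++-identityʳ (Vec.toList ps))
      (nth-flatten-fst ps [] i))

  nth-second : ∀ i → nth (encode G ps) (suc (3 + (m + m + (toℕ i + toℕ i)))) ≡ toℕ (second i)
  nth-second i = trans
    (cong (nth (flatten (Vec.toList (DAG.arcs G) ++ Vec.toList ps))) (sym (+-suc (m + m) (toℕ i + toℕ i))))
    (trans (nth-flatten-skip (DAG.arcs G) (Vec.toList ps) _)
      (subst (λ l → nth (flatten l) (suc (toℕ i + toℕ i)) ≡ toℕ (second i)) (++-identityʳ (Vec.toList ps))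
        (nth-flatten-snd ps [] i)))

  -- The array of names may differ from nm at the sentinel.
  Agree : (ℕ → ℕ) → Set
  Agree nm₀ = ∀ {i} → i < cnt → nm₀ i ≡ nm i

  agree-sentinel : ∀ {nm₀ u} → Agree nm₀ → Agree (nm₀ [ cnt ↦ u ])
  agree-sentinel {nm₀} {u} agr i< = trans (↦-there nm₀ u (<⇒≢ i<)) (agr i<)

  found⇒slot : ∀ {nm₀ u j} → Agree nm₀ → Found cnt nm₀ u j → Slot u j
  found⇒slot {nm₀} {u} {j} agr F = j≤cnt , (λ j< → trans (sym (agr j<)) match) , only
    where
    open Found F renaming (first to earlier)
    only : ∀ {i} → i < cnt → nm i ≡ u → i ≡ j
    only {i} i< eq with <-cmp i j
    ... | tri< i<j _ _ = contradiction (trans (agr i<) eq) (earlier i<j)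
    ... | tri≈ _ i≡j _ = i≡j
    ... | tri> _ _ j<i = distinct-names i< j< (trans eq (sym (trans (sym (agr j<)) match)))
      where j< = <-trans j<i i<

  names≤ : ∀ {nm₀} → Agree nm₀ → ∀ {i} → i < cnt → nm₀ i < n
  names≤ agr i< = subst (_< n) (sym (agr i<)) (names< i<)

  -- The arrays pu and pv hold the slots of the first b pairs from number i₀ on.
  Loaded : ℕ → ℕ → (pu pv : ℕ → ℕ) → Set
  Loaded i₀ b pu pv = ∀ {b′} i → b′ < b → toℕ i ≡ i₀ + b′ →
    Slot (toℕ (first i)) (pu b′) × Slot (toℕ (second i)) (pv b′)

  load-run : ∀ {r0 i₀ u j B r7 rs nm₀ ord₀ fl mk lab pu pv As o} → i₀ + B ≤ k → B ≤ m → Agree nm₀ →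
    Run load (st (r0 ∷ cnt ∷ e ∷ i₀ ∷ u ∷ j ∷ B ∷ r7 ∷ rs) (nm₀ ∷ sl ∷ ord₀ ∷ fl ∷ mk ∷ lab ∷ pu ∷ pv ∷ As) o)
        (2 + B * (12 + 4 * n)) λ s →
      ∃[ u ] ∃[ j ] ∃[ nm₀ ] ∃[ pu ] ∃[ pv ]
        s ≡ st (r0 ∷ cnt ∷ e ∷ i₀ ∷ u ∷ j ∷ B ∷ B ∷ rs) (nm₀ ∷ sl ∷ ord₀ ∷ fl ∷ mk ∷ lab ∷ pu ∷ pv ∷ As) o
        × Agree nm₀ × Loaded i₀ B pu pv
  load-run {r0} {i₀} {u} {j} {B} {r7} {rs} {nm₀} {ord₀} {fl} {mk} {lab} {pu} {pv} {As} {o} iB≤k B≤m agr =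
    run-for Inv B (10 + 4 * n) (λ { (_ , _ , _ , _ , _ , refl , _) → refl , ev-reg (≤-trans B≤m m≤top) }) body
      (u , j , nm₀ , pu , pv , refl , agr , λ _ ())
    where
    Inv : ℕ → AState → Set
    Inv b s = ∃[ u ] ∃[ j ] ∃[ nm₀ ] ∃[ pu ] ∃[ pv ]
        s ≡ st (r0 ∷ cnt ∷ e ∷ i₀ ∷ u ∷ j ∷ B ∷ b ∷ rs) (nm₀ ∷ sl ∷ ord₀ ∷ fl ∷ mk ∷ lab ∷ pu ∷ pv ∷ As) o
        × Agree nm₀ × Loaded i₀ b pu pv
    time : ∀ n → 1 + (3 + 2 * n + (2 + (3 + 2 * n + 1))) ≡ 10 + 4 * n
    time = solve-∀
    body : ∀ {b s} → b < B → Inv b s → Run _ s (10 + 4 * n) (Next 7 Inv b)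
    body {b} b<B (u , j , nm₀ , pu , pv , refl , agr , loaded) =
      run-weaken (≤-reflexive (time n))
      (assign-then (ev-inp (pair-index i toℕ-i) (nth-first i) (vertex≤top (first i)))
      (run-seq (3 + 2 * n) (find-run cnt≤ cnt≤n (vertex≤top (first i)) (names≤ agr)) λ where
      (j₁ , refl , F₁) →
        put-then (ev-reg b≤top) b≤2m (ev-reg (≤-trans (Found.j≤cnt F₁) cnt≤top))
        (assign-then (ev-inp (ev-suc (pair-index i toℕ-i) next≤top) (nth-second i) (vertex≤top (second i)))
        (run-seq (3 + 2 * n) (find-run cnt≤ cnt≤n (vertex≤top (second i)) (names≤ (agree-sentinel agr))) λ where
        (j₂ , refl , F₂) →
          run-put (ev-reg b≤top) b≤2m (ev-reg (≤-trans (Found.j≤cnt F₂) cnt≤top))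
            (refl , _ , _ , _ , pu [ b ↦ j₁ ] , pv [ b ↦ j₂ ] , refl , agree-sentinel (agree-sentinel agr) ,
              loaded′ loaded (found⇒slot (agree-sentinel agr) F₁)
                             (found⇒slot (agree-sentinel (agree-sentinel agr)) F₂))))))
      where
      ib<k : i₀ + b < k
      ib<k = <-≤-trans (+-monoʳ-< i₀ b<B) iB≤k
      i : Fin k
      i = fromℕ< ib<k
      toℕ-i : toℕ i ≡ i₀ + b
      toℕ-i = toℕ-fromℕ< ib<k
      vertex≤top : ∀ (v : Fin n) → toℕ v ≤ top
      vertex≤top v = ≤-trans (<⇒≤ (toℕ<n v)) n≤top
      b≤2m = ≤-trans (<⇒≤ b<B) (≤-trans B≤m (m≤m+n m m))
      b≤top = index≤top b≤2m
      next≤top : suc (3 + (m + m + (toℕ i + toℕ i))) ≤ top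
      next≤top = ≤-trans (≤-reflexive (cong (3 +_) (sym (+-suc (m + m) _))))
        (≤-trans (+-monoʳ-≤ 3 (+-monoʳ-≤ (m + m) (i+i≤k+k i))) input-fits)
      loaded′ : ∀ {pu pv j₁ j₂} → Loaded i₀ b pu pv → Slot (toℕ (first i)) j₁ → Slot (toℕ (second i)) j₂ →
        Loaded i₀ (suc b) (pu [ b ↦ j₁ ]) (pv [ b ↦ j₂ ])
      loaded′ {pu} {pv} {j₁} {j₂} loaded S₁ S₂ {b′} i′ b′< eq with b′ ≟ b
      ... | no b′≢b rewrite ↦-there pu j₁ b′≢b | ↦-there pv j₂ b′≢b = loaded i′ (≤∧≢⇒< (≤-pred b′<) b′≢b) eq
      ... | yes refl rewrite ↦-here pu b j₁ | ↦-here pv b j₂ with toℕ-injective (trans eq (sym toℕ-i))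
      ...   | refl = S₁ , S₂

  clear-run : ∀ {r0 r2 r3 r4 r5 r6 r7 x r9 rs a0 a1 a2 a3 a4 lab As o} →
    Run clear (st (r0 ∷ cnt ∷ r2 ∷ r3 ∷ r4 ∷ r5 ∷ r6 ∷ r7 ∷ x ∷ r9 ∷ rs) (a0 ∷ a1 ∷ a2 ∷ a3 ∷ a4 ∷ lab ∷ As) o)
        (2 + suc cnt * 3) λ s →
      ∃[ lab ] s ≡ st (r0 ∷ cnt ∷ r2 ∷ r3 ∷ r4 ∷ r5 ∷ r6 ∷ r7 ∷ x ∷ suc cnt ∷ rs) (a0 ∷ a1 ∷ a2 ∷ a3 ∷ a4 ∷ lab ∷ As) o
        × (∀ {y} → y < suc cnt → lab y ≡ 0)
  clear-run {r0} {r2} {r3} {r4} {r5} {r6} {r7} {x} {r9} {rs} {a0} {a1} {a2} {a3} {a4} {lab} {As} {o} =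
    run-for Inv (suc cnt) 1 (λ { (_ , refl , _) → refl , ev-suc (ev-reg cnt≤top) cnt<top }) body (lab , refl , λ ())
    where
    Inv : ℕ → AState → Set
    Inv y s = ∃[ lab ] s ≡ st (r0 ∷ cnt ∷ r2 ∷ r3 ∷ r4 ∷ r5 ∷ r6 ∷ r7 ∷ x ∷ y ∷ rs) (a0 ∷ a1 ∷ a2 ∷ a3 ∷ a4 ∷ lab ∷ As) o
        × (∀ {z} → z < y → lab z ≡ 0)
    body : ∀ {y s} → y < suc cnt → Inv y s → Run _ s 1 (Next 9 Inv y)
    body {y} y< (lab , refl , zeros) =
      run-put (ev-reg (≤-trans (≤-pred y<) cnt≤top)) (≤-trans (≤-pred y<) cnt≤) (ev-lit z≤n)
        (refl , _ , refl , λ {z} z< → case z ≟ y of λ where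
          (yes refl) → ↦-here lab z 0
          (no z≢y) → trans (↦-there lab 0 z≢y) (zeros (≤∧≢⇒< (≤-pred z<) z≢y)))

  module Source {x : ℕ} (x<cnt : x < cnt) (s : Fin n) (x-is-s : nm x ≡ toℕ s) where
    open Ordered P all x<cnt s x-is-s public

    -- Labels are slots on walks.
    label≤ : ∀ {i L y} → i ≤ e → Labelled i L → y ≤ cnt → L y ≤ cnt
    label≤ {i} {L} {y} i≤e Λ y≤ = go (L y) refl
      where
      go : ∀ v → L y ≡ v → v ≤ cnt
      go zero    eq = z≤n
      go (suc d) eq = on⇒< i≤e w (Labelled.passes Λ w eq)
        where w = Labelled.reached Λ y≤ λ q → 0≢1+n (trans (sym q) eq)

    spread-run : ∀ {r0 r3 r4 r5 r6 r7 r9 r10 r11 r12 r13 a0 a3 a4 lab As o} → Labelled 0 lab →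
      Run spread (st (r0 ∷ cnt ∷ e ∷ r3 ∷ r4 ∷ r5 ∷ r6 ∷ r7 ∷ x ∷ r9 ∷ r10 ∷ r11 ∷ r12 ∷ r13 ∷ [])
                     (a0 ∷ sl ∷ ord ∷ a3 ∷ a4 ∷ lab ∷ As) o) (2 + e * 11) λ s →
        ∃[ r9 ] ∃[ r10 ] ∃[ r11 ] ∃[ r12 ] ∃[ r13 ] ∃[ lab ]
          s ≡ st (r0 ∷ cnt ∷ e ∷ r3 ∷ r4 ∷ r5 ∷ r6 ∷ r7 ∷ x ∷ r9 ∷ r10 ∷ r11 ∷ r12 ∷ r13 ∷ [])
                 (a0 ∷ sl ∷ ord ∷ a3 ∷ a4 ∷ lab ∷ As) o
          × Labelled e lab
    spread-run {r0} {r3} {r4} {r5} {r6} {r7} {r9} {r10} {r11} {r12} {r13} {a0} {a3} {a4} {lab} {As} {o} Λ₀ =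
      run-map (λ p → _ , p)
        (run-for Inv e 9 (λ { (_ , _ , _ , _ , _ , refl , _) → refl , ev-reg (≤-trans e≤m m≤top) }) body
          (r10 , r11 , r12 , r13 , lab , refl , Λ₀))
      where
      Inv : ℕ → AState → Set
      Inv i s = ∃[ r10 ] ∃[ r11 ] ∃[ r12 ] ∃[ r13 ] ∃[ lab ]
          s ≡ st (r0 ∷ cnt ∷ e ∷ r3 ∷ r4 ∷ r5 ∷ r6 ∷ r7 ∷ x ∷ i ∷ r10 ∷ r11 ∷ r12 ∷ r13 ∷ [])
                 (a0 ∷ sl ∷ ord ∷ a3 ∷ a4 ∷ lab ∷ As) o
          × Labelled i lab
      body : ∀ {i s} → i < e → Inv i s → Run _ s 9 (Next 9 Inv i)
      body {i} i<e (_ , _ , _ , _ , lab , refl , Λ) =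
        assign-then (ev-cell (ev-reg (≤-trans (<⇒≤ i<e) e≤top)) (≤-trans (<⇒≤ i<e) (≤-trans e≤m (m≤m+n m m)))
                             refl (≤-trans (<⇒≤ a<m) m≤top))
        (assign-then (ev-tail refl a<m)
        (assign-then (ev-cell (ev-reg a≤top) a≤2m refl (lab≤top a≤))
        (run-if (ev-reg (lab≤top a≤))
          (λ live → assign-then (ev-head refl a<m)
            (run-if (ev-≠ (ev-reg a≤top) (ev-reg x≤top))
              (λ a≢x → run-if ev-labH
                (λ b-live → run-if (ev-≠ ev-labH (ev-reg (lab≤top a≤)))
                  (λ differ → run-put (ev-reg b≤top) b≤2m ev-b+1
                    (refl , _ , _ , _ , _ , _ , refl ,
                      fork live b-live λ eq → differ (≡⇒distance≡0 eq)))
                  (λ same → run-skip (refl , _ , _ , _ , _ , _ , refl ,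
                      agree live (a≢x ∘ ≡⇒distance≡0) (distance≡0⇒≡ same))))
                (λ b-new → run-put (ev-reg b≤top) b≤2m (ev-reg (lab≤top a≤))
                  (refl , _ , _ , _ , _ , _ , refl ,
                    inherit live (a≢x ∘ ≡⇒distance≡0) b-new)))
              (λ a≡x → run-put (ev-reg b≤top) b≤2m ev-b+1
                (refl , _ , _ , _ , _ , _ , refl , direct live (distance≡0⇒≡ a≡x)))))
          (λ dead → run-skip (refl , _ , _ , _ , _ , _ , refl , unreached dead)))))
        where
        a<m = valid i<e
        a b : ℕ
        a = tl (ord i)
        b = hd (ord i)
        a≤ : a ≤ cnt
        a≤ = <⇒≤ (tl< a<m)
        b≤ : b ≤ cnt
        b≤ = <⇒≤ (hd< a<m)
        open Scan i<e Λ a≤ b≤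
        e≤top = ≤-trans e≤m m≤top
        a≤2m = ≤-trans a≤ cnt≤
        b≤2m = ≤-trans b≤ cnt≤
        a≤top = index≤top a≤2m
        b≤top = index≤top b≤2m
        x≤top = ≤-trans (<⇒≤ x<cnt) cnt≤top
        lab≤top : ∀ {y} → y ≤ cnt → lab y ≤ top
        lab≤top y≤ = ≤-trans (label≤ (<⇒≤ i<e) Λ y≤) cnt≤top
        state : AState
        state = st (r0 ∷ cnt ∷ e ∷ r3 ∷ r4 ∷ r5 ∷ r6 ∷ r7 ∷ x ∷ i ∷ ord i ∷ a ∷ b ∷ lab a ∷ [])
                   (a0 ∷ sl ∷ ord ∷ a3 ∷ a4 ∷ lab ∷ As) o
        ev-labH : Ev (cell 5 (reg 12)) state (lab b)
        ev-labH = ev-cell (ev-reg b≤top) b≤2m refl (lab≤top b≤)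
        ev-b+1 : Ev (reg 12 ⊕ lit 1) state (suc b)
        ev-b+1 = ev-suc (ev-reg b≤top) (≤-trans (hd< a<m) cnt≤top)

  -- When source x is being tried, it has been tried for the pairs
  -- i₀, …, i₀ + b ∸ 1 of the current batch.
  record Progress (i₀ B b x : ℕ) (c : ℕ → ℕ) : Set where
    field
      earlier : ∀ {i} → i < i₀ → c i ≡ cnt
      tried   : ∀ {i} → i₀ ≤ i → i < i₀ + b → c i ≡ suc x
      untried : ∀ {i} → i₀ + b ≤ i → i < i₀ + B → c i ≡ x
      later   : ∀ {i} → i₀ + B ≤ i → c i ≡ 0

  progress-step : ∀ {i₀ B b x c} → b < B → Progress i₀ B b x c → Progress i₀ B (suc b) x (c [ i₀ + b ↦ suc x ])
  progress-step {i₀} {B} {b} {x} {c} b<B Π = record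
    { earlier = λ i< → trans (↦-there c (suc x) (<⇒≢ (<-≤-trans i< (m≤m+n i₀ b)))) (earlier i<)
    ; tried   = tried′
    ; untried = λ {i} ≤i i< → trans (↦-there c (suc x) (<⇒≢ (subst (_≤ i) (+-suc i₀ b) ≤i) ∘ sym))
                                    (untried (≤-trans (+-monoʳ-≤ i₀ (n≤1+n b)) ≤i) i<)
    ; later   = λ {i} ≤i → trans (↦-there c (suc x) (<⇒≢ (<-≤-trans (+-monoʳ-< i₀ b<B) ≤i) ∘ sym)) (later ≤i)
    }
    where
    open Progress Π
    tried′ : ∀ {i} → i₀ ≤ i → i < i₀ + suc b → (c [ i₀ + b ↦ suc x ]) i ≡ suc x
    tried′ {i} i₀≤ i< with i ≟ i₀ + b
    ... | yes refl = ↦-here c (i₀ + b) (suc x)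
    ... | no i≢ = trans (↦-there c (suc x) i≢) (tried i₀≤ (≤∧≢⇒< (≤-pred (subst (i <_) (+-suc i₀ b) i<)) i≢))

  progress-next : ∀ {i₀ B x c} → Progress i₀ B B x c → Progress i₀ B 0 (suc x) c
  progress-next {i₀} Π = record
    { earlier = earlier
    ; tried   = λ {i} i₀≤ i< → contradiction (subst (i <_) (+-identityʳ i₀) i<) (≤⇒≯ i₀≤)
    ; untried = λ {i} ≤i i< → tried (subst (_≤ i) (+-identityʳ i₀) ≤i) i<
    ; later   = later
    }
    where open Progress Π

  module Emitting {emit : Cmd} {Goal : (ℕ → ℕ) → List (ℕ × ℕ) → Set} (E : Emitter emit Goal) where
    open Emitter E

    report-run : ∀ {x i₀ B r4 r5 r7 rs nm₀ a1 a2 a3 a4 L pu pv c out o}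
      (x<cnt : x < cnt) (s : Fin n) (x-is-s : nm x ≡ toℕ s) →
      i₀ + B ≤ k → B ≤ m → Agree nm₀ → Source.Labelled x<cnt s x-is-s e L → Loaded i₀ B pu pv →
      Progress i₀ B 0 x c → Emits c out o →
      Run (report emit) (st (base ∷ cnt ∷ e ∷ i₀ ∷ r4 ∷ r5 ∷ B ∷ r7 ∷ x ∷ rs)
                            (nm₀ ∷ a1 ∷ a2 ∷ a3 ∷ a4 ∷ L ∷ pu ∷ pv ∷ out ∷ []) o) (2 + B * 7) λ s →
        ∃[ c ] ∃[ out ] ∃[ o ]
          s ≡ st (base ∷ cnt ∷ e ∷ i₀ ∷ r4 ∷ r5 ∷ B ∷ B ∷ x ∷ rs)
                 (nm₀ ∷ a1 ∷ a2 ∷ a3 ∷ a4 ∷ L ∷ pu ∷ pv ∷ out ∷ []) o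
          × Progress i₀ B B x c × Emits c out o
    report-run {x} {i₀} {B} {r4} {r5} {r7} {rs} {nm₀} {a1} {a2} {a3} {a4} {L} {pu} {pv} {c} {out} {o}
      x<cnt s x-is-s iB≤k B≤m agr Λ loaded Π₀ E₀ =
      run-for Inv B 5 (λ { (_ , _ , _ , refl , _) → refl , ev-reg (≤-trans B≤m m≤top) }) body
        (c , out , o , refl , Π₀ , E₀)
      where
      open Source x<cnt s x-is-s
      Inv : ℕ → AState → Set
      Inv b s = ∃[ c ] ∃[ out ] ∃[ o ]
          s ≡ st (base ∷ cnt ∷ e ∷ i₀ ∷ r4 ∷ r5 ∷ B ∷ b ∷ x ∷ rs)
                 (nm₀ ∷ a1 ∷ a2 ∷ a3 ∷ a4 ∷ L ∷ pu ∷ pv ∷ out ∷ []) o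
          × Progress i₀ B b x c × Emits c out o
      body : ∀ {b s} → b < B → Inv b s → Run _ s 5 (Next 7 Inv b)
      body {b} b<B (c , out , o , refl , Π , Em) =
        run-if ev-Lu
          (λ u-live → run-if ev-Lv
            (λ v-live → run-if (ev-≠ ev-Lu ev-Lv)
              (λ differ → run-map
                (λ { (out , o , refl , Em) → refl , _ , out , o , refl ,
                      progress-step b<B Π , subst (λ j → Emits (c [ j ↦ suc x ]) out o) toℕ-i Em })
                (emit-run i s toℕ-i c-i x<cnt x-is-s (agr x<cnt)
                  (labels⇒junction Λ Su Sv u-live v-live λ eq →
                    differ (≡⇒distance≡0 eq)) Em))
              (λ same → skipped λ J → proj₂ (proj₂ (junction⇒labels Λ Su Sv J)) (distance≡0⇒≡ same)))
            (λ v-dead → skipped λ J → proj₁ (proj₂ (junction⇒labels Λ Su Sv J)) v-dead))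
          (λ u-dead → skipped λ J → proj₁ (junction⇒labels Λ Su Sv J) u-dead)
        where
        ib<k : i₀ + b < k
        ib<k = <-≤-trans (+-monoʳ-< i₀ b<B) iB≤k
        i : Fin k
        i = fromℕ< ib<k
        toℕ-i : toℕ i ≡ i₀ + b
        toℕ-i = toℕ-fromℕ< ib<k
        Su : Slot (toℕ (first i)) (pu b)
        Su = proj₁ (loaded i b<B toℕ-i)
        Sv : Slot (toℕ (second i)) (pv b)
        Sv = proj₂ (loaded i b<B toℕ-i)
        c-i : c (toℕ i) ≡ x
        c-i = Progress.untried Π (≤-reflexive (sym toℕ-i)) (subst (_< i₀ + B) (sym toℕ-i) (+-monoʳ-< i₀ b<B))
        state : AState
        state = st (base ∷ cnt ∷ e ∷ i₀ ∷ r4 ∷ r5 ∷ B ∷ b ∷ x ∷ rs) (nm₀ ∷ a1 ∷ a2 ∷ a3 ∷ a4 ∷ L ∷ pu ∷ pv ∷ out ∷ []) o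
        b≤2m = ≤-trans (<⇒≤ b<B) (≤-trans B≤m (m≤m+n m m))
        ev-b : Ev (reg 7) state b
        ev-b = ev-reg (index≤top b≤2m)
        ev-Lu : Ev (cell 5 (cell 6 (reg 7))) state (L (pu b))
        ev-Lu = ev-cell (ev-cell ev-b b≤2m refl (≤-trans (proj₁ Su) cnt≤top)) (≤-trans (proj₁ Su) cnt≤) refl
                  (≤-trans (label≤ ≤-refl Λ (proj₁ Su)) cnt≤top)
        ev-Lv : Ev (cell 5 (cell 7 (reg 7))) state (L (pv b))
        ev-Lv = ev-cell (ev-cell ev-b b≤2m refl (≤-trans (proj₁ Sv) cnt≤top)) (≤-trans (proj₁ Sv) cnt≤) refl
                  (≤-trans (label≤ ≤-refl Λ (proj₁ Sv)) cnt≤top)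
        skipped : ∀ {t} → ¬ JunctionOfPair G ps i s →
          Run skip state (suc t) (Next 7 Inv b)
        skipped ¬J = run-skip (refl , _ , out , o , refl , progress-step b<B Π ,
          subst (λ j → Emits (c [ j ↦ suc x ]) out o) toℕ-i (emit-skip i s c-i x<cnt x-is-s ¬J Em))

    sources-run : ∀ {i₀ B r4 r5 r7 r8 r9 r10 r11 r12 r13 nm₀ a3 a4 lab pu pv c out o} →
      i₀ + B ≤ k → B ≤ m → Agree nm₀ → Loaded i₀ B pu pv → Progress i₀ B 0 0 c → Emits c out o →
      Run (sources emit) (st (base ∷ cnt ∷ e ∷ i₀ ∷ r4 ∷ r5 ∷ B ∷ r7 ∷ r8 ∷ r9 ∷ r10 ∷ r11 ∷ r12 ∷ r13 ∷ [])
                             (nm₀ ∷ sl ∷ ord ∷ a3 ∷ a4 ∷ lab ∷ pu ∷ pv ∷ out ∷ []) o) (2 + n * (12 + m * 24)) λ s →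
        ∃[ r7 ] ∃[ r8 ] ∃[ r9 ] ∃[ r10 ] ∃[ r11 ] ∃[ r12 ] ∃[ r13 ] ∃[ lab ] ∃[ c ] ∃[ out ] ∃[ o ]
          s ≡ st (base ∷ cnt ∷ e ∷ i₀ ∷ r4 ∷ r5 ∷ B ∷ r7 ∷ r8 ∷ r9 ∷ r10 ∷ r11 ∷ r12 ∷ r13 ∷ [])
                 (nm₀ ∷ sl ∷ ord ∷ a3 ∷ a4 ∷ lab ∷ pu ∷ pv ∷ out ∷ []) o
          × Progress i₀ B 0 cnt c × Emits c out o
    sources-run {i₀} {B} {r4} {r5} {r7} {r8} {r9} {r10} {r11} {r12} {r13} {nm₀} {a3} {a4} {lab} {pu} {pv} {c} {out} {o}
      iB≤k B≤m agr loaded Π₀ E₀ =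
      run-weaken (+-monoʳ-≤ 2 (*-monoˡ-≤ (12 + m * 24) cnt≤n))
      (run-map (λ (r7 , p) → r7 , cnt , p)
        (run-for Inv cnt (10 + m * 24)
          (λ { (_ , _ , _ , _ , _ , _ , _ , _ , _ , _ , refl , _) → refl , ev-reg cnt≤top }) body
          (r7 , r9 , r10 , r11 , r12 , r13 , lab , c , out , o , refl , Π₀ , E₀)))
      where
      Inv : ℕ → AState → Set
      Inv x s = ∃[ r7 ] ∃[ r9 ] ∃[ r10 ] ∃[ r11 ] ∃[ r12 ] ∃[ r13 ] ∃[ lab ] ∃[ c ] ∃[ out ] ∃[ o ]
          s ≡ st (base ∷ cnt ∷ e ∷ i₀ ∷ r4 ∷ r5 ∷ B ∷ r7 ∷ x ∷ r9 ∷ r10 ∷ r11 ∷ r12 ∷ r13 ∷ [])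
                 (nm₀ ∷ sl ∷ ord ∷ a3 ∷ a4 ∷ lab ∷ pu ∷ pv ∷ out ∷ []) o
          × Progress i₀ B 0 x c × Emits c out o
      time : 2 + suc cnt * 3 + (1 + (2 + e * 11 + (2 + B * 7))) ≤ 10 + m * 24
      time = begin
        2 + suc cnt * 3 + (1 + (2 + e * 11 + (2 + B * 7)))
          ≤⟨ +-mono-≤ (+-monoʳ-≤ 2 (*-monoˡ-≤ 3 (s≤s cnt≤)))
               (+-monoʳ-≤ 1 (+-mono-≤ (+-monoʳ-≤ 2 (*-monoˡ-≤ 11 e≤m)) (+-monoʳ-≤ 2 (*-monoˡ-≤ 7 B≤m)))) ⟩
        2 + suc (m + m) * 3 + (1 + (2 + m * 11 + (2 + m * 7)))
          ≡⟨ eq m ⟩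
        10 + m * 24 ∎
        where
        open ≤-Reasoning
        eq : ∀ m → 2 + suc (m + m) * 3 + (1 + (2 + m * 11 + (2 + m * 7))) ≡ 10 + m * 24
        eq = solve-∀
      body : ∀ {x s} → x < cnt → Inv x s → Run _ s (10 + m * 24) (Next 8 Inv x)
      body {x} x<cnt (_ , _ , _ , _ , _ , _ , _ , c , out , o , refl , Π , Em) =
        run-weaken time
        (run-seq (2 + suc cnt * 3) clear-run λ { (lab₀ , refl , zeros) →
          put-then (ev-reg x≤top) (≤-trans (<⇒≤ x<cnt) cnt≤) (ev-suc (ev-reg x≤top) (≤-trans x<cnt cnt≤top))
          (run-seq (2 + e * 11) (spread-run {lab = lab₀ [ x ↦ suc x ]} (labelled-start (<⇒≤ x<cnt)
              (λ y≤ y≢x → trans (↦-there lab₀ (suc x) y≢x) (zeros (s≤s y≤))) (↦-here lab₀ x (suc x))))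
          λ { (_ , _ , _ , _ , _ , L , refl , Λ) →
            run-map (λ { (c , out , o , refl , Π , Em) →
                refl , _ , _ , _ , _ , _ , _ , _ , c , out , o , refl , progress-next Π , Em })
              (report-run x<cnt s x-is-s iB≤k B≤m agr Λ loaded Π Em) }) })
        where
        s : Fin n
        s = fromℕ< (names< x<cnt)
        x-is-s : nm x ≡ toℕ s
        x-is-s = sym (toℕ-fromℕ< (names< x<cnt))
        open Source x<cnt s x-is-s using (spread-run; labelled-start)
        x≤top = ≤-trans (<⇒≤ x<cnt) cnt≤top

    -- All sources have been tried for the pairs below i₀, and none for others.
    Covered : ℕ → (ℕ → ℕ) → Set
    Covered i₀ c = (∀ {i} → i < k → i < i₀ → c i ≡ cnt) × (∀ {i} → i₀ ≤ i → c i ≡ 0)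

    batch-size : ℕ → ℕ
    batch-size i₀ = m ∸ (m ∸ (k ∸ i₀))

    batch-bound : ∀ {i₀} → i₀ ≤ k → i₀ + batch-size i₀ ≤ k
    batch-bound {i₀} i₀≤k = begin
      i₀ + batch-size i₀  ≤⟨ +-monoʳ-≤ i₀ (m∸[m∸n]≤n m (k ∸ i₀)) ⟩
      i₀ + (k ∸ i₀)       ≡⟨ m+[n∸m]≡n i₀≤k ⟩
      k                   ∎
      where
      open ≤-Reasoning
      m∸[m∸n]≤n : ∀ m n → m ∸ (m ∸ n) ≤ n
      m∸[m∸n]≤n m n with ≤-total n m
      ... | inj₁ n≤m = ≤-reflexive (m∸[m∸n]≡n n≤m)
      ... | inj₂ m≤n = ≤-trans (m∸n≤m m (m ∸ n)) m≤n

    -- A batch is either of full size or reaches the last pair.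
    batch-full : ∀ {i₀ i} → i < k → i < i₀ + m → i < i₀ + batch-size i₀
    batch-full {i₀} {i} i<k i< with ≤-total (k ∸ i₀) m
    ... | inj₁ ≤m rewrite m∸[m∸n]≡n ≤m = <-≤-trans i<k (m≤n+m∸n k i₀)
    ... | inj₂ m≤ rewrite m≤n⇒m∸n≡0 m≤ = i<

    batch-time : ℕ
    batch-time = 6 + m * (12 + 4 * n) + n * (12 + m * 24)

    batches-run : ∀ {r3 r4 r5 r6 r7 r8 r9 r10 r11 r12 r13 a3 a4 lab pu pv} q → k ≤ q * m →
      Run (batches emit) (st (base ∷ cnt ∷ e ∷ r3 ∷ r4 ∷ r5 ∷ r6 ∷ r7 ∷ r8 ∷ r9 ∷ r10 ∷ r11 ∷ r12 ∷ r13 ∷ [])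
                             (nm ∷ sl ∷ ord ∷ a3 ∷ a4 ∷ lab ∷ pu ∷ pv ∷ none ∷ []) []) (2 + q * suc batch-time) λ s →
        at 0 (regs s) 0 ≡ base × Goal (at none (arrays s) 8) (events s)
    batches-run {a3 = a3} {a4} q k≤qm =
      assign-then (ev-lit z≤n) (loop q 0 z≤n k≤qm (λ _ → refl) ((λ _ ()) , λ _ → refl) emit-start)
      where
      Post : AState → Set
      Post s = at 0 (regs s) 0 ≡ base × Goal (at none (arrays s) 8) (events s)
      time : ∀ a b t → suc (1 + (2 + a + (2 + b + 1)) + (1 + t)) ≡ 1 + (suc (6 + a + b) + t)
      time = solve-∀
      loop : ∀ {r4 r5 r6 r7 r8 r9 r10 r11 r12 r13 nm₀ lab pu pv out o c} q i₀ →
        i₀ ≤ k + m → k ∸ i₀ ≤ q * m → Agree nm₀ → Covered i₀ c → Emits c out o →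
        Run (whileNonzero (#pairs ⊖ reg 3) (batch emit))
            (st (base ∷ cnt ∷ e ∷ i₀ ∷ r4 ∷ r5 ∷ r6 ∷ r7 ∷ r8 ∷ r9 ∷ r10 ∷ r11 ∷ r12 ∷ r13 ∷ [])
                (nm₀ ∷ sl ∷ ord ∷ a3 ∷ a4 ∷ lab ∷ pu ∷ pv ∷ out ∷ []) o) (1 + q * suc batch-time) Post
      loop q i₀ i₀≤ rest agr cov Em with k ∸ i₀ ≟ 0
      ... | yes done = while-done (ev-⊖ ev-#pairs (ev-reg (≤-trans i₀≤ k+m≤top))) done
            (refl , emit-end (λ i<k → proj₁ cov i<k (<-≤-trans i<k (m∸n≡0⇒m≤n done))) Em)
      loop zero i₀ i₀≤ rest agr cov Em | no more = contradiction (n≤0⇒n≡0 rest) more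
      loop {c = c} (suc q) i₀ i₀≤ rest agr cov Em | no more =
        run-weaken (≤-reflexive (time (m * (12 + 4 * n)) (n * (12 + m * 24)) (q * suc batch-time)))
        (while-step (1 + (2 + m * (12 + 4 * n) + (2 + n * (12 + m * 24) + 1))) (ev-⊖ ev-#pairs ev-i₀) more
          (assign-then (ev-⊖ ev-#arcs (ev-⊖ ev-#arcs (ev-⊖ ev-#pairs ev-i₀)))
          (run-seq (2 + m * (12 + 4 * n))
            (run-weaken (+-monoʳ-≤ 2 (*-monoˡ-≤ (12 + 4 * n) B≤m)) (load-run (batch-bound i₀≤k) B≤m agr)) λ {
          (_ , _ , nm₀ , pu , pv , refl , agr , loaded) →
          run-seq (2 + n * (12 + m * 24)) (sources-run (batch-bound i₀≤k) B≤m agr loaded start Em) λ {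
          (_ , _ , _ , _ , _ , _ , _ , lab , c , out , o , refl , Π , Em) →
          run-assign {Q = After} (ev-⊕ ev-i₀ ev-#arcs i₀+m≤top)
            (_ , _ , _ , _ , _ , _ , _ , _ , _ , _ , nm₀ , lab , pu , pv , out , o , c ,
              refl , agr , covered Π , Em) } }))
          λ { (_ , _ , _ , _ , _ , _ , _ , _ , _ , _ , _ , _ , _ , _ , _ , _ , _ , refl , agr , cov , Em) →
              loop q (i₀ + m) (+-monoˡ-≤ m i₀≤k) rest′ agr cov Em })
        where
        i₀<k : i₀ < k
        i₀<k = m∸n≢0⇒n<m more
        i₀≤k = <⇒≤ i₀<k
        B = batch-size i₀
        B≤m : B ≤ m
        B≤m = m∸n≤m m (m ∸ (k ∸ i₀))
        i₀+m≤top = ≤-trans (+-monoˡ-≤ m i₀≤k) k+m≤top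
        ev-i₀ : ∀ {r0 r1 r2 rs As o} → Ev (reg 3) (st (r0 ∷ r1 ∷ r2 ∷ i₀ ∷ rs) As o) i₀
        ev-i₀ = ev-reg (≤-trans (m≤m+n i₀ m) i₀+m≤top)
        rest′ : k ∸ (i₀ + m) ≤ q * m
        rest′ = begin
          k ∸ (i₀ + m)   ≡⟨ ∸-+-assoc k i₀ m ⟨
          k ∸ i₀ ∸ m     ≤⟨ ∸-monoˡ-≤ m rest ⟩
          m + q * m ∸ m  ≡⟨ m+n∸m≡n m (q * m) ⟩
          q * m          ∎
          where open ≤-Reasoning
        start : Progress i₀ B 0 0 c
        start = record
          { earlier = λ i< → proj₁ cov (<-trans i< i₀<k) i<
          ; tried   = λ {i} ≤i i< → contradiction (subst (i <_) (+-identityʳ i₀) i<) (≤⇒≯ ≤i)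
          ; untried = λ {i} ≤i _ → proj₂ cov (subst (_≤ i) (+-identityʳ i₀) ≤i)
          ; later   = λ {i} ≤i → proj₂ cov (≤-trans (m≤m+n i₀ B) ≤i)
          }
        covered : ∀ {c} → Progress i₀ B 0 cnt c → Covered (i₀ + m) c
        covered {c} Π = tried-all , λ ≤i → Progress.later Π (≤-trans (+-monoʳ-≤ i₀ B≤m) ≤i)
          where
          tried-all : ∀ {i} → i < k → i < i₀ + m → c i ≡ cnt
          tried-all {i} i<k i< with i <? i₀
          ... | yes i<i₀ = Progress.earlier Π i<i₀
          ... | no i≮i₀ = Progress.untried Π (subst (_≤ i) (sym (+-identityʳ i₀)) (≮⇒≥ i≮i₀)) (batch-full i<k i<)
        After : AState → Set
        After s = ∃[ r4 ] ∃[ r5 ] ∃[ r6 ] ∃[ r7 ] ∃[ r8 ] ∃[ r9 ] ∃[ r10 ] ∃[ r11 ] ∃[ r12 ] ∃[ r13 ]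
          ∃[ nm₀ ] ∃[ lab ] ∃[ pu ] ∃[ pv ] ∃[ out ] ∃[ o ] ∃[ c ]
          s ≡ st (base ∷ cnt ∷ e ∷ i₀ + m ∷ r4 ∷ r5 ∷ r6 ∷ r7 ∷ r8 ∷ r9 ∷ r10 ∷ r11 ∷ r12 ∷ r13 ∷ [])
                 (nm₀ ∷ sl ∷ ord ∷ a3 ∷ a4 ∷ lab ∷ pu ∷ pv ∷ out ∷ []) o
          × Agree nm₀ × Covered (i₀ + m) c × Emits c out o

------------------------------------------------------------------------
-- Printing and storing the junctions

nth-++ˡ : ∀ xs ys {j} → j < length xs → nth (xs ++ ys) j ≡ nth xs j
nth-++ˡ (x ∷ xs) ys {zero}  j< = refl
nth-++ˡ (x ∷ xs) ys {suc j} j< = nth-++ˡ xs ys (≤-pred j<)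

nth-∷ʳ-length : ∀ xs y → nth (xs ++ y ∷ []) (length xs) ≡ y
nth-∷ʳ-length []       y = refl
nth-∷ʳ-length (_ ∷ xs) y = nth-∷ʳ-length xs y

nth-map-toℕ : ∀ {n} (xs : List (Fin n)) j → nth (List.map toℕ xs) (toℕ j) ≡ toℕ (List.lookup xs j)
nth-map-toℕ (x ∷ xs) zero    = refl
nth-map-toℕ (x ∷ xs) (suc j) = nth-map-toℕ xs j

module Emitters {n m k : ℕ} (G : DAG n m) (ps : Pairs n k) {cells W top : ℕ}
  (sizes : Fits n m k cells W top)
  {cnt : ℕ} {nm sl : ℕ → ℕ} (cnt≤ : cnt ≤ m + m) (ν : Numbering G cnt nm sl)
  {e : ℕ} {ord flag : ℕ → ℕ} (P : Sorting.Prefix (Slots.tl G ν) (Slots.hd G ν) m e ord flag)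
  (all : ∀ {a} → a < m → flag a ≢ 0) where

  open BatchRun G ps sizes cnt≤ ν P all
  open Numbering ν

  -- The vertex s has been tried as a source for pair i, where c is as in Emitter.
  Tried : (ℕ → ℕ) → Fin k → Fin n → Set
  Tried c i s = ∃[ x ] x < c (toℕ i) × nm x ≡ toℕ s

  -- The source s with slot x is tried for pair i.
  module Try (c : ℕ → ℕ) {x} (i : Fin k) (s : Fin n)
    (c-i : c (toℕ i) ≡ x) (x<cnt : x < cnt) (x-is-s : nm x ≡ toℕ s) where

    c′ : ℕ → ℕ
    c′ = c [ toℕ i ↦ suc x ]

    old⇒tried : ∀ {i′ s′} → Tried c i′ s′ → Tried c′ i′ s′
    old⇒tried {i′} (y , y< , eq) with toℕ i′ ≟ toℕ i
    ... | yes p = y , subst (y <_) (sym (trans (cong c′ p) (↦-here c (toℕ i) (suc x))))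
                        (m<n⇒m<1+n (subst (y <_) (trans (cong c p) c-i) y<)) , eq
    ... | no p = y , subst (y <_) (sym (↦-there c (suc x) p)) y< , eq

    new-tried : Tried c′ i s
    new-tried = x , subst (x <_) (sym (↦-here c (toℕ i) (suc x))) ≤-refl , x-is-s

    tried⇒ : ∀ {i′ s′} → Tried c′ i′ s′ → Tried c i′ s′ ⊎ (i′ ≡ i × s′ ≡ s)
    tried⇒ {i′} (y , y< , eq) with toℕ i′ ≟ toℕ i
    ... | no p = inj₁ (y , subst (y <_) (↦-there c (suc x) p) y< , eq)
    ... | yes p with toℕ-injective p
    ...   | refl with m<1+n⇒m<n∨m≡n (subst (y <_) (↦-here c (toℕ i) (suc x)) y<)
    ...     | inj₁ y<x = inj₁ (y , subst (y <_) (sym c-i) y<x , eq)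
    ...     | inj₂ refl = inj₂ (refl , toℕ-injective (trans (sym eq) x-is-s))

    untried : ¬ Tried c i s
    untried (y , y< , eq) = <⇒≢ y<x (distinct-names (<-trans y<x x<cnt) x<cnt (trans eq (sym x-is-s)))
      where y<x = subst (y <_) c-i y<

  all-tried : ∀ c {i s} → (∀ {i} → i < k → c i ≡ cnt) → JunctionOfPair G ps i s → Tried c i s
  all-tried c {i} done J with junction-named J
  ... | x , x<cnt , eq = x , subst (x <_) (sym (done (toℕ<n i))) x<cnt , eq

  printer : Emitter printing λ _ o →
    ∃[ xs ] Unique xs × (∀ i s → (i , s) ∈ xs ⇔ JunctionOfPair G ps i s)
      × o ≡ List.map (λ (i , s) → toℕ i , toℕ s) xs
  printer = record
    { Emits = λ c _ o → Printed c o
    ; emit-run = λ { {c} {out} {o} {x = x} i s toℕ-i c-i x<cnt x-is-s nm₀x J (xs , xs! , spec , refl) →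
        run-print
          (ev-⊕ (ev-reg (≤-trans (m≤m+n _ _) (pair≤top i toℕ-i)))
            (ev-reg (≤-trans (m≤n+m _ _) (pair≤top i toℕ-i))) (pair≤top i toℕ-i))
          (ev-cell (ev-reg (≤-trans (<⇒≤ x<cnt) cnt≤top)) (≤-trans (<⇒≤ x<cnt) cnt≤) (trans nm₀x x-is-s)
            (≤-trans (<⇒≤ (toℕ<n s)) n≤top))
          (out , _ , refl , printed {c} i s toℕ-i c-i x<cnt x-is-s J xs! spec) }
    ; emit-skip = λ { {c} i s c-i x<cnt x-is-s ¬J (xs , xs! , spec , eq) → xs , xs! ,
        (λ i′ s′ → let open Try c i s c-i x<cnt x-is-s in mk⇔
          (λ p → let t , J = Equivalence.to (spec i′ s′) p in old⇒tried {i′} t , J)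
          (λ (t , J) → case tried⇒ {i′} t of λ where
            (inj₁ t) → Equivalence.from (spec i′ s′) (t , J)
            (inj₂ (refl , refl)) → contradiction J ¬J)) , eq }
    ; emit-start = [] , [] , (λ i s → mk⇔ (λ ()) λ { ((_ , () , _) , _) }) , refl
    ; emit-end = λ { {c} done (xs , xs! , spec , eq) → xs , xs! ,
        (λ i s → mk⇔ (λ p → proj₂ (Equivalence.to (spec i s) p))
                     (λ J → Equivalence.from (spec i s) (all-tried c {i} done J , J))) , eq }
    }
    where
    Printed : (ℕ → ℕ) → List (ℕ × ℕ) → Set
    Printed c o = ∃[ xs ] Unique xs
      × (∀ i s → (i , s) ∈ xs ⇔ (Tried c i s × JunctionOfPair G ps i s))
      × o ≡ List.map (λ (i , s) → toℕ i , toℕ s) xs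
    pair≤top : ∀ {j} (i : Fin k) → toℕ i ≡ j → j ≤ top
    pair≤top i refl = ≤-trans (<⇒≤ (toℕ<n i)) (≤-trans (m≤m+n k m) k+m≤top)
    printed : ∀ {c x j xs} i s → toℕ i ≡ j → c (toℕ i) ≡ x → x < cnt → nm x ≡ toℕ s → JunctionOfPair G ps i s →
      Unique xs → (∀ i s → (i , s) ∈ xs ⇔ (Tried c i s × JunctionOfPair G ps i s)) →
      Printed (c [ toℕ i ↦ suc x ]) ((j , toℕ s) ∷ List.map (λ (i , s) → toℕ i , toℕ s) xs)
    printed {c} {x} {xs = xs} i s refl c-i x<cnt x-is-s J xs! spec =
      (i , s) ∷ xs , ¬Any⇒All¬ _ (λ p → untried (proj₁ (Equivalence.to (spec i s) p))) ∷ xs! , spec′ , refl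
      where
      open Try c i s c-i x<cnt x-is-s
      spec′ : ∀ i′ s′ → (i′ , s′) ∈ ((i , s) ∷ xs) ⇔ (Tried c′ i′ s′ × JunctionOfPair G ps i′ s′)
      spec′ i′ s′ = mk⇔
        (λ { (here refl) → new-tried , J
           ; (there p) → let t , J = Equivalence.to (spec i′ s′) p in old⇒tried {i′} t , J })
        (λ (t , J) → case tried⇒ {i′} t of λ where
          (inj₁ t) → there (Equivalence.from (spec i′ s′) (t , J))
          (inj₂ (refl , refl)) → here refl)

  module Storing (blocks≤cells : base + k * suc n ≤ cells) (blocks≤top : base + k * suc n ≤ top) where

    -- Block number i of the array out lists xs.
    Block : (ℕ → ℕ) → Fin k → List (Fin n) → Set
    Block out i xs =
      out (toℕ i * suc n) ≡ length xs
        × (∀ {j} → j < length xs → out (toℕ i * suc n + suc j) ≡ nth (List.map toℕ xs) j)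

    -- Each block lists the junctions among the vertices tried.
    Stored : (ℕ → ℕ) → (ℕ → ℕ) → Set
    Stored c out = ∀ i → ∃[ xs ] Unique xs
      × (∀ s → s ∈ xs ⇔ (Tried c i s × JunctionOfPair G ps i s)) × Block out i xs

    block-end : ∀ (i : Fin k) {j} → j ≤ n → base + (toℕ i * suc n + j) < base + k * suc n
    block-end i {j} j≤n = +-monoʳ-< base (begin-strict
      toℕ i * suc n + j      <⟨ +-monoʳ-< (toℕ i * suc n) (s≤s j≤n) ⟩
      toℕ i * suc n + suc n  ≡⟨ +-comm (toℕ i * suc n) (suc n) ⟩
      suc (toℕ i) * suc n    ≤⟨ *-monoˡ-≤ (suc n) (toℕ<n i) ⟩
      k * suc n              ∎)
      where open ≤-Reasoning

    blocks-injective : ∀ {i i′ : Fin k} {j j′} → j ≤ n → j′ ≤ n →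
      toℕ i * suc n + j ≡ toℕ i′ * suc n + j′ → i ≡ i′ × j ≡ j′
    blocks-injective {i} {i′} {j} {j′} j≤ j′≤ eq
      with *+-injective (suc n) (toℕ i) (toℕ i′) (s≤s j≤) (s≤s j′≤)
             (trans (cong (_+ j) (*-comm (suc n) (toℕ i))) (trans eq (cong (_+ j′) (*-comm (toℕ i′) (suc n)))))
    ... | p , q = toℕ-injective p , q

    -- The effect of storing s in block i: xs and l are the contents and the size of
    -- the block so far.
    module Emission (c out : ℕ → ℕ) {x} (i : Fin k) (s : Fin n)
      (c-i : c (toℕ i) ≡ x) (x<cnt : x < cnt) (x-is-s : nm x ≡ toℕ s)
      (J : JunctionOfPair G ps i s) (S : Stored c out) where

      open Try c i s c-i x<cnt x-is-s

      xs : List (Fin n)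
      xs = proj₁ (S i)

      a l : ℕ
      a = toℕ i * suc n
      l = length xs

      out₁ out₂ : ℕ → ℕ
      out₁ = out [ a ↦ suc l ]
      out₂ = out₁ [ a + suc l ↦ toℕ s ]

      s∉xs : s ∉ xs
      s∉xs p = untried (proj₁ (Equivalence.to (proj₁ (proj₂ (proj₂ (S i))) s) p))

      xs! : Unique xs
      xs! = proj₁ (proj₂ (S i))

      xs∷ʳs! : Unique (xs ++ s ∷ [])
      xs∷ʳs! = Unique.++⁺ xs! ([] ∷ []) λ { (p , here refl) → s∉xs p }

      -- The block has room for n junctions.
      l<n : suc l ≤ n
      l<n = Unique⇒length≤ {xs = s ∷ xs} (¬Any⇒All¬ _ s∉xs ∷ xs!)

      offset-0 : ∀ (i′ : Fin k) → toℕ i′ * suc n ≡ toℕ i′ * suc n + 0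
      offset-0 i′ = sym (+-identityʳ _)

      out₂-there : ∀ i′ {j} → j ≤ n → i′ ≢ i → out₂ (toℕ i′ * suc n + j) ≡ out (toℕ i′ * suc n + j)
      out₂-there i′ j≤n i′≢i =
        trans (↦-there out₁ (toℕ s) λ eq → i′≢i (proj₁ (blocks-injective {i′} {i} j≤n l<n eq)))
              (↦-there out (suc l) λ eq → i′≢i (proj₁ (blocks-injective {i′} {i} j≤n z≤n (trans eq (offset-0 i)))))

      stored : Stored c′ out₂
      stored i′ with i′ ≟ᶠ i
      ... | no i′≢i = let ys , ys! , spec , B = S i′ in ys , ys! ,
        (λ s′ → mk⇔
          (λ p → let t , J = Equivalence.to (spec s′) p in old⇒tried {i′} t , J)
          (λ (t , J) → case tried⇒ {i′} t of λ where
            (inj₁ t) → Equivalence.from (spec s′) (t , J)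
            (inj₂ (eq , _)) → contradiction eq i′≢i)) ,
        trans (trans (cong out₂ (offset-0 i′))
                (trans (out₂-there i′ z≤n i′≢i) (cong out (sym (offset-0 i′))))) (proj₁ B) ,
        λ j< → trans (out₂-there i′ (≤-trans j< (Unique⇒length≤ ys!)) i′≢i) (proj₂ B j<)
      ... | yes refl = xs ++ s ∷ [] , xs∷ʳs! , spec′ , count , entries
        where
        spec = proj₁ (proj₂ (proj₂ (S i)))
        B = proj₂ (proj₂ (proj₂ (S i)))
        spec′ : ∀ s′ → s′ ∈ (xs ++ s ∷ []) ⇔ (Tried c′ i s′ × JunctionOfPair G ps i s′)
        spec′ s′ = mk⇔
          (λ p → case ∈-++⁻ xs p of λ where
            (inj₁ p) → let t , J = Equivalence.to (spec s′) p in old⇒tried {i} t , J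
            (inj₂ (here refl)) → new-tried , J)
          (λ (t , J) → case tried⇒ {i} t of λ where
            (inj₁ t) → ∈-++⁺ˡ (Equivalence.from (spec s′) (t , J))
            (inj₂ (_ , refl)) → ∈-++⁺ʳ xs (here refl))
        length-∷ʳ : length (xs ++ s ∷ []) ≡ suc l
        length-∷ʳ = trans (length-++ xs) (+-comm l 1)
        count : out₂ a ≡ length (xs ++ s ∷ [])
        count = trans (↦-there out₁ (toℕ s) (m≢1+m+n′ a l)) (trans (↦-here out a (suc l)) (sym length-∷ʳ))
          where
          m≢1+m+n′ : ∀ a l → a ≢ a + suc l
          m≢1+m+n′ a l = <⇒≢ (m<m+n a (s≤s z≤n))
        entries : ∀ {j} → j < length (xs ++ s ∷ []) → out₂ (a + suc j) ≡ nth (List.map toℕ (xs ++ s ∷ [])) j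
        entries {j} j< rewrite map-++ toℕ xs (s ∷ []) with m<1+n⇒m<n∨m≡n (subst (j <_) length-∷ʳ j<)
        ... | inj₂ refl = trans (↦-here out₁ (a + suc l) (toℕ s))
                (sym (subst (λ z → nth (List.map toℕ xs ++ toℕ s ∷ []) z ≡ toℕ s) (length-map toℕ xs)
                  (nth-∷ʳ-length (List.map toℕ xs) (toℕ s))))
        ... | inj₁ j<l = trans (↦-there out₁ (toℕ s) λ eq → <⇒≢ j<l (suc-injective (+-cancelˡ-≡ a _ _ eq)))
                (trans (↦-there out (suc l) (<⇒≢ (m<m+n a (s≤s z≤n)) ∘ sym))
                (trans (proj₂ B j<l) (sym (nth-++ˡ (List.map toℕ xs) _ (subst (j <_) (sym (length-map toℕ xs)) j<l)))))

    storer : Emitter storing λ out _ → ∀ i → ∃[ xs ] Unique xs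
      × (∀ s → s ∈ xs ⇔ JunctionOfPair G ps i s) × Block out i xs
    storer = record
      { Emits = λ c out _ → Stored c out
      ; emit-run = λ { {c} {out} {o} {i₀ = i₀} {b = b} {x = x} i s toℕ-i c-i x<cnt x-is-s nm₀x J S →
          let open Emission c out i s c-i x<cnt x-is-s J S
              len<n = l<n in
          block-then (ev-block-address i toℕ-i) (address< i z≤n (offset-0 i))
            (ev-suc (ev-block (ev-block-address i toℕ-i) (address< i z≤n (offset-0 i))
                      (proj₁ (proj₂ (proj₂ (proj₂ (S i)))))
                      (≤-trans (≤-trans (n≤1+n _) len<n) n≤top)) (≤-trans len<n n≤top))
          (run-block
            (subst (Ev _ _) (+-assoc base a (suc l))
              (ev-⊕ (ev-block-address i toℕ-i)
                (ev-block (ev-block-address i toℕ-i) (address< i z≤n (offset-0 i)) (↦-here out a (suc l))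
                  (≤-trans len<n n≤top))
                (subst (_≤ top) (sym (+-assoc base a (suc l))) (≤-trans (<⇒≤ (block-end i len<n)) blocks≤top))))
            (<-≤-trans (block-end i len<n) blocks≤cells)
            (ev-cell (ev-reg (≤-trans (<⇒≤ x<cnt) cnt≤top)) (≤-trans (<⇒≤ x<cnt) cnt≤) (trans nm₀x x-is-s)
              (≤-trans (<⇒≤ (toℕ<n s)) n≤top))
            (out₂ , o , refl , stored)) }
      ; emit-skip = λ {c} i s c-i x<cnt x-is-s ¬J S i′ → let
            open Try c i s c-i x<cnt x-is-s
            ys , ys! , spec , B = S i′ in
          ys , ys! , (λ s′ → mk⇔
            (λ p → let t , J = Equivalence.to (spec s′) p in old⇒tried {i′} t , J)
            (λ (t , J) → case tried⇒ {i′} t of λ where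
              (inj₁ t) → Equivalence.from (spec s′) (t , J)
              (inj₂ (refl , refl)) → contradiction J ¬J)) , B
      ; emit-start = λ i → [] , [] , (λ s → mk⇔ (λ ()) λ { ((_ , () , _) , _) }) , refl , λ ()
      ; emit-end = λ {c} done S i → let xs , xs! , spec , B = S i in xs , xs! ,
          (λ s → mk⇔ (λ p → proj₂ (Equivalence.to (spec s) p))
                     (λ J → Equivalence.from (spec s) (all-tried c {i} done J , J))) , B
      }
      where
      address< : ∀ (i : Fin k) {j a} → j ≤ n → a ≡ toℕ i * suc n + j → base + a < cells
      address< i j≤n refl = <-≤-trans (block-end i j≤n) blocks≤cells
      ev-block-address : ∀ {r1 r2 i₀ r4 r5 r6 b rs As o} (i : Fin k) → toℕ i ≡ i₀ + b →
        Ev (reg 0 ⊕ (reg 3 ⊕ reg 7) ⊗ (#vertices ⊕ lit 1))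
           (st (base ∷ r1 ∷ r2 ∷ i₀ ∷ r4 ∷ r5 ∷ r6 ∷ b ∷ rs) As o) (base + toℕ i * suc n)
      ev-block-address {i₀ = i₀} {b = b} i eq rewrite eq =
        ev-⊕ (ev-reg {r = 0} base≤top)
          (ev-⊗ (ev-⊕ (ev-reg {r = 3} (≤-trans (m≤m+n i₀ b) ib≤top))
                      (ev-reg {r = 7} (≤-trans (m≤n+m b i₀) ib≤top)) ib≤top)
                (ev-suc ev-#vertices 1+n≤top)
                (≤-trans (m≤n+m _ base) a≤top))
          a≤top
        where
        ib<k : i₀ + b < k
        ib<k = subst (_< k) eq (toℕ<n i)
        ib≤top : i₀ + b ≤ top
        ib≤top = ≤-trans (<⇒≤ ib<k) (≤-trans (m≤m+n k m) k+m≤top)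
        a≤top : base + (i₀ + b) * suc n ≤ top
        a≤top = ≤-trans (+-monoʳ-≤ base (*-monoˡ-≤ (suc n) (<⇒≤ ib<k))) blocks≤top
        1+n≤top : suc n ≤ top
        1+n≤top = begin
          suc n                    ≡⟨ *-identityˡ (suc n) ⟨
          1 * suc n                ≤⟨ *-monoˡ-≤ (suc n) (≤-trans (s≤s z≤n) ib<k) ⟩
          k * suc n                ≤⟨ m≤n+m (k * suc n) base ⟩
          base + k * suc n         ≤⟨ blocks≤top ⟩
          top                      ∎
          where open ≤-Reasoning

------------------------------------------------------------------------
-- The whole program

at-replicate : ∀ {A : Set} (d : A) l i → at d (List.replicate l d) i ≡ d
at-replicate d zero    i       = refl
at-replicate d (suc l) zero    = refl
at-replicate d (suc l) (suc i) = at-replicate d l i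

-- The initial state, with registers 0, …, 13 and arrays 0, …, 8.
start : AState
start = st (List.replicate 14 0) (List.replicate 9 none) []

-- A number of batches of m pairs that suffices for k pairs.
batch-count : ∀ k m → m ≢ 0 → ∃[ q ] k ≤ q * m × q * m ≤ k + m
batch-count k zero    m≢0 = contradiction refl m≢0
batch-count k (suc m) _   = suc (k / suc m) , upper , lower
  where
  open ≤-Reasoning
  upper : k ≤ suc m + k / suc m * suc m
  upper = begin
    k                                  ≡⟨ m≡m%n+[m/n]*n k (suc m) ⟩
    k % suc m + k / suc m * suc m      ≤⟨ +-monoˡ-≤ (k / suc m * suc m) (<⇒≤ (m%n<n k (suc m))) ⟩
    suc m + k / suc m * suc m          ∎
  lower : suc m + k / suc m * suc m ≤ k + suc m
  lower = begin
    suc m + k / suc m * suc m  ≤⟨ +-monoʳ-≤ (suc m) (m/n*n≤m k (suc m)) ⟩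
    suc m + k                  ≡⟨ +-comm (suc m) k ⟩
    k + suc m                  ∎

some-vertex : ∀ {n m} → DAG n m → m ≢ 0 → 1 ≤ n
some-vertex {m = zero}  G m≢0 = contradiction refl m≢0
some-vertex {n} {suc m} G _   = ≤-trans (s≤s z≤n) (toℕ<n (tailOf G zero))

no-junctions : ∀ {n m} (G : DAG n m) → m ≡ 0 → ∀ {u v s} → ¬ Junction G u v s
no-junctions G refl (u≢v , P , Q , _) = u≢v (trans (sym (stuck (Path.walk P))) (stuck (Path.walk Q)))
  where
  stuck : ∀ {s u} → Star (DAG.Arc G) s u → s ≡ u
  stuck ε       = refl
  stuck (a ◅ _) with number-of G a
  ... | () , _

-- The time for numbering and sorting, and for q batches.
phases-time : ℕ → ℕ → ℕ → ℕ
phases-time n m q =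
  2 + (m + m) * (8 + 2 * n) +
  (2 + n * (6 + m * 11) +
  (2 + q * suc (6 + m * (12 + 4 * n) + n * (12 + m * 24))))

-- Numbering and sorting take at most 45 n m steps, and a batch 59 n m.
phases-time≤ : ∀ n m k q → 1 ≤ n → 1 ≤ m → q * m ≤ k + m → 2 + phases-time n m q ≤ 104 * (n * (m + k))
phases-time≤ (suc n) (suc m) k q _ _ qm≤ = begin
  2 + phases-time (suc n) (suc m) q
    ≤⟨ m≤m+n _ (extra n m + q * extra′ n m) ⟩
  2 + phases-time (suc n) (suc m) q + (extra n m + q * extra′ n m)
    ≡⟨ split n m q ⟩
  45 * (suc n * suc m) + 59 * (suc n * (q * suc m))
    ≤⟨ +-mono-≤ (*-monoʳ-≤ 45 (*-monoʳ-≤ (suc n) (m≤m+n (suc m) k)))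
                (*-monoʳ-≤ 59 (*-monoʳ-≤ (suc n) (≤-trans qm≤ (≤-reflexive (+-comm k (suc m)))))) ⟩
  45 * (suc n * (suc m + k)) + 59 * (suc n * (suc m + k))
    ≡⟨ *-distribʳ-+ (suc n * (suc m + k)) 45 59 ⟨
  104 * (suc n * (suc m + k)) ∎
  where
  open ≤-Reasoning
  -- The differences between the two sides of the estimate, which have
  -- nonnegative coefficients in n and m.
  extra extra′ : ℕ → ℕ → ℕ
  extra n m  = 24 * n + 14 * m + 30 * (n * m)
  extra′ n m = 19 * n + 19 * m + 31 * (n * m)
  split : ∀ n m q →
    2 + (2 + (suc m + suc m) * (8 + 2 * suc n) +
        (2 + suc n * (6 + suc m * 11) +
        (2 + q * suc (6 + suc m * (12 + 4 * suc n) + suc n * (12 + suc m * 24)))))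
      + (24 * n + 14 * m + 30 * (n * m) + q * (19 * n + 19 * m + 31 * (n * m))) ≡
    45 * (suc n * suc m) + 59 * (suc n * (q * suc m))
  split = solve-∀

-- A bound for the numbers that occur: its summands bound the addresses below the
-- blocks, those within the blocks, the vertices, the numbers of pairs, and the
-- input positions.
top-value : ℕ → ℕ → ℕ → ℕ
top-value n m k = 8 * suc (m + m) + k * suc n + n + (k + m) + (3 + (m + m + (k + k)))

top-value<wordBound : ∀ {K} → 104 ≤ K → ∀ n m k → top-value n m k < wordBound K n m k
top-value<wordBound {K} 104≤K n m k = begin-strict
  top-value n m k        <⟨ m<m+n _ {extra n m k} (s≤s z≤n) ⟩
  top-value n m k + extra n m k  ≡⟨ split n m k ⟩
  20 * N + N * N         ≤⟨ +-monoˡ-≤ (N * N) (*-monoˡ-≤ N (≤-trans (m≤m+n 20 12) (*-monoʳ-≤ 16 2≤N))) ⟩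
  16 * N * N + N * N     ≤⟨ m≤m+n _ (15 * N * N) ⟩
  16 * N * N + N * N + 15 * N * N  ≡⟨ collect N ⟩
  2 ^ 5 * N ^ 2          ≤⟨ *-monoˡ-≤ (N ^ 2) (^-monoˡ-≤ 5 2≤N) ⟩
  N ^ 5 * N ^ 2          ≡⟨ ^-distribˡ-+-* N 5 2 ⟨
  N ^ 7                  ≤⟨ ^-monoʳ-≤ N {{>-nonZero (≤-trans (s≤s z≤n) 2≤N)}} (≤-trans (m≤m+n 7 97) 104≤K) ⟩
  N ^ K                  ∎
  where
  open ≤-Reasoning
  N : ℕ
  N = n + m + k + 2
  2≤N : 2 ≤ N
  2≤N = m≤n+m 2 (n + m + k)
  -- The difference between the two sides of the second step.
  extra : ℕ → ℕ → ℕ → ℕ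
  extra n m k = 33 + 23 * n + 5 * m + 20 * k + (n * n + m * m + k * k + 2 * (n * m) + n * k + 2 * (m * k))
  split : ∀ n m k → 8 * suc (m + m) + k * suc n + n + (k + m) + (3 + (m + m + (k + k)))
      + (33 + 23 * n + 5 * m + 20 * k + (n * n + m * m + k * k + 2 * (n * m) + n * k + 2 * (m * k))) ≡
    20 * (n + m + k + 2) + (n + m + k + 2) * (n + m + k + 2)
  split = solve-∀
  collect : ∀ N → 16 * N * N + N * N + 15 * N * N ≡ 32 * (N * (N * 1))
  collect = solve-∀

fits : ∀ {K n m k cells} → 104 ≤ K → 8 * suc (m + m) ≤ cells →
  Fits n m k cells (wordBound K n m k) (top-value n m k)
fits {K} {n} {m} {k} 104≤K room = record
  { room       = room
  ; base≤top   = ≤-trans (m≤m+n a b) (≤-trans (m≤m+n _ n) (≤-trans (m≤m+n _ (k + m)) (m≤m+n _ d)))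
  ; top<W      = top-value<wordBound 104≤K n m k
  ; n≤top      = ≤-trans (m≤n+m n (a + b)) (≤-trans (m≤m+n _ (k + m)) (m≤m+n _ d))
  ; k+m≤top    = ≤-trans (m≤n+m (k + m) (a + b + n)) (m≤m+n _ d)
  ; input-fits = m≤n+m d (a + b + n + (k + m))
  }
  where
  a b d : ℕ
  a = 8 * suc (m + m)
  b = k * suc n
  d = 3 + (m + m + (k + k))

-- The program for a given command that emits the junctions.
module Whole {n m k : ℕ} (G : DAG n m) (ps : Pairs n k) {cells W top : ℕ} (sizes : Fits n m k cells W top)
  (emit : Cmd) (Goal : (ℕ → ℕ) → List (ℕ × ℕ) → Set)
  (emitter : ∀ {cnt nm sl} (cnt≤ : cnt ≤ m + m) (ν : Numbering G cnt nm sl)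
     {e ord flag} (P : Sorting.Prefix (Slots.tl G ν) (Slots.hd G ν) m e ord flag)
     (all : ∀ {a} → a < m → flag a ≢ 0) → BatchRun.Emitter G ps sizes cnt≤ ν P all emit Goal)
  (no-arcs : m ≡ 0 → Goal none []) where

  open Execution G ps sizes public

  Post : AState → Set
  Post s = at 0 (regs s) 0 ≡ base × Goal (at none (arrays s) 8) (events s)

  ev-base : Ev (lit 8 ⊗ (lit 1 ⊕ (#arcs ⊕ #arcs))) start base
  ev-base = ev-⊗ (ev-lit 8≤top) (ev-⊕ (ev-lit (≤-trans (s≤s z≤n) 8≤top)) ev-2#arcs
    (≤-trans (m≤n*m (suc (m + m)) 8) base≤top)) base≤top

  program-run : m ≢ 0 → ∀ q → k ≤ q * m → Run (program emit) start (2 + phases-time n m q) Post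
  program-run m≢0 q k≤qm = assign-then ev-base (run-if ev-#arcs
    (λ _ → run-seq (2 + (m + m) * (8 + 2 * n)) number-run λ { (cnt , nm , sl , cnt≤ , ν , _ , _ , _ , refl) →
      run-seq (2 + n * (6 + m * 11)) (SortRun.sort-run G ps sizes cnt≤ ν) λ {
        (e , ord , flag , mk , _ , _ , refl , P , all) →
        BatchRun.Emitting.batches-run G ps sizes cnt≤ ν P all (emitter cnt≤ ν P all) q k≤qm } })
    (λ m≡0 → contradiction m≡0 m≢0))

  program-run-no-arcs : m ≡ 0 → Run (program emit) start 3 Post
  program-run-no-arcs m≡0 = assign-then ev-base (run-if ev-#arcs
    (λ m≢0 → contradiction m≡0 m≢0)
    (λ _ → run-skip (refl , no-arcs m≡0)))

  initial-rel : Rel initial start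
  initial-rel = record
    { rel-regs   = λ r → sym (at-replicate 0 14 r)
    ; rel-cells  = λ f i _ _ → cong (_$ i) (sym (at-replicate none 9 f))
    ; rel-blocks = λ _ → refl
    ; rel-events = refl
    }

  open Machine (encode G ps) cells W

  Halts : ℕ → Set
  Halts T = ∃[ t ] ∃[ σ ] ∃[ s ] (program emit , initial ⇓[ t ] σ) × t ≤ T × Rel σ s × Post s

  halts-within : ∀ {t₀ T} → t₀ ≤ T → Run (program emit) start t₀ Post → Halts T
  halts-within t₀≤T X = let t , σ , s , run , t≤ , R , post = Run.exec X initial-rel in
    t , σ , s , run , ≤-trans t≤ t₀≤T , R , post

  halts : ∀ {K} → 104 ≤ K → Halts (K ·O (n * (m + k)))
  halts {K} 104≤K = by-cases (m ≟ 0)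
    where
    open ≤-Reasoning
    short : 3 ≤ K ·O (n * (m + k))
    short = begin
      3                     ≤⟨ ≤-trans (m≤m+n 3 101) 104≤K ⟩
      K                     ≡⟨ *-identityʳ K ⟨
      K * 1                 ≤⟨ *-monoʳ-≤ K (m≤n+m 1 _) ⟩
      K ·O (n * (m + k))    ∎
    long : m ≢ 0 → ∀ q → q * m ≤ k + m → 2 + phases-time n m q ≤ K ·O (n * (m + k))
    long m≢0 q qm≤ = begin
      2 + phases-time n m q   ≤⟨ phases-time≤ n m k q (some-vertex G m≢0) (n≢0⇒n>0 m≢0) qm≤ ⟩
      104 * (n * (m + k))     ≤⟨ *-monoˡ-≤ (n * (m + k)) 104≤K ⟩
      K * (n * (m + k))       ≤⟨ *-monoʳ-≤ K (m≤m+n _ 1) ⟩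
      K ·O (n * (m + k))      ∎
    by-cases : Dec (m ≡ 0) → Halts (K ·O (n * (m + k)))
    by-cases (yes m≡0) = halts-within short (program-run-no-arcs m≡0)
    by-cases (no m≢0) = let q , k≤qm , qm≤ = batch-count k m m≢0 in
      halts-within (long m≢0 q qm≤) (program-run m≢0 q k≤qm)

module PrintingProgram {K n m k : ℕ} (104≤K : 104 ≤ K) (G : DAG n m) (ps : Pairs n k) where

  room : 8 * suc (m + m) ≤ K ·O m
  room = begin
    8 * suc (m + m)                  ≤⟨ m≤m+n _ (96 + 88 * m) ⟩
    8 * suc (m + m) + (96 + 88 * m)  ≡⟨ eq m ⟩
    104 * (m + 1)                    ≤⟨ *-monoˡ-≤ (m + 1) 104≤K ⟩
    K ·O m                           ∎
    where
    open ≤-Reasoning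
    eq : ∀ m → 8 * suc (m + m) + (96 + 88 * m) ≡ 104 * (m + 1)
    eq = solve-∀

  sizes : Fits n m k (K ·O m) (wordBound K n m k) (top-value n m k)
  sizes = fits 104≤K room

  Goal : (ℕ → ℕ) → List (ℕ × ℕ) → Set
  Goal _ o = ∃[ xs ] Unique xs × (∀ i s → (i , s) ∈ xs ⇔ JunctionOfPair G ps i s)
    × o ≡ List.map (λ (i , s) → toℕ i , toℕ s) xs

  open Whole G ps sizes printing Goal (λ cnt≤ ν P all → Emitters.printer G ps sizes cnt≤ ν P all)
    (λ m≡0 → [] , [] , (λ i s → mk⇔ (λ ()) λ J → contradiction J (no-junctions G m≡0)) , refl)

  prints : Solves (program printing) K (K ·O (n * (m + k))) (K ·O m) G ps (PrintsJunctions G ps)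
  prints =
    let t , σ , s , run , t≤ , R , _ , xs , xs! , spec , eq = halts 104≤K in
    t , σ , run , t≤ , xs , xs! , spec , trans (Rel.rel-events R) eq

module StoringProgram {K n m k : ℕ} (104≤K : 104 ≤ K) (G : DAG n m) (ps : Pairs n k) where

  b : ℕ
  b = 8 * suc (m + m)

  -- If there is a pair, there is a vertex.
  k≤nk : ∀ {k} → Pairs n k → k ≤ n * k
  k≤nk Vec.[]                = z≤n
  k≤nk {k} ((u , _) Vec.∷ _) = m≤n*m k n {{>-nonZero (≤-trans (s≤s z≤n) (toℕ<n u))}}

  blocks≤cells : b + k * suc n ≤ K ·O (n * k + m)
  blocks≤cells = begin
    b + k * suc n                                        ≡⟨ cong (b +_) (trans (*-suc k n) (cong (k +_) (*-comm k n))) ⟩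
    b + (k + n * k)                                      ≤⟨ +-monoʳ-≤ b (+-monoˡ-≤ (n * k) (k≤nk ps)) ⟩
    b + (n * k + n * k)                                  ≤⟨ m≤m+n _ (96 + 88 * m + 102 * (n * k)) ⟩
    b + (n * k + n * k) + (96 + 88 * m + 102 * (n * k))  ≡⟨ eq m (n * k) ⟩
    104 * (n * k + m + 1)                                ≤⟨ *-monoˡ-≤ (n * k + m + 1) 104≤K ⟩
    K ·O (n * k + m)                                     ∎
    where
    open ≤-Reasoning
    eq : ∀ m x → 8 * suc (m + m) + (x + x) + (96 + 88 * m + 102 * x) ≡ 104 * (x + m + 1)
    eq = solve-∀

  blocks≤top : b + k * suc n ≤ top-value n m k
  blocks≤top = ≤-trans (m≤m+n _ n) (≤-trans (m≤m+n _ (k + m)) (m≤m+n _ _))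

  sizes : Fits n m k (K ·O (n * k + m)) (wordBound K n m k) (top-value n m k)
  sizes = fits 104≤K (≤-trans (m≤m+n b (k * suc n)) blocks≤cells)

  Goal : (ℕ → ℕ) → List (ℕ × ℕ) → Set
  Goal out _ = ∀ (i : Fin k) → ∃[ xs ] Unique xs × (∀ s → s ∈ xs ⇔ JunctionOfPair G ps i s)
    × out (toℕ i * suc n) ≡ length xs
    × (∀ {j} → j < length xs → out (toℕ i * suc n + suc j) ≡ nth (List.map toℕ xs) j)

  open Whole G ps sizes storing Goal
    (λ cnt≤ ν P all → Emitters.Storing.storer G ps sizes cnt≤ ν P all blocks≤cells blocks≤top)
    (λ m≡0 i → [] , [] , (λ s → mk⇔ (λ ()) λ J → contradiction J (no-junctions G m≡0)) , refl , λ ())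

  layout : ∀ {σ s} → Rel σ s → ∀ {r} → r ≡ b → Goal (at none (arrays s) 8) (events s) → ∀ i →
    ∃[ xs ] Unique xs × (∀ s → s ∈ xs ⇔ JunctionOfPair G ps i s)
      × memory σ (r + toℕ i * suc n) ≡ length xs
      × (∀ j → memory σ (suc (r + toℕ i * suc n) + toℕ j) ≡ toℕ (List.lookup xs j))
  layout {σ} R refl goal i =
    let xs , xs! , spec , count , entries = goal i in
    xs , xs! , spec , trans (Rel.rel-blocks R _) count ,
      λ j → trans (cong (memory σ) (shift b (toℕ i * suc n) (toℕ j)))
        (trans (Rel.rel-blocks R _) (trans (entries (toℕ<n j)) (nth-map-toℕ xs j)))
    where
    shift : ∀ b a j → suc (b + a) + j ≡ b + (a + suc j)
    shift = solve-∀

  stores : Solves (program storing) K (K ·O (n * (m + k))) (K ·O (n * k + m)) G ps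
    (StoresJunctions G ps (K ·O (n * k + m)))
  stores =
    let t , σ , s , run , t≤ , R , r0 , goal = halts 104≤K
        base-eq = trans (Rel.rel-regs R 0) r0 in
    t , σ , run , t≤ , subst (λ r → r + k * suc n ≤ K ·O (n * k + m)) (sym base-eq) blocks≤cells ,
      layout R base-eq goal

-- The constant 104 is 45 + 59, from the time bound; it leaves ample room for the
-- memory and the words.
mainTheorem2 :
    (∃[ prog ] ∃[ K ] (∀ {n m k : ℕ} (G : DAG n m) (ps : Pairs n k) →
      let time  = K ·O (n * (m + k))
          cells = K ·O m
      in Solves prog K time cells G ps (PrintsJunctions G ps)))
    ×
    (∃[ prog ] ∃[ K ] (∀ {n m k : ℕ} (G : DAG n m) (ps : Pairs n k) →
      let time  = K ·O (n * (m + k))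
          cells = K ·O (n * k + m)
      in Solves prog K time cells G ps (StoresJunctions G ps cells)))
mainTheorem2 =
  (program printing , 104 , PrintingProgram.prints ≤-refl) ,
  (program storing , 104 , StoringProgram.stores ≤-refl)
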